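{- For each fixed integer constant $p > 2$, the decision version of MaxCover restricted to instances in which every element belongs to at most $p$ sets of ${\mathcal{S}}$ is ${\mathrm{W[1]}}$-complete when parametrized by $K$.
   Context: An instance of the decision version of MaxCover is $(N,{\mathcal{S}},K,L)$: a finite set $N$ of $n$ elements, a family ${\mathcal{S}}=\{S_1,\dots,S_m\}$ of subsets of $N$, and nonnegative integers $K$ and $L$. The question is whether there is a subcollection ${\mathcal{C}}\subseteq{\mathcal{S}}$ with $|{\mathcal{C}}|\le K$ and $|\bigcup_{S\in{\mathcal{C}}}S|\ge L$. The frequency of an element $e$ is the number of sets of ${\mathcal{S}}$ containing $e$. ${\mathrm{W[1]}}$ is the class of parametrized problems admitting a parametrized (FPT) reduction to Clique parametrized by the clique size. -}

module Defs where

open import Data.Bool using (Bool; true; false; if_then_else_)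
open import Data.Fin using (Fin)
open import Data.Fin.Subset using (Subset; inside; outside; ∣_∣; ⋃; _∈_)
open import Data.Fin.Subset.Properties using (_∈?_)
open import Data.List as List using (List; []; _∷_)
open import Data.Nat using (ℕ; suc; _+_; _*_; _∸_; _^_; _≤_)
open import Data.Nat.Logarithm using (⌊log₂_⌋)
open import Data.Product using (Σ-syntax; ∃-syntax; _×_)
open import Data.Vec as Vec using (Vec; []; _∷_)
open import Function.Bundles using (_⇔_)
open import Relation.Binary.PropositionalEquality using (_≡_; _≢_)

-- Programs transform binary trees with natural numbers at the leaves.
-- Numbers are measured by their binary length, and every primitive step
-- is charged the full size of its argument and of its result.  Running
-- time is therefore polynomially related to Turing-machine time, and no
-- program can produce an output larger than its running time.

data Val : Set where
  num : ℕ → Val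
  _∙_ : Val → Val → Val

infixr 5 _∙_

size : Val → ℕ
size (num n) = suc ⌊log₂ n ⌋
size (u ∙ v) = suc (size u + size v)

data Prim : Set where
  ident left right isNum add monus mult : Prim
  const : ℕ → Prim

-- Primitives are total: on an argument of the wrong shape the result is num 0.
apply : Prim → Val → Val
apply ident     v               = v
apply left      (u ∙ v)         = u
apply right     (u ∙ v)         = v
apply isNum     (num _)         = num 1
apply add       (num a ∙ num b) = num (a + b)
apply monus     (num a ∙ num b) = num (a ∸ b)
apply mult      (num a ∙ num b) = num (a * b)
apply (const c) _               = num c
apply _         _               = num 0

data Prog : Set where
  prim  : Prim → Prog
  _⨾_   : Prog → Prog → Prog
  ⟨_,_⟩ : Prog → Prog → Prog
  cond  : Prog → Prog → Prog → Prog
  while : Prog → Prog → Prog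

infixr 6 _⨾_

-- P ⊢ v ⇓ w ∣ t : the program P halts on input v with output w in time t.
-- num 0 is the false value of tests; every other value is true.
infix 4 _⊢_⇓_∣_
data _⊢_⇓_∣_ : Prog → Val → Val → ℕ → Set where
  run-prim  : ∀ {o v} →
              prim o ⊢ v ⇓ apply o v ∣ size v + size (apply o v)
  run-seq   : ∀ {P Q u v w s t} →
              P ⊢ u ⇓ v ∣ s → Q ⊢ v ⇓ w ∣ t →
              P ⨾ Q ⊢ u ⇓ w ∣ suc (s + t)
  run-pair  : ∀ {P Q u v w s t} →
              P ⊢ u ⇓ v ∣ s → Q ⊢ u ⇓ w ∣ t →
              ⟨ P , Q ⟩ ⊢ u ⇓ v ∙ w ∣ suc (s + t)
  run-then  : ∀ {B P Q u b v s t} →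
              B ⊢ u ⇓ b ∣ s → b ≢ num 0 → P ⊢ u ⇓ v ∣ t →
              cond B P Q ⊢ u ⇓ v ∣ suc (s + t)
  run-else  : ∀ {B P Q u v s t} →
              B ⊢ u ⇓ num 0 ∣ s → Q ⊢ u ⇓ v ∣ t →
              cond B P Q ⊢ u ⇓ v ∣ suc (s + t)
  run-stop  : ∀ {B P u s} →
              B ⊢ u ⇓ num 0 ∣ s →
              while B P ⊢ u ⇓ u ∣ suc s
  run-loop  : ∀ {B P u b v w s t r} →
              B ⊢ u ⇓ b ∣ s → b ≢ num 0 → P ⊢ u ⇓ v ∣ t →
              while B P ⊢ v ⇓ w ∣ r →
              while B P ⊢ u ⇓ w ∣ suc (s + t + r)

Computable : (ℕ → ℕ) → Set
Computable f = Σ[ P ∈ Prog ] (∀ k → ∃[ t ] P ⊢ num k ⇓ num (f k) ∣ t)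

-- A set of pairs (x , k), where k is the parameter.
ParamProblem : Set₁
ParamProblem = Val → ℕ → Set

record _≤fpt_ (A B : ParamProblem) : Set where
  field
    program        : Prog
    f g            : ℕ → ℕ
    c              : ℕ
    f-computable   : Computable f
    g-computable   : Computable g
    reduces        : ∀ x k → ∃[ x′ ] ∃[ k′ ] ∃[ t ]
                       program ⊢ x ∙ num k ⇓ x′ ∙ num k′ ∣ t
                     × t ≤ f k * size (x ∙ num k) ^ c
                     × k′ ≤ g k
                     × (A x k ⇔ B x′ k′)

infix 4 _≤fpt_

listVal : List Val → Val
listVal = List.foldr _∙_ (num 0)

vecVal : ∀ {n} → Vec Val n → Val
vecVal v = listVal (Vec.toList v)

bitVal : Bool → Val
bitVal b = num (if b then 1 else 0)

record Graph : Set where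
  field
    order     : ℕ
    adj       : Fin order → Fin order → Bool
    symmetric : ∀ i j → adj i j ≡ adj j i
    loopless  : ∀ i → adj i i ≡ false

encodeGraph : Graph → Val
encodeGraph G =
  vecVal (Vec.tabulate λ i → vecVal (Vec.tabulate λ j → bitVal (adj i j)))
  where open Graph G

HasClique : Graph → ℕ → Set
HasClique G k = Σ[ Q ∈ Subset order ]
  ∣ Q ∣ ≡ k × (∀ {i j} → i ∈ Q → j ∈ Q → i ≢ j → adj i j ≡ true)
  where open Graph G

Clique : ParamProblem
Clique x k = Σ[ G ∈ Graph ] encodeGraph G ≡ x × HasClique G k

W[1] : ParamProblem → Set
W[1] A = A ≤fpt Clique

W[1]-hard : ParamProblem → Set₁
W[1]-hard A = ∀ (B : ParamProblem) → W[1] B → B ≤fpt A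

W[1]-complete : ParamProblem → Set₁
W[1]-complete A = W[1] A × W[1]-hard A

-- The family is indexed, so a subcollection is a set of indices.
record CoverInstance : Set where
  field
    n m    : ℕ
    family : Vec (Subset n) m
    K L    : ℕ

chosen : ∀ {A : Set} {m} → Vec A m → Subset m → List A
chosen []       []            = []
chosen (S ∷ 𝒮) (inside  ∷ C) = S ∷ chosen 𝒮 C
chosen (S ∷ 𝒮) (outside ∷ C) = chosen 𝒮 C

Coverable : CoverInstance → Set
Coverable I = Σ[ C ∈ Subset m ] ∣ C ∣ ≤ K × L ≤ ∣ ⋃ (chosen family C) ∣
  where open CoverInstance I

frequency : (I : CoverInstance) → Fin (CoverInstance.n I) → ℕ
frequency I e = Vec.count (e ∈?_) (CoverInstance.family I)

-- The ground set is written out element by element, the sets are given by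
-- their characteristic vectors, and L is a binary number.  K is omitted
-- because it is supplied as the parameter.
encodeCover : CoverInstance → Val
encodeCover I =
    vecVal (Vec.replicate n (num 0))
  ∙ vecVal (Vec.map (λ S → vecVal (Vec.map bitVal S)) family)
  ∙ num L
  where open CoverInstance I

MaxCover : ℕ → ParamProblem
MaxCover p x k = Σ[ I ∈ CoverInstance ]
    encodeCover I ≡ x
  × CoverInstance.K I ≡ k
  × (∀ e → frequency I e ≤ p)
  × Coverable I

{-# OPTIONS --safe #-}
module Submission where

-- Hardness.  Given a graph on n vertices, call two vertices close if they are
-- equal or adjacent.  The ground set has two elements for each ordered pair
-- (u , v) of vertices.  If u and v are close, one of them lies in the set of u
-- only and the other in the set of v only; otherwise one lies in both sets and
-- the other in none.  Hence every frequency is at most 2, and k sets cover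
-- 2nk elements minus the number of ordered pairs of chosen vertices that are
-- not close, so they cover 2nk elements exactly when they form a clique.
--
-- Membership.  If k distinct sets are chosen and an element lies in d of them,
-- then d ≤ p, so (1 − d)(2 − d)⋯(p − d) is p! if the element is uncovered and 0
-- otherwise.  Writing q − d as q minus one summand for each chosen set, the
-- product expands into (k + 1)^p terms, each depending on at most p of the
-- chosen sets.  Summed over all elements, the number of uncovered elements
-- becomes a sum of (k + 1)^p weights of polynomial size.  A clique of size
-- (k + 1)^p selects one vertex for each term; a vertex records the at most p
-- sets involved and the sum of the preceding weights, and edges check that
-- the choices are consistent and that consecutive sums differ by the weight.

open import Data.Bool using (Bool; true; false; if_then_else_; _∧_; _∨_; not)
open import Data.Bool.Properties using (T-≡; ∧-comm)
open import Data.Fin as Fin using (Fin; toℕ; fromℕ<)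
open import Data.Fin.Properties using (toℕ<n; toℕ-fromℕ<; toℕ-injective)
open import Data.Fin.Subset using (Subset; inside; outside; ∣_∣; ⋃; _∈_)
open import Data.Fin.Subset.Properties using (_∈?_)
open import Data.List using (applyUpTo)
open import Data.Nat
open import Data.Nat.DivMod
  using (_/_; _%_; [m+n]%n≡m%n; [m+kn]%n≡m%n; m<n⇒m%n≡m; m<n⇒m/n≡0; m%n<n; n/n≡1; m*n/n≡m;
         m≡m%n+[m/n]*n; m<n*o⇒m/o<n; +-distrib-/-∣ˡ; +-distrib-/-∣ʳ)
open import Data.Nat.Divisibility using (∣-refl; m∣m*n)
open import Data.Nat.Logarithm
open import Data.Nat.Properties
open import Data.Nat.Tactic.RingSolver using (solve-∀)
open import Data.Product using (Σ-syntax; ∃-syntax; _×_; _,_; proj₁; proj₂)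
open import Data.Vec as Vec using (Vec; []; _∷_; lookup)
open import Data.Vec.Properties
  using ([]=⇒lookup; lookup⇒[]=; lookup∘tabulate; lookup-zipWith; lookup-replicate)
open import Data.Vec.Relation.Unary.All as All using (All; []; _∷_)
open import Function using (_∘_; id)
open import Function.Bundles using (_⇔_; mk⇔; Equivalence)
open import Function.Construct.Composition using (_⇔-∘_)
open import Function.Construct.Symmetry using (⇔-sym)
open import Relation.Binary.PropositionalEquality
open import Relation.Nullary using (Dec; contradiction; yes; no; does)
open import Defs

-- Adjacency sees only two vertices, while coverage is a global count; carrying partial sums turns
-- the count into tests on pairs. This stays polynomial because each weight has positive and
-- negative part at most n p!, so all partial sums are at most (k + 1)^p n p! and every candidate
-- value can be listed. Subtraction on ℕ truncates, so the two parts are summed separately and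
-- compared only at the last term.
--
-- The product formula needs d ≤ p, which fails if a set is chosen twice. Edges therefore require
-- that equal slots and equal choices go together, and a collection of fewer than k sets is padded
-- with distinct empty ones.
--
-- The parameter arrives in binary, so k may be exponential in the input size. It is first written
-- in unary, at a cost that depends on k up to a polynomial factor; the rest is polynomial in the
-- enlarged input.
--
-- Programs are assembled from combinators that carry meaning, code and time bound together, so
-- running times come by construction and correctness reduces to equations between values. Inputs
-- that encode no instance are recognised by decoding and encoding again.

data Poly : Set where
  X       : Poly
  κ       : ℕ → Poly
  _⊕_ _⊗_ : Poly → Poly → Poly

infixl 6 _⊕_
infixr 8 _∘ₚ_
infixl 7 _⊗_

eval : Poly → ℕ → ℕ
eval X       n = n
eval (κ c)   n = c
eval (p ⊕ q) n = eval p n + eval q n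
eval (p ⊗ q) n = eval p n * eval q n

eval-mono : ∀ p {m n} → m ≤ n → eval p m ≤ eval p n
eval-mono X       m≤n = m≤n
eval-mono (κ c)   m≤n = ≤-refl
eval-mono (p ⊕ q) m≤n = +-mono-≤ (eval-mono p m≤n) (eval-mono q m≤n)
eval-mono (p ⊗ q) m≤n = *-mono-≤ (eval-mono p m≤n) (eval-mono q m≤n)

_∘ₚ_ : Poly → Poly → Poly
X       ∘ₚ r = r
κ c     ∘ₚ r = κ c
(p ⊕ q) ∘ₚ r = p ∘ₚ r ⊕ q ∘ₚ r
(p ⊗ q) ∘ₚ r = p ∘ₚ r ⊗ q ∘ₚ r

eval-∘ : ∀ p r n → eval (p ∘ₚ r) n ≡ eval p (eval r n)
eval-∘ X       r n = refl
eval-∘ (κ c)   r n = refl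
eval-∘ (p ⊕ q) r n = cong₂ _+_ (eval-∘ p r n) (eval-∘ q r n)
eval-∘ (p ⊗ q) r n = cong₂ _*_ (eval-∘ p r n) (eval-∘ q r n)

1≤^ : ∀ {n} d → 1 ≤ n → 1 ≤ n ^ d
1≤^ {n} d 1≤n = subst (_≤ n ^ d) (^-zeroˡ d) (^-monoˡ-≤ d 1≤n)

-- A bound in `_≤fpt_` must have the shape f k * size ^ c. In the sum case both exponents are raised
-- to d + e, which is harmless because n ≥ 1.
poly≤monomial : ∀ p → ∃[ c ] ∃[ d ] (∀ n → 1 ≤ n → eval p n ≤ c * n ^ d)
poly≤monomial X     = 1 , 1 , λ n _ → ≤-reflexive (sym (trans (*-identityˡ (n ^ 1)) (^-identityʳ n)))
poly≤monomial (κ c) = c , 0 , λ n _ → ≤-reflexive (sym (*-identityʳ c))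
poly≤monomial (p ⊕ q) with poly≤monomial p | poly≤monomial q
... | a , d , f | b , e , g = a + b , d + e , bound
  where
  open ≤-Reasoning
  bound : ∀ n → 1 ≤ n → eval p n + eval q n ≤ (a + b) * n ^ (d + e)
  bound n 1≤n = begin
    eval p n + eval q n               ≤⟨ +-mono-≤ (f n 1≤n) (g n 1≤n) ⟩
    a * n ^ d + b * n ^ e             ≤⟨ +-mono-≤
      (*-monoʳ-≤ a (^-monoʳ-≤ n ⦃ >-nonZero 1≤n ⦄ (m≤m+n d e)))
      (*-monoʳ-≤ b (^-monoʳ-≤ n ⦃ >-nonZero 1≤n ⦄ (m≤n+m e d))) ⟩
    a * n ^ (d + e) + b * n ^ (d + e) ≡⟨ *-distribʳ-+ (n ^ (d + e)) a b ⟨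
    (a + b) * n ^ (d + e)             ∎
poly≤monomial (p ⊗ q) with poly≤monomial p | poly≤monomial q
... | a , d , f | b , e , g = a * b , d + e , bound
  where
  open ≤-Reasoning
  bound : ∀ n → 1 ≤ n → eval p n * eval q n ≤ (a * b) * n ^ (d + e)
  bound n 1≤n = begin
    eval p n * eval q n           ≤⟨ *-mono-≤ (f n 1≤n) (g n 1≤n) ⟩
    (a * n ^ d) * (b * n ^ e)     ≡⟨ [m*n]*[o*p]≡[m*o]*[n*p] a (n ^ d) b (n ^ e) ⟩
    (a * b) * (n ^ d * n ^ e)     ≡⟨ cong (a * b *_) (^-distribˡ-+-* n d e) ⟨
    (a * b) * n ^ (d + e)         ∎

-- Sizes of values

1≤size : ∀ v → 1 ≤ size v
1≤size (num n) = s≤s z≤n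
1≤size (u ∙ v) = s≤s z≤n

n<2^n : ∀ n → n < 2 ^ n
n<2^n zero    = s≤s z≤n
n<2^n (suc n) = begin-strict
  suc n           <⟨ s≤s (n<2^n n) ⟩
  1 + 2 ^ n       ≤⟨ +-monoˡ-≤ (2 ^ n) (1≤^ n (s≤s z≤n)) ⟩
  2 ^ n + 2 ^ n   ≡⟨ cong (2 ^ n +_) (+-identityʳ (2 ^ n)) ⟨
  2 ^ suc n       ∎
  where open ≤-Reasoning

log≤ : ∀ n → ⌊log₂ n ⌋ ≤ n
log≤ n = subst (⌊log₂ n ⌋ ≤_) (⌊log₂[2^n]⌋≡n n) (⌊log₂⌋-mono-≤ (<⇒≤ (n<2^n n)))

n≤2*⌊n/2⌋+1 : ∀ n → n ≤ 2 * ⌊ n /2⌋ + 1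
n≤2*⌊n/2⌋+1 zero          = z≤n
n≤2*⌊n/2⌋+1 (suc zero)    = s≤s z≤n
n≤2*⌊n/2⌋+1 (suc (suc n)) = begin
  2 + n                        ≤⟨ +-monoʳ-≤ 2 (n≤2*⌊n/2⌋+1 n) ⟩
  2 + (2 * ⌊ n /2⌋ + 1)        ≡⟨ lemma ⌊ n /2⌋ ⟩
  2 * suc ⌊ n /2⌋ + 1          ∎
  where
  open ≤-Reasoning
  lemma : ∀ h → 2 + (2 * h + 1) ≡ 2 * suc h + 1
  lemma = solve-∀

<2^suc-log : ∀ n → n < 2 ^ suc ⌊log₂ n ⌋
<2^suc-log n = go n n ≤-refl
  where
  open ≤-Reasoning
  go : ∀ f n → n ≤ f → n < 2 ^ suc ⌊log₂ n ⌋
  go f zero          _  = s≤s z≤n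
  go f (suc zero)    _  = s≤s (s≤s z≤n)
  go (suc f) (suc (suc n)) (s≤s n<f) = begin-strict
    2 + n                          ≤⟨ n≤2*⌊n/2⌋+1 (2 + n) ⟩
    2 * h + 1                      <⟨ +-monoʳ-< (2 * h) (s≤s (s≤s z≤n)) ⟩
    2 * h + 2                      ≡⟨ lemma h ⟩
    2 * suc h                      ≤⟨ *-monoʳ-≤ 2 (go f h (≤-trans (s≤s (⌊n/2⌋≤n n)) n<f)) ⟩
    2 * 2 ^ suc ⌊log₂ h ⌋          ≡⟨ cong (λ e → 2 * 2 ^ e) log-h ⟩
    2 ^ suc ⌊log₂ 2 + n ⌋          ∎
    where
    h = ⌊ 2 + n /2⌋
    lemma : ∀ h → 2 * h + 2 ≡ 2 * suc h
    lemma = solve-∀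
    log-h : suc ⌊log₂ h ⌋ ≡ ⌊log₂ 2 + n ⌋
    log-h = trans (cong suc (⌊log₂⌊n/2⌋⌋≡⌊log₂n⌋∸1 (2 + n)))
                  (m+[n∸m]≡n {1} (⌊log₂⌋-mono-≤ {2} {2 + n} (s≤s (s≤s z≤n))))

-- Serves sums and products alike: both are at most the product of the powers of two just above a
-- and b, and the logarithm turns that product into a sum of lengths.
log-bound : ∀ a b c → c ≤ 2 ^ suc ⌊log₂ a ⌋ * 2 ^ suc ⌊log₂ b ⌋ →
            size (num c) ≤ suc (size (num a) + size (num b))
log-bound a b c c≤ = s≤s (subst (⌊log₂ c ⌋ ≤_)
  (⌊log₂[2^n]⌋≡n (suc ⌊log₂ a ⌋ + suc ⌊log₂ b ⌋))
  (⌊log₂⌋-mono-≤ (subst (c ≤_) (sym (^-distribˡ-+-* 2 (suc ⌊log₂ a ⌋) _)) c≤)))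

size-+ : ∀ a b → size (num (a + b)) ≤ suc (size (num a) + size (num b))
size-+ a b = log-bound a b (a + b) (+≤* _ _ (<2^suc-log a) (<2^suc-log b))
  where
  open ≤-Reasoning
  +≤* : ∀ A B → a < A → b < B → a + b ≤ A * B
  +≤* (suc A) (suc B) (s≤s a≤A) (s≤s b≤B) = begin
    a + b                   ≤⟨ +-mono-≤ a≤A b≤B ⟩
    A + B                   ≤⟨ m≤m+n (A + B) (1 + A * B) ⟩
    A + B + (1 + A * B)     ≡⟨ lemma A B ⟩
    suc A * suc B           ∎
    where
    lemma : ∀ A B → A + B + (1 + A * B) ≡ suc A * suc B
    lemma = solve-∀

size-* : ∀ a b → size (num (a * b)) ≤ suc (size (num a) + size (num b))
size-* a b = log-bound a b (a * b)
  (*-mono-≤ (<⇒≤ (<2^suc-log a)) (<⇒≤ (<2^suc-log b)))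

size-mono : ∀ {a b} → a ≤ b → size (num a) ≤ size (num b)
size-mono a≤b = s≤s (⌊log₂⌋-mono-≤ a≤b)

size-num : ∀ n → size (num n) ≤ suc n
size-num n = s≤s (log≤ n)

-- Every primitive step pays for its argument and its result. A time bound is therefore also a size
-- bound for the input of the next program. A loop that stops at once returns its input, hence the
-- companion bound `input≤time`.
output≤time : ∀ {P u v t} → P ⊢ u ⇓ v ∣ t → size v ≤ t
input≤time  : ∀ {P u v t} → P ⊢ u ⇓ v ∣ t → size u ≤ t

output≤time (run-prim {v = v})      = m≤n+m _ (size v)
output≤time (run-seq {s = s} r r′)  = m≤n⇒m≤1+n (≤-trans (output≤time r′) (m≤n+m _ s))
output≤time (run-pair r r′)         = s≤s (+-mono-≤ (output≤time r) (output≤time r′))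
output≤time (run-then {s = s} r _ r′) = m≤n⇒m≤1+n (≤-trans (output≤time r′) (m≤n+m _ s))
output≤time (run-else {s = s} r r′) = m≤n⇒m≤1+n (≤-trans (output≤time r′) (m≤n+m _ s))
output≤time (run-stop r)            = m≤n⇒m≤1+n (input≤time r)
output≤time (run-loop {s = s} {t = t} r _ r′ r″) =
  m≤n⇒m≤1+n (≤-trans (output≤time r″) (m≤n+m _ (s + t)))

input≤time (run-prim {v = v})       = m≤m+n (size v) _
input≤time (run-seq r r′)           = m≤n⇒m≤1+n (≤-trans (input≤time r) (m≤m+n _ _))
input≤time (run-pair r r′)          = m≤n⇒m≤1+n (≤-trans (input≤time r) (m≤m+n _ _))
input≤time (run-then r _ r′)        = m≤n⇒m≤1+n (≤-trans (input≤time r) (m≤m+n _ _))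
input≤time (run-else r r′)          = m≤n⇒m≤1+n (≤-trans (input≤time r) (m≤m+n _ _))
input≤time (run-stop r)             = m≤n⇒m≤1+n (input≤time r)
input≤time (run-loop r _ r′ r″)     =
  m≤n⇒m≤1+n (≤-trans (input≤time r) (≤-trans (m≤m+n _ _) (m≤m+n _ _)))

-- Polynomial-time functions

-- Termination and cost are settled once per combinator; afterwards only `⟦_⟧` has to be reasoned
-- about.
record PolyTime : Set where
  field
    ⟦_⟧     : Val → Val
    program : Prog
    bound   : Poly
    runs    : ∀ v → ∃[ t ] (program ⊢ v ⇓ ⟦_⟧ v ∣ t × t ≤ eval bound (size v))

open PolyTime public

output≤ : ∀ F v → size (⟦ F ⟧ v) ≤ eval (bound F) (size v)
output≤ F v with runs F v
... | t , r , t≤ = ≤-trans (output≤time r) t≤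

primOverhead : Prim → ℕ
primOverhead (const c) = size (num c)
primOverhead _         = 0

size-apply : ∀ o v → size (apply o v) ≤ primOverhead o + size v
size-apply ident       v                     = ≤-refl
size-apply left        (num n)               = 1≤size (num n)
size-apply left        (u ∙ v)               = m≤n⇒m≤1+n (m≤m+n _ _)
size-apply right       (num n)               = 1≤size (num n)
size-apply right       (u ∙ v)               = m≤n⇒m≤1+n (m≤n+m _ _)
size-apply isNum       (num n)               = 1≤size (num n)
size-apply isNum       (u ∙ v)               = s≤s z≤n
size-apply add         (num n)               = s≤s z≤n
size-apply add         (num a ∙ num b)       = size-+ a b
size-apply add         (num a ∙ (v ∙ w))     = s≤s z≤n
size-apply add         ((u ∙ v) ∙ w)         = s≤s z≤n
size-apply monus       (num n)               = s≤s z≤n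
size-apply monus       (num a ∙ num b)       =
  m≤n⇒m≤1+n (≤-trans (size-mono (m∸n≤m a b)) (m≤m+n _ _))
size-apply monus       (num a ∙ (v ∙ w))     = s≤s z≤n
size-apply monus       ((u ∙ v) ∙ w)         = s≤s z≤n
size-apply mult        (num n)               = s≤s z≤n
size-apply mult        (num a ∙ num b)       = size-* a b
size-apply mult        (num a ∙ (v ∙ w))     = s≤s z≤n
size-apply mult        ((u ∙ v) ∙ w)         = s≤s z≤n
size-apply (const c)   v                     = m≤m+n (size (num c)) _

primᵖ : Prim → PolyTime
primᵖ o .⟦_⟧     = apply o
primᵖ o .program = prim o
primᵖ o .bound   = X ⊕ (κ (primOverhead o) ⊕ X)
primᵖ o .runs v  = _ , run-prim , +-monoʳ-≤ (size v) (size-apply o v)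

infixr 9 _∘ᵖ_
_∘ᵖ_ : PolyTime → PolyTime → PolyTime
(G ∘ᵖ F) .⟦_⟧ v     = ⟦ G ⟧ (⟦ F ⟧ v)
(G ∘ᵖ F) .program   = program F ⨾ program G
(G ∘ᵖ F) .bound     = κ 1 ⊕ (bound F ⊕ bound G ∘ₚ bound F)
(G ∘ᵖ F) .runs v with runs F v | runs G (⟦ F ⟧ v)
... | s , r , s≤ | t , r′ , t≤ = _ , run-seq r r′ , s≤s (+-mono-≤ s≤ (≤-trans t≤
  (subst (eval (bound G) (size (⟦ F ⟧ v)) ≤_) (sym (eval-∘ (bound G) (bound F) (size v)))
    (eval-mono (bound G) (output≤ F v)))))

infixr 5 _,ᵖ_
_,ᵖ_ : PolyTime → PolyTime → PolyTime
(F ,ᵖ G) .⟦_⟧ v   = ⟦ F ⟧ v ∙ ⟦ G ⟧ v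
(F ,ᵖ G) .program = ⟨ program F , program G ⟩
(F ,ᵖ G) .bound   = κ 1 ⊕ (bound F ⊕ bound G)
(F ,ᵖ G) .runs v with runs F v | runs G v
... | s , r , s≤ | t , r′ , t≤ = _ , run-pair r r′ , s≤s (+-mono-≤ s≤ t≤)

truth : Val → Bool
truth (num zero)    = false
truth (num (suc _)) = true
truth (_ ∙ _)       = true

truth-false : ∀ {v} → truth v ≡ false → v ≡ num 0
truth-false {num zero} _ = refl

truth-true : ∀ {v} → truth v ≡ true → v ≢ num 0
truth-true () refl

infix 4 ifᵖ_then_else_
ifᵖ_then_else_ : PolyTime → PolyTime → PolyTime → PolyTime
(ifᵖ B then F else G) .⟦_⟧ v   = if truth (⟦ B ⟧ v) then ⟦ F ⟧ v else ⟦ G ⟧ v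
(ifᵖ B then F else G) .program = cond (program B) (program F) (program G)
(ifᵖ B then F else G) .bound   = κ 1 ⊕ (bound B ⊕ (bound F ⊕ bound G))
(ifᵖ B then F else G) .runs v with ⟦ B ⟧ v in eq | runs B v
... | num zero    | s , r , s≤ = let t , r′ , t≤ = runs G v in
  _ , run-else r r′ ,
  s≤s (+-mono-≤ s≤ (≤-trans t≤ (m≤n+m _ _)))
... | num (suc n) | s , r , s≤ = let t , r′ , t≤ = runs F v in
  _ , run-then r (λ ()) r′ , s≤s (+-mono-≤ s≤ (≤-trans t≤ (m≤m+n _ _)))
... | b ∙ c       | s , r , s≤ = let t , r′ , t≤ = runs F v in
  _ , run-then r (λ ()) r′ , s≤s (+-mono-≤ s≤ (≤-trans t≤ (m≤m+n _ _)))

-- Loop B F S n u w: the loop "while B do F" leads from u to w in at most n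
-- rounds, through values of size at most S.
data Loop (B F : PolyTime) (S : ℕ) : ℕ → Val → Val → Set where
  halt : ∀ {n u} → truth (⟦ B ⟧ u) ≡ false → size u ≤ S → Loop B F S n u u
  next : ∀ {n u w} → truth (⟦ B ⟧ u) ≡ true → size u ≤ S →
         Loop B F S n (⟦ F ⟧ u) w → Loop B F S (suc n) u w

roundTime : PolyTime → PolyTime → ℕ → ℕ
roundTime B F S = suc (eval (bound B) S + eval (bound F) S)

run-while : ∀ {B F S n u w} → Loop B F S n u w →
            ∃[ t ] (while (program B) (program F) ⊢ u ⇓ w ∣ t × t ≤ suc n * roundTime B F S)
run-while {B} {F} {S} {n} (halt {u = u} b≡ size≤) with runs B u
... | s , r , s≤ = _ , run-stop (subst (λ b → _ ⊢ _ ⇓ b ∣ _) (truth-false b≡) r) ,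
  ≤-trans (s≤s (≤-trans s≤ (≤-trans (eval-mono (bound B) size≤) (m≤m+n _ (eval (bound F) S)))))
          (m≤m+n (roundTime B F S) _)
run-while {B} {F} {S} (next {u = u} b≡ size≤ loop) with runs B u | runs F u | run-while loop
... | s , r , s≤ | t , r′ , t≤ | t″ , r″ , t″≤ = _ , run-loop r (truth-true b≡) r′ r″ ,
  +-mono-≤ (s≤s (+-mono-≤ (≤-trans s≤ (eval-mono (bound B) size≤))
                          (≤-trans t≤ (eval-mono (bound F) size≤)))) t″≤

-- A loop need not terminate, so its meaning `H` is supplied from outside, with evidence that the
-- loop reaches it within `N` rounds through states of size at most `S`.
whileᵖ : (I B F : PolyTime) (S N : Poly) (H : Val → Val) →
         (∀ v → Loop B F (eval S (size v)) (eval N (size v)) (⟦ I ⟧ v) (H v)) → PolyTime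
whileᵖ I B F S N H loops .⟦_⟧     = H
whileᵖ I B F S N H loops .program = program I ⨾ while (program B) (program F)
whileᵖ I B F S N H loops .bound   =
  κ 1 ⊕ (bound I ⊕ (κ 1 ⊕ N) ⊗ (κ 1 ⊕ (bound B ∘ₚ S ⊕ bound F ∘ₚ S)))
whileᵖ I B F S N H loops .runs v with runs I v | run-while (loops v)
... | s , r , s≤ | t , r′ , t≤ = _ , run-seq r r′ , s≤s (+-mono-≤ s≤
  (subst (λ e → t ≤ suc (eval N (size v)) * suc e)
    (sym (cong₂ _+_ (eval-∘ (bound B) S (size v)) (eval-∘ (bound F) S (size v)))) t≤))

-- Hides accumulators and loop states behind the intended function, so that later equations hold by
-- computation on that function.
retype : (F : PolyTime) (f : Val → Val) → (∀ v → ⟦ F ⟧ v ≡ f v) → PolyTime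
retype F f F≗f .⟦_⟧     = f
retype F f F≗f .program = program F
retype F f F≗f .bound   = bound F
retype F f F≗f .runs v  =
  subst (λ w → ∃[ t ] (program F ⊢ v ⇓ w ∣ t × t ≤ eval (bound F) (size v))) (F≗f v) (runs F v)

idᵖ fstᵖ sndᵖ isPairᵖ toNumᵖ : PolyTime
idᵖ  = primᵖ ident
fstᵖ = primᵖ left
sndᵖ = primᵖ right

natᵖ : ℕ → PolyTime
natᵖ c = primᵖ (const c)

addᵖ monusᵖ multᵖ : PolyTime → PolyTime → PolyTime
addᵖ   F G = primᵖ add ∘ᵖ (F ,ᵖ G)
monusᵖ F G = primᵖ monus ∘ᵖ (F ,ᵖ G)
multᵖ  F G = primᵖ mult ∘ᵖ (F ,ᵖ G)

isPairᵖ = ifᵖ primᵖ isNum then natᵖ 0 else natᵖ 1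
toNumᵖ  = ifᵖ primᵖ isNum then idᵖ else natᵖ 0

toℕᵛ : Val → ℕ
toℕᵛ (num n) = n
toℕᵛ (_ ∙ _) = 0

⟦toNumᵖ⟧ : ∀ v → ⟦ toNumᵖ ⟧ v ≡ num (toℕᵛ v)
⟦toNumᵖ⟧ (num n) = refl
⟦toNumᵖ⟧ (u ∙ v) = refl

size-toℕᵛ : ∀ v → size (num (toℕᵛ v)) ≤ size v
size-toℕᵛ (num n) = ≤-refl
size-toℕᵛ (u ∙ v) = s≤s z≤n

-- Values as lists: the elements are read off along the right spine, and
-- whichever number ends the spine is ignored.

endᵛ : Val → Val
endᵛ (num n) = num n
endᵛ (u ∙ v) = endᵛ v

revOnto : Val → Val → Val
revOnto (num n) r = r
revOnto (u ∙ v) r = revOnto v (u ∙ r)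

appendᵛ : Val → Val → Val
appendᵛ (num n) r = r
appendᵛ (u ∙ v) r = u ∙ appendᵛ v r

concatᵛ : Val → Val
concatᵛ (num n) = num 0
concatᵛ (u ∙ v) = appendᵛ u (concatᵛ v)

mapFrom : (Val → Val → Val) → ℕ → Val → Val
mapFrom f i (num n) = num 0
mapFrom f i (u ∙ v) = f (num i) u ∙ mapFrom f (suc i) v

sumᵛ : Val → ℕ
sumᵛ (num n) = 0
sumᵛ (u ∙ v) = toℕᵛ u + sumᵛ v

eqᵛ : Val → Val → Bool
eqᵛ (num a) (num b) = a ≡ᵇ b
eqᵛ (num a) (v ∙ w) = false
eqᵛ (u ∙ v) (num b) = false
eqᵛ (u ∙ v) (w ∙ x) = eqᵛ u w ∧ eqᵛ v x

weaken : ∀ {B F S m n u w} → m ≤ n → Loop B F S m u w → Loop B F S n u w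
weaken m≤n       (halt b s)   = halt b s
weaken (s≤s m≤n) (next b s l) = next b s (weaken m≤n l)

-- List operations and equality as polynomial-time loops

module Reverse where

  test step : PolyTime
  test = isPairᵖ ∘ᵖ fstᵖ
  step = sndᵖ ∘ᵖ fstᵖ ,ᵖ fstᵖ ∘ᵖ fstᵖ ,ᵖ sndᵖ

  shift : ∀ x a r → suc (a + suc (x + r)) ≡ suc (suc (x + a) + r)
  shift = solve-∀

  loop : ∀ {S n} a r → size (a ∙ r) ≤ S → size a ≤ n →
         Loop test step S n (a ∙ r) (endᵛ a ∙ revOnto a r)
  loop (num n) r s≤ _ = halt refl s≤
  loop {S} {suc n} (u ∙ v) r s≤ (s≤s n≤) = next refl s≤
    (loop v (u ∙ r)
      (subst (_≤ S) (sym (shift (size u) (size v) (size r))) s≤)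
      (≤-trans (m≤n+m _ (size u)) n≤))

  result : Val → Val
  result (num n) = num n
  result (a ∙ r) = endᵛ a ∙ revOnto a r

  loops : ∀ v → Loop test step (size v) (size v) (⟦ idᵖ ⟧ v) (result v)
  loops (num n) = halt refl ≤-refl
  loops (a ∙ r) = loop a r ≤-refl (m≤n⇒m≤1+n (m≤m+n _ _))

  reverseᵖ : PolyTime
  reverseᵖ = sndᵖ ∘ᵖ whileᵖ idᵖ test step X X result loops ∘ᵖ (idᵖ ,ᵖ natᵖ 0)

open Reverse using (reverseᵖ)

module Map (G : PolyTime) where

  init test step : PolyTime
  init = (sndᵖ ,ᵖ natᵖ 0) ,ᵖ fstᵖ ,ᵖ natᵖ 0
  test = isPairᵖ ∘ᵖ fstᵖ ∘ᵖ sndᵖ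
  step = (fstᵖ ∘ᵖ fstᵖ ,ᵖ addᵖ (sndᵖ ∘ᵖ fstᵖ) (natᵖ 1))
       ,ᵖ sndᵖ ∘ᵖ fstᵖ ∘ᵖ sndᵖ
       ,ᵖ G ∘ᵖ (sndᵖ ∘ᵖ fstᵖ ,ᵖ fstᵖ ∘ᵖ fstᵖ ∘ᵖ sndᵖ ,ᵖ fstᵖ ∘ᵖ fstᵖ)
       ,ᵖ sndᵖ ∘ᵖ sndᵖ

  mapRev : Val → ℕ → Val → Val → Val
  mapRev ρ i (num n) acc = acc
  mapRev ρ i (u ∙ v) acc = mapRev ρ (suc i) v (⟦ G ⟧ (num i ∙ u ∙ ρ) ∙ acc)

  count : ℕ → Val → ℕ
  count i (num n) = i
  count i (u ∙ v) = count (suc i) v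

  -- For inputs of size s, an argument of `G` has size at most `argSize s`, so a round lengthens the
  -- accumulator by at most `resSize s`. The invariant i + size l ≤ s bounds the number of rounds by
  -- s.
  argSize resSize stateSize : ℕ → ℕ
  argSize s   = 3 + (s + s)
  resSize s   = suc (eval (bound G) (argSize s))
  stateSize s = 3 + (s + (suc s + suc (s * resSize s)))

  argPoly statePoly : Poly
  argPoly   = κ 3 ⊕ (X ⊕ X)
  statePoly = κ 3 ⊕ (X ⊕ ((κ 1 ⊕ X) ⊕ (κ 1 ⊕ X ⊗ (κ 1 ⊕ (bound G ∘ₚ argPoly)))))

  eval-statePoly : ∀ s → eval statePoly s ≡ stateSize s
  eval-statePoly s = cong (λ e → 3 + (s + (suc s + suc (s * suc e)))) (eval-∘ (bound G) argPoly s)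

  open ≤-Reasoning

  regroup : ∀ r i v a → suc (suc (r + i) + suc (v + a)) ≡ 3 + ((v + r) + (i + a))
  regroup = solve-∀

  size-arg : ∀ {s} i u v ρ → i + size (u ∙ v) ≤ s → size (u ∙ v) + size ρ ≤ s →
             size (num i ∙ u ∙ ρ) ≤ argSize s
  size-arg {s} i u v ρ i≤ l≤ = begin
    suc (size (num i) + suc (size u + size ρ)) ≤⟨ s≤s (+-mono-≤
      (≤-trans (size-num i) (s≤s (≤-trans (m≤m+n i _) i≤)))
      (s≤s (≤-trans (+-monoˡ-≤ (size ρ) (m≤n⇒m≤1+n (m≤m+n (size u) (size v)))) l≤))) ⟩
    suc (suc s + suc s)                        ≡⟨ lemma s ⟩
    argSize s                                  ∎
    where
    lemma : ∀ s → suc (suc s + suc s) ≡ 3 + (s + s)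
    lemma = solve-∀

  size-state : ∀ {s} ρ i l acc → i + size l ≤ s → size l + size ρ ≤ s →
               size acc ≤ suc (i * resSize s) →
               size ((ρ ∙ num i) ∙ l ∙ acc) ≤ stateSize s
  size-state {s} ρ i l acc i≤ l≤ acc≤ = begin
    suc (suc (size ρ + size (num i)) + suc (size l + size acc))
      ≡⟨ regroup (size ρ) (size (num i)) (size l) (size acc) ⟩
    3 + ((size l + size ρ) + (size (num i) + size acc))
      ≤⟨ +-monoʳ-≤ 3 (+-mono-≤ l≤ (+-mono-≤
           (≤-trans (size-num i) (s≤s i≤s))
           (≤-trans acc≤ (s≤s (*-monoˡ-≤ (resSize s) i≤s))))) ⟩
    stateSize s ∎
    where
    i≤s : i ≤ s
    i≤s = ≤-trans (m≤m+n i _) i≤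

  loop : ∀ {s n} ρ i l acc → i + size l ≤ s → size l + size ρ ≤ s →
         size acc ≤ suc (i * resSize s) → size l ≤ n →
         Loop test step (stateSize s) n
           ((ρ ∙ num i) ∙ l ∙ acc) ((ρ ∙ num (count i l)) ∙ endᵛ l ∙ mapRev ρ i l acc)
  loop ρ i (num e) acc i≤ l≤ acc≤ _ = halt refl (size-state ρ i (num e) acc i≤ l≤ acc≤)
  loop {s} {suc n} ρ i (u ∙ v) acc i≤ l≤ acc≤ (s≤s n≤) =
    next refl (size-state ρ i (u ∙ v) acc i≤ l≤ acc≤)
      (subst (λ j → Loop test step (stateSize s) n
               ((ρ ∙ num j) ∙ v ∙ (⟦ G ⟧ (num i ∙ u ∙ ρ) ∙ acc))
               ((ρ ∙ num (count (suc i) v)) ∙ endᵛ v ∙ mapRev ρ i (u ∙ v) acc))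
        (+-comm 1 i)
        (loop ρ (suc i) v _
          (begin
            suc (i + size v)    ≡⟨ +-suc i (size v) ⟨
            i + suc (size v)    ≤⟨ +-monoʳ-≤ i (s≤s (m≤n+m (size v) (size u))) ⟩
            i + size (u ∙ v)    ≤⟨ i≤ ⟩
            s                   ∎)
          (≤-trans (+-monoˡ-≤ (size ρ) (m≤n⇒m≤1+n (m≤n+m (size v) (size u)))) l≤)
          (begin
            suc (size (⟦ G ⟧ (num i ∙ u ∙ ρ)) + size acc) ≤⟨ s≤s (+-mono-≤
              (≤-trans (output≤ G (num i ∙ u ∙ ρ)) (eval-mono (bound G) (size-arg i u v ρ i≤ l≤)))
              acc≤) ⟩
            suc (eval (bound G) (argSize s) + suc (i * resSize s))
              ≡⟨ cong suc (+-suc (eval (bound G) (argSize s)) _) ⟩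
            suc (resSize s + i * resSize s)               ∎)
          (≤-trans (m≤n+m _ (size u)) n≤)))

  result : Val → Val
  result (num n) = (num 0 ∙ num 0) ∙ num 0 ∙ num 0
  result (l ∙ ρ) = (ρ ∙ num (count 0 l)) ∙ endᵛ l ∙ mapRev ρ 0 l (num 0)

  loops : ∀ v → Loop test step (eval statePoly (size v)) (eval X (size v)) (⟦ init ⟧ v) (result v)
  loops (num n) = halt refl (subst (7 ≤_) (sym (eval-statePoly (size (num n))))
    (+-monoʳ-≤ 3 (+-mono-≤ {1} (1≤size (num n)) (+-mono-≤ {2} (s≤s (1≤size (num n))) (s≤s z≤n)))))
  loops (l ∙ ρ) = subst (λ s → Loop test step s (size (l ∙ ρ)) (⟦ init ⟧ (l ∙ ρ)) (result (l ∙ ρ)))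
    (sym (eval-statePoly (size (l ∙ ρ))))
    (loop ρ 0 l (num 0) (m≤n⇒m≤1+n (m≤m+n _ _)) (n≤1+n _) ≤-refl (m≤n⇒m≤1+n (m≤m+n _ _)))

  revOnto-mapRev : ∀ ρ i l acc → revOnto (mapRev ρ i l acc) (num 0) ≡
                   revOnto acc (mapFrom (λ j x → ⟦ G ⟧ (j ∙ x ∙ ρ)) i l)
  revOnto-mapRev ρ i (num n) acc = refl
  revOnto-mapRev ρ i (u ∙ v) acc = revOnto-mapRev ρ (suc i) v _

-- The body sees the index of an element and the element in front of its
-- own environment.
forᵖ : PolyTime → PolyTime → PolyTime
forᵖ E G = retype
  (reverseᵖ ∘ᵖ sndᵖ ∘ᵖ sndᵖ ∘ᵖ whileᵖ init test step statePoly X result loops ∘ᵖ (E ,ᵖ idᵖ))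
  (λ ρ → mapFrom (λ i x → ⟦ G ⟧ (i ∙ x ∙ ρ)) 0 (⟦ E ⟧ ρ))
  (λ ρ → revOnto-mapRev ρ 0 (⟦ E ⟧ ρ) (num 0))
  where open Map G

module Concat where

  test step : PolyTime
  test = isPairᵖ ∘ᵖ fstᵖ
  step = ifᵖ isPairᵖ ∘ᵖ fstᵖ ∘ᵖ fstᵖ
         then (sndᵖ ∘ᵖ fstᵖ ∘ᵖ fstᵖ ,ᵖ sndᵖ ∘ᵖ fstᵖ) ,ᵖ fstᵖ ∘ᵖ fstᵖ ∘ᵖ fstᵖ ,ᵖ sndᵖ
         else (sndᵖ ∘ᵖ fstᵖ ,ᵖ sndᵖ)

  concatRev : Val → Val → Val
  concatRev (num n) acc = acc
  concatRev (u ∙ v) acc = concatRev v (revOnto u acc)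

  shift : ∀ x u v a → suc (suc (u + v) + suc (x + a)) ≡ suc (suc (suc (x + u) + v) + a)
  shift = solve-∀

  size-revOnto : ∀ u acc → suc (size (revOnto u acc)) ≤ size u + size acc
  size-revOnto (num n) acc = s≤s (m≤n+m _ _)
  size-revOnto (u ∙ v) acc = subst (suc (size (revOnto v (u ∙ acc))) ≤_)
    (lemma (size u) (size v) (size acc)) (size-revOnto v (u ∙ acc))
    where
    lemma : ∀ u v a → v + suc (u + a) ≡ suc (u + v) + a
    lemma = solve-∀

  size-next : ∀ u v acc → size (v ∙ revOnto u acc) ≤ size ((u ∙ v) ∙ acc)
  size-next u v acc = s≤s (≤-trans (+-monoʳ-≤ (size v) (≤-trans (n≤1+n _) (size-revOnto u acc)))
    (subst (_≤ suc (size u + size v) + size acc) (lemma (size u) (size v) (size acc)) (n≤1+n _)))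
    where
    lemma : ∀ u v a → (u + v) + a ≡ v + (u + a)
    lemma = solve-∀

  -- The nested traversal is flattened into one loop: a round either moves one element of the head
  -- list to the accumulator or drops an exhausted head. Each round uses up a node of the input,
  -- which gives the linear number of rounds.
  loop-head : ∀ {S n w} u v acc → size ((u ∙ v) ∙ acc) ≤ S →
              Loop test step S n (v ∙ revOnto u acc) w →
              Loop test step S (size u + n) ((u ∙ v) ∙ acc) w
  loop-head {n = n} (num e) v acc s≤ rest =
    next refl s≤ (weaken (m≤n+m n _) rest)
  loop-head {S} {n} {w} (x ∙ u) v acc s≤ rest = next refl s≤
    (weaken (+-monoˡ-≤ n (m≤n+m (size u) (size x)))
      (loop-head u v (x ∙ acc)
        (subst (_≤ S) (sym (shift (size x) (size u) (size v) (size acc))) s≤) rest))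

  loop : ∀ {S} l acc → size (l ∙ acc) ≤ S →
         Loop test step S (size l) (l ∙ acc) (endᵛ l ∙ concatRev l acc)
  loop (num n) acc s≤ = halt refl s≤
  loop (u ∙ v) acc s≤ = weaken (n≤1+n _)
    (loop-head u v acc s≤ (loop v (revOnto u acc) (≤-trans (size-next u v acc) s≤)))

  revOnto-revOnto : ∀ u acc r → revOnto (revOnto u acc) r ≡ revOnto acc (appendᵛ u r)
  revOnto-revOnto (num n) acc r = refl
  revOnto-revOnto (x ∙ u) acc r = revOnto-revOnto u (x ∙ acc) r

  revOnto-concatRev : ∀ l acc → revOnto (concatRev l acc) (num 0) ≡ revOnto acc (concatᵛ l)
  revOnto-concatRev (num n) acc = refl
  revOnto-concatRev (u ∙ v) acc =
    trans (revOnto-concatRev v (revOnto u acc)) (revOnto-revOnto u acc (concatᵛ v))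

concatᵖ : PolyTime → PolyTime
concatᵖ E = retype
  (reverseᵖ ∘ᵖ sndᵖ ∘ᵖ whileᵖ (idᵖ ,ᵖ natᵖ 0) test step (κ 2 ⊕ X) X
    (λ l → endᵛ l ∙ concatRev l (num 0))
    (λ l → loop l (num 0) (≤-reflexive (cong suc (+-comm (size l) 1)))) ∘ᵖ E)
  (λ ρ → concatᵛ (⟦ E ⟧ ρ))
  (λ ρ → revOnto-concatRev (⟦ E ⟧ ρ) (num 0))
  where open Concat

module Sum where

  test step : PolyTime
  test = isPairᵖ ∘ᵖ fstᵖ
  step = sndᵖ ∘ᵖ fstᵖ ,ᵖ addᵖ (toNumᵖ ∘ᵖ fstᵖ ∘ᵖ fstᵖ) sndᵖ

  step-eq : ∀ u v a → ⟦ step ⟧ ((u ∙ v) ∙ num a) ≡ v ∙ num (toℕᵛ u + a)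
  step-eq (num n) v a = refl
  step-eq (u ∙ w) v a = refl

  -- A sum can be longer by one than its summands together; the list node that disappears pays for
  -- it.
  size-step : ∀ u v a → size (v ∙ num (toℕᵛ u + a)) ≤ size ((u ∙ v) ∙ num a)
  size-step u v a = s≤s (≤-trans
    (+-monoʳ-≤ (size v) (≤-trans (size-+ (toℕᵛ u) a) (s≤s (+-monoˡ-≤ (size (num a)) (size-toℕᵛ u)))))
    (≤-reflexive (lemma (size u) (size v) (size (num a)))))
    where
    lemma : ∀ u v a → v + suc (u + a) ≡ suc (u + v) + a
    lemma = solve-∀

  loop : ∀ {S n} l a → size (l ∙ num a) ≤ S → size l ≤ n →
         Loop test step S n (l ∙ num a) (endᵛ l ∙ num (sumᵛ l + a))
  loop (num n) a s≤ _ = halt refl s≤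
  loop {S} {suc n} (u ∙ v) a s≤ (s≤s n≤) = next refl s≤
    (subst₂ (Loop test step S n) (sym (step-eq u v a))
      (cong (λ b → endᵛ v ∙ num b) (lemma (sumᵛ v) (toℕᵛ u) a))
      (loop v (toℕᵛ u + a) (≤-trans (size-step u v a) s≤) (≤-trans (m≤n+m _ (size u)) n≤)))
    where
    lemma : ∀ v u a → v + (u + a) ≡ (u + v) + a
    lemma = solve-∀

sumᵖ : PolyTime → PolyTime
sumᵖ E = retype
  (sndᵖ ∘ᵖ whileᵖ (idᵖ ,ᵖ natᵖ 0) test step (κ 2 ⊕ X) X
    (λ l → endᵛ l ∙ num (sumᵛ l + 0))
    (λ l → loop l 0 (≤-reflexive (cong suc (+-comm (size l) 1))) ≤-refl) ∘ᵖ E)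
  (λ ρ → num (sumᵛ (⟦ E ⟧ ρ)))
  (λ ρ → cong num (+-identityʳ _))
  where open Sum

module Equality where

  init : PolyTime → PolyTime → PolyTime
  init E F = (E ,ᵖ F) ,ᵖ natᵖ 0

  -- Recursion on two trees runs with an explicit stack of pairs still to be compared. An empty
  -- stack is `num 0`; a mismatch replaces the whole stack by `num 1`. Both are numbers, so both
  -- stop the loop and are told apart afterwards.
  a₁ b₁ test step : PolyTime
  a₁ = fstᵖ ∘ᵖ fstᵖ
  b₁ = sndᵖ ∘ᵖ fstᵖ
  test = isPairᵖ
  step = ifᵖ primᵖ isNum ∘ᵖ a₁
         then (ifᵖ primᵖ isNum ∘ᵖ b₁
               then (ifᵖ addᵖ (monusᵖ a₁ b₁) (monusᵖ b₁ a₁) then natᵖ 1 else sndᵖ)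
               else natᵖ 1)
         else (ifᵖ primᵖ isNum ∘ᵖ b₁
               then natᵖ 1
               else (fstᵖ ∘ᵖ a₁ ,ᵖ fstᵖ ∘ᵖ b₁) ,ᵖ (sndᵖ ∘ᵖ a₁ ,ᵖ sndᵖ ∘ᵖ b₁) ,ᵖ sndᵖ)

  truth-distance : ∀ a b → truth (num ((a ∸ b) + (b ∸ a))) ≡ not (a ≡ᵇ b)
  truth-distance zero    zero    = refl
  truth-distance zero    (suc b) = refl
  truth-distance (suc a) zero    = refl
  truth-distance (suc a) (suc b) = truth-distance a b

  step-num : ∀ a b r → ⟦ step ⟧ ((num a ∙ num b) ∙ r) ≡ (if a ≡ᵇ b then r else num 1)
  step-num a b r rewrite truth-distance a b with a ≡ᵇ b
  ... | true  = refl
  ... | false = refl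

  regroup : ∀ a a′ b b′ r → suc (suc (a + b) + suc (suc (a′ + b′) + r)) ≡
            suc (suc (suc (a + a′) + suc (b + b′)) + r)
  regroup = solve-∀

  size-unpair : ∀ {S} a a′ b b′ r → size (((a ∙ a′) ∙ (b ∙ b′)) ∙ r) ≤ S →
                size ((a ∙ b) ∙ (a′ ∙ b′) ∙ r) ≤ S
  size-unpair {S} a a′ b b′ r =
    subst (_≤ S) (sym (regroup (size a) (size a′) (size b) (size b′) (size r)))

  size-tail : ∀ {S} u v → size (u ∙ v) ≤ S → size v ≤ S
  size-tail u v = ≤-trans (m≤n⇒m≤1+n (m≤n+m _ _))

  fail : ∀ {S n} → 1 ≤ S → Loop test step S n (num 1) (num 1)
  fail 1≤S = halt refl 1≤S

  loop-true : ∀ {S n r w} a b → eqᵛ a b ≡ true → size ((a ∙ b) ∙ r) ≤ S →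
              Loop test step S n r w → Loop test step S (size a + n) ((a ∙ b) ∙ r) w
  loop-true {S} {n} {r} {w} (num a) (num b) eq s≤ rest = next refl s≤
    (weaken (m≤n+m n _) (subst (λ u → Loop test step S n u w)
      (sym (trans (step-num a b r) (cong (if_then r else num 1) eq))) rest))
  loop-true {S} {n} {r} (a ∙ a′) (b ∙ b′) eq s≤ rest with eqᵛ a b in eq₁ | eqᵛ a′ b′ in eq₂
  ... | true | true = next refl s≤ (weaken (≤-reflexive (sym (+-assoc (size a) (size a′) n)))
    (loop-true a b eq₁ s≤′ (loop-true a′ b′ eq₂ (size-tail (a ∙ b) ((a′ ∙ b′) ∙ r) s≤′) rest)))
    where s≤′ = size-unpair a a′ b b′ r s≤

  loop-false : ∀ {S n r} a b → eqᵛ a b ≡ false → size ((a ∙ b) ∙ r) ≤ S →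
               Loop test step S (size a + n) ((a ∙ b) ∙ r) (num 1)
  loop-false {S} {n} {r} (num a) (num b) eq s≤ = next refl s≤
    (subst (λ u → Loop test step S _ u (num 1))
      (sym (trans (step-num a b r) (cong (if_then r else num 1) eq)))
      (fail (≤-trans (s≤s z≤n) s≤)))
  loop-false (num a) (b ∙ b′) eq s≤ = next refl s≤ (fail (≤-trans (s≤s z≤n) s≤))
  loop-false (a ∙ a′) (num b) eq s≤ = next refl s≤ (fail (≤-trans (s≤s z≤n) s≤))
  loop-false {S} {n} {r} (a ∙ a′) (b ∙ b′) eq s≤ with eqᵛ a b in eq₁ | eqᵛ a′ b′ in eq₂
  ... | false | _     = next refl s≤ (weaken (≤-reflexive (sym (+-assoc (size a) (size a′) n)))
    (loop-false a b eq₁ (size-unpair a a′ b b′ r s≤)))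
  ... | true  | false = next refl s≤ (weaken (≤-reflexive (sym (+-assoc (size a) (size a′) n)))
    (loop-true a b eq₁ s≤′ (loop-false a′ b′ eq₂ (size-tail (a ∙ b) ((a′ ∙ b′) ∙ r) s≤′))))
    where s≤′ = size-unpair a a′ b b′ r s≤

  result : Val → Val → Val
  result a b = if eqᵛ a b then num 0 else num 1

  loop : ∀ {S} a b → size ((a ∙ b) ∙ num 0) ≤ S →
         Loop test step S (size a + 0) ((a ∙ b) ∙ num 0) (result a b)
  loop a b s≤ with eqᵛ a b in eq
  ... | true  = loop-true a b eq s≤ (halt refl (≤-trans (s≤s z≤n) s≤))
  ... | false = loop-false a b eq s≤

  result-not : ∀ a b → (if truth (result a b) then num 0 else num 1) ≡ bitVal (eqᵛ a b)
  result-not a b with eqᵛ a b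
  ... | true  = refl
  ... | false = refl

eqᵖ : PolyTime → PolyTime → PolyTime
eqᵖ E F = retype
  (ifᵖ whileᵖ (init E F) test step (bound (init E F)) (bound E ⊕ κ 0)
         (λ ρ → result (⟦ E ⟧ ρ) (⟦ F ⟧ ρ))
         (λ ρ → weaken (+-monoˡ-≤ 0 (output≤ E ρ))
                  (loop (⟦ E ⟧ ρ) (⟦ F ⟧ ρ) (output≤ (init E F) ρ)))
   then natᵖ 0 else natᵖ 1)
  (λ ρ → bitVal (eqᵛ (⟦ E ⟧ ρ) (⟦ F ⟧ ρ)))
  (λ ρ → result-not (⟦ E ⟧ ρ) (⟦ F ⟧ ρ))
  where open Equality

-- Booleans as the numbers 0 and 1

𝟙 : Bool → ℕ
𝟙 b = if b then 1 else 0

𝟙≤1 : ∀ b → 𝟙 b ≤ 1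
𝟙≤1 true  = ≤-refl
𝟙≤1 false = z≤n

1≤𝟙⇒true : ∀ {b} → 1 ≤ 𝟙 b → b ≡ true
1≤𝟙⇒true {true} _ = refl

Bool-ext : ∀ {a b} → (a ≡ true → b ≡ true) → (b ≡ true → a ≡ true) → a ≡ b
Bool-ext {false} {false} f g = refl
Bool-ext {false} {true}  f g = g refl
Bool-ext {true}  {b}     f g = sym (f refl)

≡false : ∀ {b} → b ≢ true → b ≡ false
≡false {true}  b≢ = contradiction refl b≢
≡false {false} b≢ = refl

∧-elim : ∀ {a b} → a ∧ b ≡ true → a ≡ true × b ≡ true
∧-elim {true} eq = refl , eq

∧-intro : ∀ {a b} → a ≡ true → b ≡ true → a ∧ b ≡ true
∧-intro refl refl = refl

≡ᵇ-sound : ∀ {a b} → (a ≡ᵇ b) ≡ true → a ≡ b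
≡ᵇ-sound {a} {b} eq = ≡ᵇ⇒≡ a b (Equivalence.from T-≡ eq)

≡ᵇ-complete : ∀ {a b} → a ≡ b → (a ≡ᵇ b) ≡ true
≡ᵇ-complete {a} {b} eq = Equivalence.to T-≡ (≡⇒≡ᵇ a b eq)

≡ᵇ-refl : ∀ a → (a ≡ᵇ a) ≡ true
≡ᵇ-refl a = ≡ᵇ-complete {a} refl

≡ᵇ-false : ∀ {a b} → a ≢ b → (a ≡ᵇ b) ≡ false
≡ᵇ-false a≢b = ≡false (a≢b ∘ ≡ᵇ-sound)

≡ᵇ-sym : ∀ a b → (a ≡ᵇ b) ≡ (b ≡ᵇ a)
≡ᵇ-sym a b = Bool-ext {a ≡ᵇ b} {b ≡ᵇ a}
  (λ eq → ≡ᵇ-complete {b} {a} (sym (≡ᵇ-sound {a} {b} eq)))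
  (λ eq → ≡ᵇ-complete {a} {b} (sym (≡ᵇ-sound {b} {a} eq)))

-- Finite sums

∑ : ℕ → (ℕ → ℕ) → ℕ
∑ zero    f = 0
∑ (suc n) f = f 0 + ∑ n (f ∘ suc)

∑-cong : ∀ n {f g} → (∀ i → i < n → f i ≡ g i) → ∑ n f ≡ ∑ n g
∑-cong zero    f≗g = refl
∑-cong (suc n) f≗g = cong₂ _+_ (f≗g 0 z<s) (∑-cong n (λ i i<n → f≗g (suc i) (s<s i<n)))

∑-mono : ∀ n {f g} → (∀ i → i < n → f i ≤ g i) → ∑ n f ≤ ∑ n g
∑-mono zero    f≤g = z≤n
∑-mono (suc n) f≤g = +-mono-≤ (f≤g 0 z<s) (∑-mono n (λ i i<n → f≤g (suc i) (s<s i<n)))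

∑-const : ∀ n c → ∑ n (λ _ → c) ≡ n * c
∑-const zero    c = refl
∑-const (suc n) c = cong (c +_) (∑-const n c)

∑-≤-const : ∀ n {f} c → (∀ i → i < n → f i ≤ c) → ∑ n f ≤ n * c
∑-≤-const n c f≤c = subst (∑ n _ ≤_) (∑-const n c) (∑-mono n f≤c)

∑-zero : ∀ n {f} → (∀ i → i < n → f i ≡ 0) → ∑ n f ≡ 0
∑-zero n f≡0 = trans (∑-cong n f≡0) (trans (∑-const n 0) (*-zeroʳ n))

∑-+ : ∀ n f g → ∑ n (λ i → f i + g i) ≡ ∑ n f + ∑ n g
∑-+ zero    f g = refl
∑-+ (suc n) f g = trans (cong (f 0 + g 0 +_) (∑-+ n (f ∘ suc) (g ∘ suc)))
                        (+-swap₄ (f 0) (g 0) _ _)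
  where
  +-swap₄ : ∀ a b c d → (a + b) + (c + d) ≡ (a + c) + (b + d)
  +-swap₄ = solve-∀

∑-*ˡ : ∀ n c f → ∑ n (λ i → c * f i) ≡ c * ∑ n f
∑-*ˡ zero    c f = sym (*-zeroʳ c)
∑-*ˡ (suc n) c f = trans (cong (c * f 0 +_) (∑-*ˡ n c (f ∘ suc)))
                         (sym (*-distribˡ-+ c (f 0) _))

∑-swap : ∀ m n (f : ℕ → ℕ → ℕ) → ∑ m (λ i → ∑ n (f i)) ≡ ∑ n (λ j → ∑ m (λ i → f i j))
∑-swap zero    n f = sym (∑-zero n (λ _ _ → refl))
∑-swap (suc m) n f = trans (cong (∑ n (f 0) +_) (∑-swap m n (f ∘ suc)))
                           (sym (∑-+ n (f 0) _))

∑-last : ∀ n f → ∑ (suc n) f ≡ ∑ n f + f n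
∑-last zero    f = +-comm (f 0) 0
∑-last (suc n) f = trans (cong (f 0 +_) (∑-last n (f ∘ suc))) (sym (+-assoc (f 0) _ _))

∑-split : ∀ m n f → ∑ (m + n) f ≡ ∑ m f + ∑ n (λ i → f (m + i))
∑-split zero    n f = refl
∑-split (suc m) n f = trans (cong (f 0 +_) (∑-split m n (f ∘ suc))) (sym (+-assoc (f 0) _ _))

∑-member : ∀ n f {i} → i < n → f i ≤ ∑ n f
∑-member (suc n) f {zero}  i<n       = m≤m+n _ _
∑-member (suc n) f {suc i} (s≤s i<n) = ≤-trans (∑-member n (f ∘ suc) i<n) (m≤n+m _ (f 0))

∑-pos : ∀ n f → 1 ≤ ∑ n f → ∃[ i ] (i < n × 1 ≤ f i)
∑-pos (suc n) f 1≤ with f 0 in eq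
... | suc _ = 0 , z<s , subst (1 ≤_) (sym eq) (s≤s z≤n)
... | zero  with ∑-pos n (f ∘ suc) 1≤
...   | i , i<n , 1≤fi = suc i , s<s i<n , 1≤fi

∑-≡0 : ∀ n f → ∑ n f ≡ 0 → ∀ {i} → i < n → f i ≡ 0
∑-≡0 n f eq {i} i<n = n≤0⇒n≡0 (subst (f i ≤_) eq (∑-member n f i<n))

-- The slacks g i - f i are nonnegative and add up to at most 0. This is the pigeonhole step that
-- finds a clique vertex of every colour.
∑-tight : ∀ n {f g} → (∀ i → i < n → f i ≤ g i) → ∑ n g ≤ ∑ n f →
          ∀ i → i < n → g i ≤ f i
∑-tight (suc n) {f} {g} f≤g ∑≤ zero _ =
  +-cancelʳ-≤ (∑ n (g ∘ suc)) (g 0) (f 0)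
    (≤-trans ∑≤ (+-monoʳ-≤ (f 0) (∑-mono n (λ i i<n → f≤g (suc i) (s<s i<n)))))
∑-tight (suc n) {f} {g} f≤g ∑≤ (suc i) (s≤s i<n) =
  ∑-tight n (λ i i<n → f≤g (suc i) (s<s i<n))
    (+-cancelˡ-≤ (f 0) _ _ (≤-trans (+-monoˡ-≤ _ (f≤g 0 z<s)) ∑≤)) i i<n

∑-𝟙-≤1 : ∀ n t → (∀ i j → i < n → j < n → t i ≡ true → t j ≡ true → i ≡ j) →
         ∑ n (𝟙 ∘ t) ≤ 1
∑-𝟙-≤1 zero    t unique = z≤n
∑-𝟙-≤1 (suc n) t unique with t 0 in eq
... | false = ∑-𝟙-≤1 n (t ∘ suc) (λ i j i<n j<n ti tj →
  suc-injective (unique (suc i) (suc j) (s<s i<n) (s<s j<n) ti tj))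
... | true  = ≤-reflexive (cong suc (∑-zero n (λ i i<n → cong 𝟙 (≡false (λ ti →
  contradiction (unique 0 (suc i) z<s (s<s i<n) eq ti) λ ())))))

∑-δ : ∀ n {a} (f : ℕ → ℕ) → a < n → ∑ n (λ i → 𝟙 (a ≡ᵇ i) * f i) ≡ f a
∑-δ (suc n) {zero}  f _         = trans (cong (f 0 + 0 +_) (∑-zero n (λ _ _ → refl)))
                                        (trans (+-identityʳ _) (+-identityʳ _))
∑-δ (suc n) {suc a} f (s≤s a<n) = ∑-δ n (f ∘ suc) a<n

∑-δ-1 : ∀ n {a} → a < n → ∑ n (λ i → 𝟙 (a ≡ᵇ i)) ≡ 1
∑-δ-1 n a<n = trans (∑-cong n (λ _ _ → sym (*-identityʳ _))) (∑-δ n (λ _ → 1) a<n)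

∑-δ-≤1 : ∀ n a → ∑ n (λ i → 𝟙 (a ≡ᵇ i)) ≤ 1
∑-δ-≤1 n a = ∑-𝟙-≤1 n _ (λ i j _ _ ai aj → trans (sym (≡ᵇ-sound {a} ai)) (≡ᵇ-sound {a} aj))

anyᵇ : ℕ → (ℕ → Bool) → Bool
anyᵇ zero    t = false
anyᵇ (suc n) t = t 0 ∨ anyᵇ n (t ∘ suc)

anyᵇ-intro : ∀ n t {i} → i < n → t i ≡ true → anyᵇ n t ≡ true
anyᵇ-intro (suc n) t {zero}  _         eq rewrite eq = refl
anyᵇ-intro (suc n) t {suc i} (s≤s i<n) eq with t 0
... | true  = refl
... | false = anyᵇ-intro n (t ∘ suc) i<n eq

anyᵇ-elim : ∀ n t → anyᵇ n t ≡ true → ∃[ i ] (i < n × t i ≡ true)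
anyᵇ-elim (suc n) t eq with t 0 in eq₀
... | true  = 0 , z<s , eq₀
... | false with anyᵇ-elim n (t ∘ suc) eq
...   | i , i<n , ti = suc i , s<s i<n , ti

anyᵇ-cong : ∀ n {s t} → (∀ i → i < n → s i ≡ t i) → anyᵇ n s ≡ anyᵇ n t
anyᵇ-cong zero    s≗t = refl
anyᵇ-cong (suc n) s≗t = cong₂ _∨_ (s≗t 0 z<s) (anyᵇ-cong n (λ i i<n → s≗t (suc i) (s<s i<n)))

anyᵇ≤∑ : ∀ n t → 𝟙 (anyᵇ n t) ≤ ∑ n (𝟙 ∘ t)
anyᵇ≤∑ zero    t = z≤n
anyᵇ≤∑ (suc n) t with t 0
... | true  = s≤s z≤n
... | false = anyᵇ≤∑ n (t ∘ suc)

anyᵇ≡∑ : ∀ n t → (∀ i j → i < n → j < n → t i ≡ true → t j ≡ true → i ≡ j) →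
         𝟙 (anyᵇ n t) ≡ ∑ n (𝟙 ∘ t)
anyᵇ≡∑ n t unique with anyᵇ n t in eq
... | true with anyᵇ-elim n t eq
...   | i , i<n , ti = ≤-antisym
  (subst (_≤ ∑ n (𝟙 ∘ t)) (cong 𝟙 ti) (∑-member n (𝟙 ∘ t) i<n)) (∑-𝟙-≤1 n t unique)
anyᵇ≡∑ n t unique | false = sym (∑-zero n (λ i i<n → cong 𝟙 (≡false (λ ti →
  contradiction (trans (sym eq) (anyᵇ-intro n t i<n ti)) λ ()))))

-- Double counting: after exchanging the sums, x i is counted once for each preimage of i, hence at
-- most once.
∑-injective : ∀ k m (γ : ℕ → ℕ) (x : ℕ → ℕ) → (∀ s → s < k → γ s < m) →
              (∀ s t → s < k → t < k → γ s ≡ γ t → s ≡ t) →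
              ∑ k (x ∘ γ) ≤ ∑ m x
∑-injective k m γ x γ<m γ-inj = begin
  ∑ k (x ∘ γ)                                     ≡⟨ ∑-cong k (λ s s<k → sym (∑-δ m x (γ<m s s<k))) ⟩
  ∑ k (λ s → ∑ m (λ i → 𝟙 (γ s ≡ᵇ i) * x i))      ≡⟨ ∑-swap k m _ ⟩
  ∑ m (λ i → ∑ k (λ s → 𝟙 (γ s ≡ᵇ i) * x i))      ≡⟨ ∑-cong m (λ i _ → trans
    (∑-cong k (λ s _ → *-comm (𝟙 (γ s ≡ᵇ i)) (x i))) (∑-*ˡ k (x i) _)) ⟩
  ∑ m (λ i → x i * ∑ k (λ s → 𝟙 (γ s ≡ᵇ i)))      ≤⟨ ∑-mono m (λ i _ → *-monoʳ-≤ (x i)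
    (∑-𝟙-≤1 k _ (λ s t s<k t<k γs γt → γ-inj s t s<k t<k
      (trans (≡ᵇ-sound {γ s} γs) (sym (≡ᵇ-sound {γ t} γt)))))) ⟩
  ∑ m (λ i → x i * 1)                             ≡⟨ ∑-cong m (λ i _ → *-identityʳ (x i)) ⟩
  ∑ m x                                           ∎
  where open ≤-Reasoning

-- Lists described by their length and their entries

lenᵛ : Val → ℕ
lenᵛ (num n) = 0
lenᵛ (u ∙ v) = suc (lenᵛ v)

-- The value is num 0 when the index is out of range.
nthᵛ : Val → ℕ → Val
nthᵛ (num n) i       = num 0
nthᵛ (u ∙ v) zero    = u
nthᵛ (u ∙ v) (suc i) = nthᵛ v i

listOf : ℕ → (ℕ → Val) → Val
listOf n f = listVal (applyUpTo f n)

listOf-cong : ∀ n {f g} → (∀ i → i < n → f i ≡ g i) → listOf n f ≡ listOf n g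
listOf-cong zero    f≗g = refl
listOf-cong (suc n) f≗g =
  cong₂ _∙_ (f≗g 0 z<s) (listOf-cong n (λ i i<n → f≗g (suc i) (s<s i<n)))

len-listOf : ∀ n f → lenᵛ (listOf n f) ≡ n
len-listOf zero    f = refl
len-listOf (suc n) f = cong suc (len-listOf n (f ∘ suc))

nth-listOf : ∀ n f {i} → i < n → nthᵛ (listOf n f) i ≡ f i
nth-listOf (suc n) f {zero}  _         = refl
nth-listOf (suc n) f {suc i} (s≤s i<n) = nth-listOf n (f ∘ suc) i<n

nth-overflow : ∀ v {i} → lenᵛ v ≤ i → nthᵛ v i ≡ num 0
nth-overflow (num n) _                 = refl
nth-overflow (u ∙ v) {suc i} (s≤s len≤) = nth-overflow v len≤

mapFrom≡listOf : ∀ f i v →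
  mapFrom f i v ≡ listOf (lenᵛ v) (λ j → f (num (i + j)) (nthᵛ v j))
mapFrom≡listOf f i (num n) = refl
mapFrom≡listOf f i (u ∙ v) = cong₂ _∙_ (cong (λ k → f (num k) u) (sym (+-identityʳ i)))
  (trans (mapFrom≡listOf f (suc i) v)
    (listOf-cong (lenᵛ v) (λ j _ → cong (λ k → f (num k) (nthᵛ v j)) (sym (+-suc i j)))))

map≡listOf : ∀ {f g} v → (∀ i → i < lenᵛ v → f (num i) (nthᵛ v i) ≡ g i) →
             mapFrom f 0 v ≡ listOf (lenᵛ v) g
map≡listOf {f} v f≗g = trans (mapFrom≡listOf f 0 v) (listOf-cong (lenᵛ v) f≗g)

sum-listOf : ∀ n f → sumᵛ (listOf n f) ≡ ∑ n (toℕᵛ ∘ f)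
sum-listOf zero    f = refl
sum-listOf (suc n) f = cong (toℕᵛ (f 0) +_) (sum-listOf n (f ∘ suc))

sum-map : ∀ {f g} v → (∀ i → i < lenᵛ v → f (num i) (nthᵛ v i) ≡ num (g i)) →
          sumᵛ (mapFrom f 0 v) ≡ ∑ (lenᵛ v) g
sum-map {f} {g} v f≗g = trans (cong sumᵛ (map≡listOf v f≗g)) (sum-listOf (lenᵛ v) (num ∘ g))

-- Functions on an initial segment of ℕ instead of functions on Fin n.

extend : ∀ {A : Set} {n} → A → (Fin n → A) → ℕ → A
extend {n = zero}  d f i       = d
extend {n = suc n} d f zero    = f Fin.zero
extend {n = suc n} d f (suc i) = extend d (f ∘ Fin.suc) i

extend-toℕ : ∀ {A : Set} {n} (d : A) (f : Fin n → A) i → extend d f (toℕ i) ≡ f i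
extend-toℕ d f Fin.zero    = refl
extend-toℕ d f (Fin.suc i) = extend-toℕ d (f ∘ Fin.suc) i

on-Fin : ∀ {n} (P : ℕ → Set) → (∀ (i : Fin n) → P (toℕ i)) → ∀ {i} → i < n → P i
on-Fin P p i<n = subst P (toℕ-fromℕ< i<n) (p (fromℕ< i<n))

vecVal-tabulate : ∀ n {f : Fin n → Val} {g} → (∀ i → f i ≡ g (toℕ i)) →
                  vecVal (Vec.tabulate f) ≡ listOf n g
vecVal-tabulate zero    f≗g = refl
vecVal-tabulate (suc n) f≗g = cong₂ _∙_ (f≗g Fin.zero) (vecVal-tabulate n (f≗g ∘ Fin.suc))

vecVal-map : ∀ {A : Set} {n} {f : A → Val} {g} (v : Vec A n) →
             (∀ i → f (lookup v i) ≡ g (toℕ i)) → vecVal (Vec.map f v) ≡ listOf n g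
vecVal-map []      f≗g = refl
vecVal-map (x ∷ v) f≗g = cong₂ _∙_ (f≗g Fin.zero) (vecVal-map v (f≗g ∘ Fin.suc))

vecVal-replicate : ∀ n v → vecVal (Vec.replicate n v) ≡ listOf n (λ _ → v)
vecVal-replicate zero    v = refl
vecVal-replicate (suc n) v = cong (v ∙_) (vecVal-replicate n v)

∣∣≡∑ : ∀ {n} (Q : Subset n) {q} → (∀ i → lookup Q i ≡ q (toℕ i)) → ∣ Q ∣ ≡ ∑ n (𝟙 ∘ q)
∣∣≡∑ []           Q≗q = refl
∣∣≡∑ (inside ∷ Q)  Q≗q = cong₂ _+_ (cong 𝟙 (Q≗q Fin.zero)) (∣∣≡∑ Q (Q≗q ∘ Fin.suc))
∣∣≡∑ (outside ∷ Q) Q≗q = cong₂ _+_ (cong 𝟙 (Q≗q Fin.zero)) (∣∣≡∑ Q (Q≗q ∘ Fin.suc))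

-- Clique

graphVal : ℕ → (ℕ → ℕ → Bool) → Val
graphVal n b = listOf n λ i → listOf n λ j → bitVal (b i j)

Cliqueℕ : ℕ → (ℕ → ℕ → Bool) → ℕ → Set
Cliqueℕ n b k = ∃[ q ] (∑ n (𝟙 ∘ q) ≡ k ×
  (∀ {i j} → i < n → j < n → q i ≡ true → q j ≡ true → i ≢ j → b i j ≡ true))

Cliqueℕ-cong : ∀ {n b b′ k} → (∀ {i j} → i < n → j < n → b i j ≡ b′ i j) →
               Cliqueℕ n b k → Cliqueℕ n b′ k
Cliqueℕ-cong b≗b′ (q , ∑q , clique) = q , ∑q , λ i<n j<n qi qj i≢j →
  trans (sym (b≗b′ i<n j<n)) (clique i<n j<n qi qj i≢j)

HasClique⇔Cliqueℕ : ∀ G {b k} → (∀ i j → Graph.adj G i j ≡ b (toℕ i) (toℕ j)) →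
                    HasClique G k ⇔ Cliqueℕ (Graph.order G) b k
HasClique⇔Cliqueℕ G {b} {k} adj≗b = mk⇔ to from
  where
  open Graph G
  to : HasClique G k → Cliqueℕ order b k
  to (Q , ∣Q∣ , clique) = q , trans (sym (∣∣≡∑ Q (λ i → sym (extend-toℕ false (lookup Q) i)))) ∣Q∣ ,
    λ i<n j<n → on-Fin (λ i → q i ≡ true → q _ ≡ true → i ≢ _ → b i _ ≡ true)
      (λ i → on-Fin (λ j → q (toℕ i) ≡ true → q j ≡ true → toℕ i ≢ j → b (toℕ i) j ≡ true)
        (λ j qi qj i≢j → trans (sym (adj≗b i j)) (clique (member i qi) (member j qj) (i≢j ∘ cong toℕ)))
        j<n) i<n
    where
    q = extend false (lookup Q)
    member : ∀ i → q (toℕ i) ≡ true → i ∈ Q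
    member i qi = lookup⇒[]= i Q (trans (sym (extend-toℕ false (lookup Q) i)) qi)
  from : Cliqueℕ order b k → HasClique G k
  from (q , ∑q , clique) = Q , trans (∣∣≡∑ Q (lookup∘tabulate (q ∘ toℕ))) ∑q ,
    λ {i} {j} i∈Q j∈Q i≢j → trans (adj≗b i j)
      (clique (toℕ<n i) (toℕ<n j) (chosen′ i i∈Q) (chosen′ j j∈Q) (i≢j ∘ toℕ-injective))
    where
    Q = Vec.tabulate (q ∘ toℕ)
    chosen′ : ∀ i → i ∈ Q → q (toℕ i) ≡ true
    chosen′ i i∈Q = trans (sym (lookup∘tabulate (q ∘ toℕ) i)) ([]=⇒lookup i∈Q)

entryᵛ : Val → ℕ → ℕ → Bool
entryᵛ x i j = truth (nthᵛ (nthᵛ x i) j)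

-- Symmetrised and cleared on the diagonal, so that every value whatsoever decodes to a graph.
adjᵛ : Val → ℕ → ℕ → Bool
adjᵛ x i j = entryᵛ x i j ∧ (entryᵛ x j i ∧ not (i ≡ᵇ j))

truth-bitVal : ∀ b → truth (bitVal b) ≡ b
truth-bitVal true  = refl
truth-bitVal false = refl

matrixVal : ℕ → ℕ → (ℕ → ℕ → Bool) → Val
matrixVal m n s = listOf m λ i → listOf n λ j → bitVal (s i j)

entry-matrixVal : ∀ m n s {i j} → i < m → j < n → entryᵛ (matrixVal m n s) i j ≡ s i j
entry-matrixVal m n s {i} {j} i<m j<n = trans
  (cong (λ r → truth (nthᵛ r j)) (nth-listOf m _ i<m))
  (trans (cong truth (nth-listOf n _ j<n)) (truth-bitVal (s i j)))

matrixVal-cong : ∀ m n {s t} → (∀ {i j} → i < m → j < n → s i j ≡ t i j) →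
                 matrixVal m n s ≡ matrixVal m n t
matrixVal-cong m n s≗t = listOf-cong m λ i i<m → listOf-cong n λ j j<n → cong bitVal (s≗t i<m j<n)

adj-graphVal : ∀ n {b} → (∀ {i j} → i < n → j < n → b i j ≡ b j i) →
               (∀ {i} → i < n → b i i ≡ false) →
               ∀ {i j} → i < n → j < n → adjᵛ (graphVal n b) i j ≡ b i j
adj-graphVal n {b} b-sym b-irr {i} {j} i<n j<n
  rewrite entry-matrixVal n n b i<n j<n | entry-matrixVal n n b j<n i<n | b-sym j<n i<n
  with b i j in eq
... | false = refl
... | true  = cong not (≡ᵇ-false {i} {j} (λ { refl → contradiction (trans (sym eq) (b-irr i<n)) λ () }))

adj-symmetric : ∀ x i j → adjᵛ x i j ≡ adjᵛ x j i
adj-symmetric x i j rewrite ≡ᵇ-sym i j with entryᵛ x i j | entryᵛ x j i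
... | true  | true  = refl
... | true  | false = refl
... | false | true  = refl
... | false | false = refl

adj-irreflexive : ∀ x i → adjᵛ x i i ≡ false
adj-irreflexive x i rewrite ≡ᵇ-refl i with entryᵛ x i i
... | true  = refl
... | false = refl

-- Decoding never fails, so being the code of a graph is the single equation "decode, then encode,
-- gives `x` back", which a program can test.
ValidGraph : Val → Set
ValidGraph x = graphVal (lenᵛ x) (adjᵛ x) ≡ x

CliqueCondition : Val → ℕ → Set
CliqueCondition x k = ValidGraph x × Cliqueℕ (lenᵛ x) (adjᵛ x) k

graphVal-condition : ∀ n {b k} → (∀ {i j} → i < n → j < n → b i j ≡ b j i) →
                     (∀ {i} → i < n → b i i ≡ false) →
                     Cliqueℕ n b k ⇔ CliqueCondition (graphVal n b) k
graphVal-condition n {b} {k} b-sym b-irr = mk⇔ to from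
  where
  adj≡b = adj-graphVal n b-sym b-irr
  to : Cliqueℕ n b k → CliqueCondition (graphVal n b) k
  to c rewrite len-listOf n (λ i → listOf n (λ j → bitVal (b i j))) =
    matrixVal-cong n n adj≡b , Cliqueℕ-cong (λ i<n j<n → sym (adj≡b i<n j<n)) c
  from : CliqueCondition (graphVal n b) k → Cliqueℕ n b k
  from (_ , c) rewrite len-listOf n (λ i → listOf n (λ j → bitVal (b i j))) =
    Cliqueℕ-cong adj≡b c

-- A code determines its graph up to the representation of adjacency, so the quantifier over graphs
-- disappears in favour of a condition on `x` itself.
Clique⇔ : ∀ x k → Clique x k ⇔ CliqueCondition x k
Clique⇔ x k = mk⇔ to from
  where
  to : Clique x k → CliqueCondition x k
  to (G , refl , has) = subst (λ y → CliqueCondition y k)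
    (sym (vecVal-tabulate order (λ i → vecVal-tabulate order (λ j → cong bitVal (sym (b≡adj i j))))))
    (Equivalence.to (graphVal-condition order
      (λ i<n j<n → on-Fin (λ i → b i _ ≡ b _ i)
        (λ i → on-Fin (λ j → b (toℕ i) j ≡ b j (toℕ i))
          (λ j → trans (b≡adj i j) (trans (symmetric i j) (sym (b≡adj j i)))) j<n) i<n)
      (λ i<n → on-Fin (λ i → b i i ≡ false) (λ i → trans (b≡adj i i) (loopless i)) i<n))
      (Equivalence.to (HasClique⇔Cliqueℕ G (λ i j → sym (b≡adj i j))) has))
    where
    open Graph G
    b : ℕ → ℕ → Bool
    b = extend (λ _ → false) (λ i → extend false (adj i))
    b≡adj : ∀ i j → b (toℕ i) (toℕ j) ≡ adj i j
    b≡adj i j = trans (cong (λ r → r (toℕ j)) (extend-toℕ (λ _ → false) (λ i → extend false (adj i)) i))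
                      (extend-toℕ false (adj i) j)
  from : CliqueCondition x k → Clique x k
  from (valid , has) = G ,
    trans (vecVal-tabulate (lenᵛ x) (λ i → vecVal-tabulate (lenᵛ x) (λ j → refl))) valid ,
    Equivalence.from (HasClique⇔Cliqueℕ G (λ i j → refl)) has
    where
    G : Graph
    G = record
      { order     = lenᵛ x
      ; adj       = λ i j → adjᵛ x (toℕ i) (toℕ j)
      ; symmetric = λ i j → adj-symmetric x (toℕ i) (toℕ j)
      ; loopless  = λ i → adj-irreflexive x (toℕ i)
      }

-- MaxCover

coverVal : ℕ → ℕ → (ℕ → ℕ → Bool) → ℕ → Val
coverVal n m s L = listOf n (λ _ → num 0) ∙ matrixVal m n s ∙ num L

Frequencyℕ : ℕ → ℕ → ℕ → (ℕ → ℕ → Bool) → Set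
Frequencyℕ p n m s = ∀ e → e < n → ∑ m (λ i → 𝟙 (s i e)) ≤ p

coverage : ℕ → ℕ → (ℕ → ℕ → Bool) → (ℕ → Bool) → ℕ
coverage n m s q = ∑ n λ e → 𝟙 (anyᵇ m λ i → q i ∧ s i e)

Coverℕ : ℕ → ℕ → (ℕ → ℕ → Bool) → ℕ → ℕ → Set
Coverℕ n m s k L = ∃[ q ] (∑ m (𝟙 ∘ q) ≤ k × L ≤ coverage n m s q)

Frequencyℕ-cong : ∀ {p n m s t} → (∀ {i e} → i < m → e < n → s i e ≡ t i e) →
                  Frequencyℕ p n m s → Frequencyℕ p n m t
Frequencyℕ-cong {p} {m = m} s≗t freq e e<n = subst (_≤ p)
  (∑-cong m (λ i i<m → cong 𝟙 (s≗t i<m e<n))) (freq e e<n)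

Coverℕ-cong : ∀ {n m s t k L} → (∀ {i e} → i < m → e < n → s i e ≡ t i e) →
              Coverℕ n m s k L → Coverℕ n m t k L
Coverℕ-cong {n} {m} {L = L} s≗t (q , ∑q , cov) = q , ∑q , subst (L ≤_)
  (∑-cong n (λ e e<n → cong 𝟙 (anyᵇ-cong m (λ i i<m → cong (q i ∧_) (s≗t i<m e<n))))) cov

does-∈? : ∀ {n} (e : Fin n) S → does (e ∈? S) ≡ lookup S e
does-∈? e S with e ∈? S
... | yes e∈S = sym ([]=⇒lookup e∈S)
... | no  e∉S = sym (≡false (e∉S ∘ lookup⇒[]= e S))

count≡∑ : ∀ {n m} (e : Fin n) (𝒮 : Vec (Subset n) m) {t} →
          (∀ i → lookup (lookup 𝒮 i) e ≡ t (toℕ i)) → Vec.count (e ∈?_) 𝒮 ≡ ∑ m (𝟙 ∘ t)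
count≡∑ e []      𝒮≗t = refl
count≡∑ e (S ∷ 𝒮) 𝒮≗t with does (e ∈? S) | trans (does-∈? e S) (𝒮≗t Fin.zero)
... | true  | eq = cong₂ _+_ (cong 𝟙 eq) (count≡∑ e 𝒮 (𝒮≗t ∘ Fin.suc))
... | false | eq = cong₂ _+_ (cong 𝟙 eq) (count≡∑ e 𝒮 (𝒮≗t ∘ Fin.suc))

lookup-⋃ : ∀ {n m} (𝒮 : Vec (Subset n) m) (C : Subset m) (e : Fin n) {t} →
           (∀ i → lookup C i ∧ lookup (lookup 𝒮 i) e ≡ t (toℕ i)) →
           lookup (⋃ (chosen 𝒮 C)) e ≡ anyᵇ m t
lookup-⋃ []      []            e 𝒮≗t = lookup-replicate e outside
lookup-⋃ (S ∷ 𝒮) (inside ∷ C)  e 𝒮≗t = trans (lookup-zipWith _∨_ e S (⋃ (chosen 𝒮 C)))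
  (cong₂ _∨_ (𝒮≗t Fin.zero) (lookup-⋃ 𝒮 C e (𝒮≗t ∘ Fin.suc)))
lookup-⋃ (S ∷ 𝒮) (outside ∷ C) e {t} 𝒮≗t rewrite sym (𝒮≗t Fin.zero) = lookup-⋃ 𝒮 C e (𝒮≗t ∘ Fin.suc)

module _ (I : CoverInstance) {s : ℕ → ℕ → Bool}
         (family≗s : ∀ i e → lookup (lookup (CoverInstance.family I) i) e ≡ s (toℕ i) (toℕ e)) where

  open CoverInstance I

  encodeCover≡ : encodeCover I ≡ coverVal n m s L
  encodeCover≡ = cong₂ _∙_ (vecVal-replicate n (num 0)) (cong (_∙ num L)
    (vecVal-map family (λ i → vecVal-map (lookup family i) (λ e → cong bitVal (family≗s i e)))))

  frequency⇔ : ∀ {p} → (∀ e → frequency I e ≤ p) ⇔ Frequencyℕ p n m s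
  frequency⇔ {p} = mk⇔
    (λ freq e → on-Fin (λ e → ∑ m (λ i → 𝟙 (s i e)) ≤ p) (λ e → subst (_≤ p) (eq e) (freq e)) {e})
    (λ freq e → subst (_≤ p) (sym (eq e)) (freq (toℕ e) (toℕ<n e)))
    where
    eq : ∀ e → frequency I e ≡ ∑ m (λ i → 𝟙 (s i (toℕ e)))
    eq e = count≡∑ e family (λ i → family≗s i e)

  ∣⋃∣≡coverage : ∀ C {q} → (∀ i → lookup C i ≡ q (toℕ i)) →
                 ∣ ⋃ (chosen family C) ∣ ≡ coverage n m s q
  ∣⋃∣≡coverage C C≗q = ∣∣≡∑ (⋃ (chosen family C))
    (λ e → lookup-⋃ family C e (λ i → cong₂ _∧_ (C≗q i) (family≗s i e)))

  Coverable⇔ : Coverable I ⇔ Coverℕ n m s K L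
  Coverable⇔ = mk⇔
    (λ (C , ∣C∣ , L≤) → extend false (lookup C) ,
       subst (_≤ K) (∣∣≡∑ C (extended C)) ∣C∣ , subst (L ≤_) (∣⋃∣≡coverage C (extended C)) L≤)
    (λ (q , ∑q , L≤) → Vec.tabulate (q ∘ toℕ) ,
       subst (_≤ K) (sym (∣∣≡∑ (Vec.tabulate {n = m} (q ∘ toℕ)) {q} (lookup∘tabulate (q ∘ toℕ)))) ∑q ,
       subst (L ≤_) (sym (∣⋃∣≡coverage (Vec.tabulate (q ∘ toℕ)) {q} (lookup∘tabulate (q ∘ toℕ)))) L≤)
    where
    extended : ∀ C i → lookup C i ≡ extend false (lookup C) (toℕ i)
    extended C i = sym (extend-toℕ false (lookup C) i)

elements sets : Val → ℕ
elements x = lenᵛ (apply left x)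
sets     x = lenᵛ (apply left (apply right x))

inSet : Val → ℕ → ℕ → Bool
inSet x = entryᵛ (apply left (apply right x))

target : Val → ℕ
target x = toℕᵛ (apply right (apply right x))

ValidCover : Val → Set
ValidCover x = coverVal (elements x) (sets x) (inSet x) (target x) ≡ x

CoverCondition : ℕ → Val → ℕ → Set
CoverCondition p x k = ValidCover x × Frequencyℕ p (elements x) (sets x) (inSet x) ×
                       Coverℕ (elements x) (sets x) (inSet x) k (target x)

coverVal-condition : ∀ {p n m s L k} → (Frequencyℕ p n m s × Coverℕ n m s k L) ⇔
                     CoverCondition p (coverVal n m s L) k
coverVal-condition {p} {n} {m} {s} {L} {k} = mk⇔ to from
  where
  x = coverVal n m s L
  in≡s : ∀ {i e} → i < m → e < n → inSet x i e ≡ s i e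
  in≡s = entry-matrixVal m n s
  to : Frequencyℕ p n m s × Coverℕ n m s k L → CoverCondition p x k
  to (freq , cov) rewrite len-listOf n (λ _ → num 0)
                        | len-listOf m (λ i → listOf n (λ e → bitVal (s i e))) =
    cong (λ F → listOf n (λ _ → num 0) ∙ F ∙ num L) (matrixVal-cong m n in≡s) ,
    Frequencyℕ-cong {p} {n} {m} {s} (λ i<m e<n → sym (in≡s i<m e<n)) freq ,
    Coverℕ-cong {n} {m} {s} (λ i<m e<n → sym (in≡s i<m e<n)) cov
  from : CoverCondition p x k → Frequencyℕ p n m s × Coverℕ n m s k L
  from (_ , freq , cov) rewrite len-listOf n (λ _ → num 0)
                              | len-listOf m (λ i → listOf n (λ e → bitVal (s i e))) =
    Frequencyℕ-cong {p} {n} {m} in≡s freq , Coverℕ-cong {n} {m} in≡s cov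

MaxCover⇔ : ∀ p x k → MaxCover p x k ⇔ CoverCondition p x k
MaxCover⇔ p x k = mk⇔ to from
  where
  to : MaxCover p x k → CoverCondition p x k
  to (I , refl , refl , freq , cov) = subst (λ y → CoverCondition p y K) (sym (encodeCover≡ I {s} family≗s))
    (Equivalence.to (coverVal-condition {p} {n} {m} {s} {L} {K})
      (Equivalence.to (frequency⇔ I {s} family≗s) freq , Equivalence.to (Coverable⇔ I {s} family≗s) cov))
    where
    open CoverInstance I
    s : ℕ → ℕ → Bool
    s i e = extend (λ _ → false) (λ i → extend false (lookup (lookup family i))) i e
    family≗s : ∀ i e → lookup (lookup family i) e ≡ s (toℕ i) (toℕ e)
    family≗s i e = sym (trans
      (cong (λ r → r (toℕ e)) (extend-toℕ (λ _ → false) (λ i → extend false (lookup (lookup family i))) i))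
      (extend-toℕ false (lookup (lookup family i)) e))
  from : CoverCondition p x k → MaxCover p x k
  from (valid , freq , cov) = I , trans (encodeCover≡ I family≗s) valid , refl ,
    Equivalence.from (frequency⇔ I family≗s) freq , Equivalence.from (Coverable⇔ I family≗s) cov
    where
    I : CoverInstance
    I = record
      { n = elements x ; m = sets x ; K = k ; L = target x
      ; family = Vec.tabulate λ i → Vec.tabulate λ e → inSet x (toℕ i) (toℕ e)
      }
    family≗s : ∀ i e → lookup (lookup (CoverInstance.family I) i) e ≡ inSet x (toℕ i) (toℕ e)
    family≗s i e = trans
      (cong (λ S → lookup S e) (lookup∘tabulate (λ i → Vec.tabulate λ e → inSet x (toℕ i) (toℕ e)) i))
      (lookup∘tabulate (λ e → inSet x (toℕ i) (toℕ e)) e)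

-- Computable bounds

Computable-id : Computable id
Computable-id = prim ident , λ k → _ , run-prim

Computable-poly : ∀ p {f} → Computable f → Computable (eval p ∘ f)
Computable-poly X       cf = cf
Computable-poly (κ c)   cf = prim (const c) , λ k → _ , run-prim
Computable-poly (p ⊕ q) cf with Computable-poly p cf | Computable-poly q cf
... | P , rp | Q , rq = ⟨ P , Q ⟩ ⨾ prim add ,
  λ k → _ , run-seq (run-pair (proj₂ (rp k)) (proj₂ (rq k))) run-prim
Computable-poly (p ⊗ q) cf with Computable-poly p cf | Computable-poly q cf
... | P , rp | Q , rq = ⟨ P , Q ⟩ ⨾ prim mult ,
  λ k → _ , run-seq (run-pair (proj₂ (rp k)) (proj₂ (rq k))) run-prim

infixr 9 _^ₚ_
_^ₚ_ : Poly → ℕ → Poly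
p ^ₚ zero  = κ 1
p ^ₚ suc d = p ⊗ p ^ₚ d

eval-^ₚ : ∀ p d n → eval (p ^ₚ d) n ≡ eval p n ^ d
eval-^ₚ p zero    n = refl
eval-^ₚ p (suc d) n = cong (eval p n *_) (eval-^ₚ p d n)

^-distribʳ : ∀ a b d → (a * b) ^ d ≡ a ^ d * b ^ d
^-distribʳ a b zero    = refl
^-distribʳ a b (suc d) =
  trans (cong (a * b *_) (^-distribʳ a b d)) ([m*n]*[o*p]≡[m*o]*[n*p] a b (a ^ d) (b ^ d))

record PolyReduction (A B : ParamProblem) : Set where
  field
    reduction : PolyTime
    correct   : ∀ x k → ∃[ x′ ] (⟦ reduction ⟧ (x ∙ num k) ≡ x′ ∙ num k × (A x k ⇔ B x′ k))

-- The intermediate instance may be as large as the first running time φ s^c. A second bound a y^d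
-- turns this into a φ^d s^(c d): the power of φ still depends on k only, and c d goes into the
-- exponent. The second reduction keeps the parameter, so `g` is unchanged.
≤fpt-∘ : ∀ {A B C} → A ≤fpt B → PolyReduction B C → A ≤fpt C
≤fpt-∘ {A} {B} {C} A≤B B≤C with poly≤monomial (bound (PolyReduction.reduction B≤C))
... | a , d , monomial = record
  { program      = A≤B.program ⨾ program reduction
  ; f            = eval f′ ∘ A≤B.f
  ; g            = A≤B.g
  ; c            = A≤B.c + A≤B.c * d
  ; f-computable = Computable-poly f′ A≤B.f-computable
  ; g-computable = A≤B.g-computable
  ; reduces      = reduces′
  }
  where
  module A≤B = _≤fpt_ A≤B
  open PolyReduction B≤C
  f′ : Poly
  f′ = κ 1 ⊕ (X ⊕ κ a ⊗ X ^ₚ d)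
  reduces′ : ∀ x k → ∃[ x′ ] ∃[ k′ ] ∃[ t ]
               (A≤B.program ⨾ program reduction ⊢ x ∙ num k ⇓ x′ ∙ num k′ ∣ t
                × t ≤ eval f′ (A≤B.f k) * size (x ∙ num k) ^ (A≤B.c + A≤B.c * d)
                × k′ ≤ A≤B.g k
                × (A x k ⇔ C x′ k′))
  reduces′ x k with A≤B.reduces x k
  ... | x′ , k′ , t , r , t≤ , k′≤ , A⇔B with correct x′ k′ | runs reduction (x′ ∙ num k′)
  ...   | x″ , eq , B⇔C | t′ , r′ , t′≤ = x″ , k′ , suc (t + t′) ,
    run-seq r (subst (λ w → program reduction ⊢ x′ ∙ num k′ ⇓ w ∣ t′) eq r′) ,
    time≤ , k′≤ , B⇔C ⇔-∘ A⇔B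
    where
    open ≤-Reasoning
    s e φ : ℕ
    s = size (x ∙ num k)
    e = A≤B.c + A≤B.c * d
    φ = A≤B.f k
    T≤ : φ * s ^ A≤B.c ≤ φ * s ^ e
    T≤ = *-monoʳ-≤ φ (^-monoʳ-≤ s (m≤m+n A≤B.c (A≤B.c * d)))
    t′≤′ : t′ ≤ a * (φ ^ d * s ^ e)
    t′≤′ = begin
      t′                                          ≤⟨ t′≤ ⟩
      eval (bound reduction) (size (x′ ∙ num k′)) ≤⟨ monomial _ (1≤size (x′ ∙ num k′)) ⟩
      a * size (x′ ∙ num k′) ^ d                  ≤⟨ *-monoʳ-≤ a (^-monoˡ-≤ d (≤-trans (output≤time r) t≤)) ⟩
      a * (φ * s ^ A≤B.c) ^ d                     ≡⟨ cong (a *_) (^-distribʳ φ (s ^ A≤B.c) d) ⟩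
      a * (φ ^ d * (s ^ A≤B.c) ^ d)               ≡⟨ cong (λ z → a * (φ ^ d * z)) (^-*-assoc s A≤B.c d) ⟩
      a * (φ ^ d * s ^ (A≤B.c * d))               ≤⟨ *-monoʳ-≤ a (*-monoʳ-≤ (φ ^ d)
                                                       (^-monoʳ-≤ s (m≤n+m (A≤B.c * d) A≤B.c))) ⟩
      a * (φ ^ d * s ^ e)                         ∎
    time≤ : suc (t + t′) ≤ eval f′ φ * s ^ e
    time≤ = begin
      1 + (t + t′)                                  ≤⟨ +-mono-≤ (1≤^ e (1≤size (x ∙ num k)))
                                                         (+-mono-≤ (≤-trans t≤ T≤) t′≤′) ⟩
      s ^ e + (φ * s ^ e + a * (φ ^ d * s ^ e))     ≡⟨ lemma (s ^ e) φ a (φ ^ d) ⟩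
      (1 + (φ + a * φ ^ d)) * s ^ e                 ≡⟨ cong (λ z → (1 + (φ + a * z)) * s ^ e) (eval-^ₚ X d φ) ⟨
      eval f′ φ * s ^ e                             ∎
      where
      lemma : ∀ z f a g → z + (f * z + a * (g * z)) ≡ (1 + (f + a * g)) * z
      lemma = solve-∀

-- Expressions over an environment, which is a list of values

infixr 10 var_
var_ : ℕ → PolyTime
var zero  = fstᵖ
var suc i = var i ∘ᵖ sndᵖ

notᵖ boolᵖ : PolyTime → PolyTime
notᵖ  E = ifᵖ E then natᵖ 0 else natᵖ 1
boolᵖ E = ifᵖ E then natᵖ 1 else natᵖ 0

andᵖ orᵖ nthᵖ : PolyTime → PolyTime → PolyTime
andᵖ E F = ifᵖ E then F else natᵖ 0
orᵖ  E F = ifᵖ E then natᵖ 1 else F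

lenᵖ : PolyTime → PolyTime
lenᵖ E = sumᵖ (forᵖ E (natᵖ 1))

nthᵖ E I = fstᵖ ∘ᵖ concatᵖ (forᵖ (var 0) (ifᵖ eqᵖ (var 0) (var 3) then (var 1 ,ᵖ natᵖ 0) else natᵖ 0))
                ∘ᵖ (E ,ᵖ I ,ᵖ natᵖ 0)

if-bit : ∀ {A : Set} b {u} {x y : A} → u ≡ bitVal b → (if truth u then x else y) ≡ (if b then x else y)
if-bit true  refl = refl
if-bit false refl = refl

not-bit : ∀ {b u} → u ≡ bitVal b → (if truth u then num 0 else num 1) ≡ bitVal (not b)
not-bit {true}  refl = refl
not-bit {false} refl = refl

and-bit : ∀ {a b u v} → u ≡ bitVal a → v ≡ bitVal b → (if truth u then v else num 0) ≡ bitVal (a ∧ b)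
and-bit {true}  refl eq = eq
and-bit {false} refl eq = refl

or-bit : ∀ {a b u v} → u ≡ bitVal a → v ≡ bitVal b → (if truth u then num 1 else v) ≡ bitVal (a ∨ b)
or-bit {true}  refl eq = refl
or-bit {false} refl eq = eq

bool-bit : ∀ u → (if truth u then num 1 else num 0) ≡ bitVal (truth u)
bool-bit u with truth u
... | true  = refl
... | false = refl

eq-bit : ∀ {a b u v} → u ≡ num a → v ≡ num b → bitVal (eqᵛ u v) ≡ bitVal (a ≡ᵇ b)
eq-bit refl refl = refl

eqᵛ-sound : ∀ u v → eqᵛ u v ≡ true → u ≡ v
eqᵛ-sound (num a) (num b) eq = cong num (≡ᵇ-sound {a} eq)
eqᵛ-sound (u ∙ v) (w ∙ x) eq with ∧-elim {eqᵛ u w} eq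
... | eq₁ , eq₂ = cong₂ _∙_ (eqᵛ-sound u w eq₁) (eqᵛ-sound v x eq₂)

eqᵛ-refl : ∀ u → eqᵛ u u ≡ true
eqᵛ-refl (num a) = ≡ᵇ-refl a
eqᵛ-refl (u ∙ v) = ∧-intro (eqᵛ-refl u) (eqᵛ-refl v)

count-map : ∀ v → sumᵛ (mapFrom (λ _ _ → num 1) 0 v) ≡ lenᵛ v
count-map v = trans (sum-map {g = λ _ → 1} v (λ _ _ → refl))
                    (trans (∑-const (lenᵛ v) 1) (*-identityʳ _))

-- The loop maps position i to a singleton and all others to empty lists, so the head of the
-- concatenation is the entry. If i is out of range the concatenation is `num 0`, and `left` of it
-- is the default `num 0`.
⟦nthᵖ⟧ : ∀ E I ρ {i} → ⟦ I ⟧ ρ ≡ num i → ⟦ nthᵖ E I ⟧ ρ ≡ nthᵛ (⟦ E ⟧ ρ) i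
⟦nthᵖ⟧ E I ρ {i} eq rewrite eq = go (⟦ E ⟧ ρ) 0 i
  where
  pick : ℕ → Val → Val → Val
  pick i j x = if truth (bitVal (eqᵛ j (num i))) then x ∙ num 0 else num 0
  go : ∀ l j i → apply left (concatᵛ (mapFrom (pick (j + i)) j l)) ≡ nthᵛ l i
  go (num n) j i       = refl
  go (u ∙ v) j zero    rewrite ≡ᵇ-complete {j} (sym (+-identityʳ j)) = refl
  go (u ∙ v) j (suc i) rewrite ≡ᵇ-false {j} {j + suc i} (m≢1+m+n j ∘ (λ eq → trans eq (+-suc j i)))
                             | +-suc j i = go v (suc j) i

entryᵖ adjᵖ : PolyTime → PolyTime → PolyTime → PolyTime
entryᵖ E I J = boolᵖ (nthᵖ (nthᵖ E I) J)
adjᵖ   E I J = andᵖ (entryᵖ E I J) (andᵖ (entryᵖ E J I) (notᵖ (eqᵖ I J)))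

⟦entryᵖ⟧ : ∀ E I J ρ {i j} → ⟦ I ⟧ ρ ≡ num i → ⟦ J ⟧ ρ ≡ num j →
           ⟦ entryᵖ E I J ⟧ ρ ≡ bitVal (entryᵛ (⟦ E ⟧ ρ) i j)
⟦entryᵖ⟧ E I J ρ {i} {j} i≡ j≡ = trans (bool-bit (⟦ nthᵖ (nthᵖ E I) J ⟧ ρ))
  (cong (bitVal ∘ truth) (trans (⟦nthᵖ⟧ (nthᵖ E I) J ρ j≡) (cong (λ r → nthᵛ r j) (⟦nthᵖ⟧ E I ρ i≡))))

⟦adjᵖ⟧ : ∀ E I J ρ {i j} → ⟦ I ⟧ ρ ≡ num i → ⟦ J ⟧ ρ ≡ num j →
         ⟦ adjᵖ E I J ⟧ ρ ≡ bitVal (adjᵛ (⟦ E ⟧ ρ) i j)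
⟦adjᵖ⟧ E I J ρ i≡ j≡ = and-bit (⟦entryᵖ⟧ E I J ρ i≡ j≡)
  (and-bit (⟦entryᵖ⟧ E J I ρ j≡ i≡) (not-bit (eq-bit i≡ j≡)))

∑ᵛ : (Val → ℕ) → Val → ℕ
∑ᵛ g (num n) = 0
∑ᵛ g (u ∙ v) = g u + ∑ᵛ g v

∑-nth : ∀ g v → ∑ (lenᵛ v) (g ∘ nthᵛ v) ≡ ∑ᵛ g v
∑-nth g (num n) = refl
∑-nth g (u ∙ v) = cong (g u +_) (∑-nth g v)

∑ᵛ-append : ∀ g u v → ∑ᵛ g (appendᵛ u v) ≡ ∑ᵛ g u + ∑ᵛ g v
∑ᵛ-append g (num n) v = refl
∑ᵛ-append g (x ∙ u) v = trans (cong (g x +_) (∑ᵛ-append g u v)) (sym (+-assoc (g x) _ _))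

∑ᵛ-concat : ∀ g n f → ∑ᵛ g (concatᵛ (listOf n f)) ≡ ∑ n (λ i → ∑ᵛ g (f i))
∑ᵛ-concat g zero    f = refl
∑ᵛ-concat g (suc n) f = trans (∑ᵛ-append g (f 0) _) (cong (∑ᵛ g (f 0) +_) (∑ᵛ-concat g n (f ∘ suc)))

infixr 5 _◂_
data Allᵛ (P : Val → Set) : Val → Set where
  end : ∀ {n} → Allᵛ P (num n)
  _◂_ : ∀ {u v} → P u → Allᵛ P v → Allᵛ P (u ∙ v)

Allᵛ-nth : ∀ {P v} → Allᵛ P v → ∀ {i} → i < lenᵛ v → P (nthᵛ v i)
Allᵛ-nth (p ◂ ps) {zero}  _         = p
Allᵛ-nth (p ◂ ps) {suc i} (s≤s i<n) = Allᵛ-nth ps i<n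

Allᵛ-append : ∀ {P u v} → Allᵛ P u → Allᵛ P v → Allᵛ P (appendᵛ u v)
Allᵛ-append end      qs = qs
Allᵛ-append (p ◂ ps) qs = p ◂ Allᵛ-append ps qs

Allᵛ-listOf : ∀ {P} n {f} → (∀ i → i < n → P (f i)) → Allᵛ P (listOf n f)
Allᵛ-listOf zero    p = end
Allᵛ-listOf (suc n) p = p 0 z<s ◂ Allᵛ-listOf n (λ i i<n → p (suc i) (s<s i<n))

Allᵛ-concat : ∀ {P} n {f} → (∀ i → i < n → Allᵛ P (f i)) → Allᵛ P (concatᵛ (listOf n f))
Allᵛ-concat zero    p = end
Allᵛ-concat (suc n) p = Allᵛ-append (p 0 z<s) (Allᵛ-concat n (λ i i<n → p (suc i) (s<s i<n)))

⟦concat-for⟧ : ∀ {f g} v → (∀ i → i < lenᵛ v → f (num i) (nthᵛ v i) ≡ g i) →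
               concatᵛ (mapFrom f 0 v) ≡ concatᵛ (listOf (lenᵛ v) g)
⟦concat-for⟧ v f≗g = cong concatᵛ (map≡listOf v f≗g)

-- The reduction from Clique to MaxCover

module CliqueToCover where

  -- The environment is (x , k).

  canonical : PolyTime
  canonical = forᵖ (var 0) (forᵖ (var 2) (adjᵖ (var 4) (var 2) (var 0)))

  ground : PolyTime → PolyTime
  ground E = concatᵖ (forᵖ (var 0) (concatᵖ (forᵖ (var 2)
    ((var 2 ,ᵖ var 0 ,ᵖ natᵖ 0) ,ᵖ (var 2 ,ᵖ var 0 ,ᵖ natᵖ 1) ,ᵖ natᵖ 0)))) ∘ᵖ (E ,ᵖ natᵖ 0)

  -- Whether the element z lies in the set of the vertex w of x, in the
  -- environment (_ , z , w , _ , x , _).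
  memberᵖ : PolyTime
  memberᵖ = ifᵖ sndᵖ ∘ᵖ sndᵖ ∘ᵖ var 1 then andᵖ (eqᵖ w v) near else orᵖ (eqᵖ w u) (andᵖ (eqᵖ w v) (notᵖ near))
    where
    u v w near : PolyTime
    u    = fstᵖ ∘ᵖ var 1
    v    = fstᵖ ∘ᵖ sndᵖ ∘ᵖ var 1
    w    = var 2
    near = orᵖ (eqᵖ u v) (adjᵖ (var 4) u v)

  cover : PolyTime
  cover = forᵖ (ground (var 0)) (natᵖ 0)
       ,ᵖ forᵖ (var 0) (forᵖ (ground (var 2)) memberᵖ)
       ,ᵖ multᵖ (addᵖ (addᵖ n n) (monusᵖ (natᵖ 1) n)) sndᵖ
    where
    n = lenᵖ (var 0)

  program′ : PolyTime
  program′ = (ifᵖ eqᵖ canonical (var 0) then cover else natᵖ 1) ,ᵖ sndᵖ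

  groundᵛ : ℕ → Val
  groundᵛ n = concatᵛ (listOf n λ u → concatᵛ (listOf n λ v →
    (num u ∙ num v ∙ num 0) ∙ (num u ∙ num v ∙ num 1) ∙ num 0))

  ⟦ground⟧ : ∀ E ρ → ⟦ ground E ⟧ ρ ≡ groundᵛ (lenᵛ (⟦ E ⟧ ρ))
  ⟦ground⟧ E ρ = ⟦concat-for⟧ (⟦ E ⟧ ρ) λ u _ → ⟦concat-for⟧ (⟦ E ⟧ ρ) λ v _ → refl

  ⟦canonical⟧ : ∀ x k → ⟦ canonical ⟧ (x ∙ k) ≡ graphVal (lenᵛ x) (adjᵛ x)
  ⟦canonical⟧ x k = map≡listOf x λ i _ → map≡listOf x λ j _ →
    ⟦adjᵖ⟧ (var 4) (var 2) (var 0) (num j ∙ nthᵛ x j ∙ num i ∙ nthᵛ x i ∙ x ∙ k) refl refl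

  near : Val → ℕ → ℕ → Bool
  near x u v = (u ≡ᵇ v) ∨ adjᵛ x u v

  -- Bit 0 marks the element owned by u, which v shares when the two are not close; bit 1 marks the
  -- element owned by v, which then lies in no set.
  member : Val → ℕ → ℕ → ℕ → Bool → Bool
  member x w u v b = if b then (w ≡ᵇ v) ∧ near x u v else (w ≡ᵇ u) ∨ ((w ≡ᵇ v) ∧ not (near x u v))

  memberᵛ : Val → ℕ → Val → Bool
  memberᵛ x w z = member x w (toℕᵛ (apply left z)) (toℕᵛ (apply left (apply right z)))
                         (truth (apply right (apply right z)))

  IsElement : ℕ → Val → Set
  IsElement n z = ∃[ u ] ∃[ v ] ∃[ b ] (u < n × v < n × z ≡ num u ∙ num v ∙ bitVal b)

  ground-elements : ∀ n → Allᵛ (IsElement n) (groundᵛ n)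
  ground-elements n = Allᵛ-concat n λ u u<n → Allᵛ-concat n λ v v<n →
    (u , v , false , u<n , v<n , refl) ◂ (u , v , true , u<n , v<n , refl) ◂ end

  ⟦memberᵖ⟧ : ∀ x w {n z} → IsElement n z → ∀ {i y k} →
              ⟦ memberᵖ ⟧ (i ∙ z ∙ num w ∙ y ∙ x ∙ k) ≡ bitVal (memberᵛ x w z)
  ⟦memberᵖ⟧ x w (u , v , b , _ , _ , refl) {i} {y} {k} = lemma b
    where
    near≡ : ∀ b → _
    near≡ b = or-bit {u ≡ᵇ v} refl (⟦adjᵖ⟧ (var 4) (fstᵖ ∘ᵖ var 1) (fstᵖ ∘ᵖ sndᵖ ∘ᵖ var 1)
      (i ∙ (num u ∙ num v ∙ bitVal b) ∙ num w ∙ y ∙ x ∙ k) {u} {v} refl refl)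
    lemma : ∀ b → ⟦ memberᵖ ⟧ (i ∙ (num u ∙ num v ∙ bitVal b) ∙ num w ∙ y ∙ x ∙ k) ≡
                  bitVal (member x w u v (truth (bitVal b)))
    lemma true  = and-bit {w ≡ᵇ v} refl (near≡ true)
    lemma false = or-bit {w ≡ᵇ u} refl (and-bit {w ≡ᵇ v} refl (not-bit (near≡ false)))

  instanceSize : Val → ℕ
  instanceSize x = lenᵛ (groundᵛ (lenᵛ x))

  incidence : Val → ℕ → ℕ → Bool
  incidence x w e = memberᵛ x w (nthᵛ (groundᵛ (lenᵛ x)) e)

  -- This is 2nk unless n = 0. There 2nk = 0 would be reached by the empty collection even for k >
  -- 0, when no clique exists; the summand 1 ∸ n raises the target to k.
  targetFor : ℕ → ℕ → ℕ
  targetFor n k = ((n + n) + (1 ∸ n)) * k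

  ⟦cover⟧ : ∀ x k → ⟦ cover ⟧ (x ∙ num k) ≡
            coverVal (instanceSize x) (lenᵛ x) (incidence x) (targetFor (lenᵛ x) k)
  ⟦cover⟧ x k = cong₂ _∙_
    (trans (map≡listOf {g = λ _ → num 0} (⟦ ground (var 0) ⟧ (x ∙ num k)) λ _ _ → refl)
           (cong (λ v → listOf (lenᵛ v) (λ _ → num 0)) (⟦ground⟧ (var 0) (x ∙ num k))))
    (cong₂ _∙_
      (map≡listOf x λ w _ → trans
        (cong (mapFrom _ 0) (⟦ground⟧ (var 2) (num w ∙ nthᵛ x w ∙ x ∙ num k)))
        (map≡listOf (groundᵛ (lenᵛ x)) λ e e<n →
          ⟦memberᵖ⟧ x w (Allᵛ-nth (ground-elements (lenᵛ x)) e<n) {num e} {nthᵛ x w} {num k}))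
      target≡)
    where
    target≡ : ⟦ multᵖ (addᵖ (addᵖ (lenᵖ (var 0)) (lenᵖ (var 0))) (monusᵖ (natᵖ 1) (lenᵖ (var 0)))) sndᵖ ⟧
                (x ∙ num k) ≡ num (targetFor (lenᵛ x) k)
    target≡ = cong (λ m → num (targetFor m k)) (count-map x)

  uncovering : Val → (ℕ → Bool) → ℕ → ℕ → Bool
  uncovering x q u v = q u ∧ (q v ∧ not (near x u v))

  near-distinct : ∀ x {u v} → u ≢ v → near x u v ≡ adjᵛ x u v
  near-distinct x {u} {v} u≢v = cong (_∨ adjᵛ x u v) (≡ᵇ-false u≢v)

  forced : ∀ {a b c} → a ≡ true → b ≡ true → 𝟙 (a ∧ (b ∧ not c)) ≡ 0 → c ≡ true
  forced {c = true} refl refl _ = refl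

  any-single : ∀ n (q : ℕ → Bool) v c → v < n → anyᵇ n (λ w → q w ∧ ((w ≡ᵇ v) ∧ c)) ≡ q v ∧ c
  any-single n q v c v<n = Bool-ext
    (λ eq → let w , _ , both = anyᵇ-elim n _ eq
                qw , rest    = ∧-elim {q w} both
                w≡v , c≡     = ∧-elim {w ≡ᵇ v} rest
            in ∧-intro (subst (λ w → q w ≡ true) (≡ᵇ-sound {w} w≡v) qw) c≡)
    (λ eq → let qv , c≡ = ∧-elim {q v} eq
            in anyᵇ-intro n _ v<n (∧-intro qv (∧-intro (≡ᵇ-refl v) c≡)))

  any-double : ∀ n (q : ℕ → Bool) u v c → u < n → v < n →
               anyᵇ n (λ w → q w ∧ ((w ≡ᵇ u) ∨ ((w ≡ᵇ v) ∧ c))) ≡ q u ∨ (q v ∧ c)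
  any-double n q u v c u<n v<n = Bool-ext to from
    where
    t : ℕ → Bool
    t w = q w ∧ ((w ≡ᵇ u) ∨ ((w ≡ᵇ v) ∧ c))
    to : anyᵇ n t ≡ true → q u ∨ (q v ∧ c) ≡ true
    to eq with anyᵇ-elim n t eq
    ... | w , _ , both with ∧-elim {q w} both
    ...   | qw , rest with w ≡ᵇ u in w≡u
    ...     | true rewrite sym (≡ᵇ-sound {w} w≡u) | qw = refl
    ...     | false with ∧-elim {w ≡ᵇ v} rest
    ...       | w≡v , c≡ rewrite sym (≡ᵇ-sound {w} w≡v) | qw | c≡ with q u
    ...         | true  = refl
    ...         | false = refl
    from : q u ∨ (q v ∧ c) ≡ true → anyᵇ n t ≡ true
    from eq with q u in qu
    ... | true  = anyᵇ-intro n t u<n (∧-intro qu (cong (_∨ ((u ≡ᵇ v) ∧ c)) (≡ᵇ-refl u)))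
    ... | false with ∧-elim {q v} eq
    ...   | qv , c≡ = anyᵇ-intro n t v<n (∧-intro qv right-true)
      where
      right-true : (v ≡ᵇ u) ∨ ((v ≡ᵇ v) ∧ c) ≡ true
      right-true rewrite ≡ᵇ-refl v | c≡ with v ≡ᵇ u
      ... | true  = refl
      ... | false = refl

  -- The account of one ordered pair (u , v): a and b say whether u and v are chosen, c whether they
  -- are close. One element is lost exactly when both are chosen and not close.
  pair-count : ∀ a b c → 𝟙 (a ∨ (b ∧ not c)) + (𝟙 (b ∧ c) + 0) + 𝟙 (a ∧ (b ∧ not c)) ≡ 𝟙 a + 𝟙 b
  pair-count true  true  true  = refl
  pair-count true  true  false = refl
  pair-count true  false true  = refl
  pair-count true  false false = refl
  pair-count false true  true  = refl
  pair-count false true  false = refl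
  pair-count false false true  = refl
  pair-count false false false = refl

  defect : Val → (ℕ → Bool) → ℕ
  defect x q = ∑ (lenᵛ x) λ u → ∑ (lenᵛ x) λ v → 𝟙 (uncovering x q u v)

  -- `pair-count` summed over all ordered pairs; every chosen vertex occurs n times as first and n
  -- times as second coordinate.
  coverage-defect : ∀ x q → let n = lenᵛ x in
    coverage (instanceSize x) n (incidence x) q + defect x q ≡ (n + n) * ∑ n (𝟙 ∘ q)
  coverage-defect x q = begin
    coverage (instanceSize x) n (incidence x) q + defect x q
      ≡⟨ cong (_+ defect x q) (trans (∑-nth g (groundᵛ n)) (trans (∑ᵛ-concat g n _)
           (∑-cong n λ u _ → ∑ᵛ-concat g n _))) ⟩
    ∑ n (λ u → ∑ n (λ v → g (num u ∙ num v ∙ num 0) + (g (num u ∙ num v ∙ num 1) + 0))) + defect x q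
      ≡⟨ cong (_+ defect x q) (∑-cong n λ u u<n → ∑-cong n λ v v<n → cong₂ (λ a b → 𝟙 a + (𝟙 b + 0))
           (any-double n q u v (not (near x u v)) u<n v<n)
           (any-single n q v (near x u v) v<n)) ⟩
    ∑ n (λ u → ∑ n (f u)) + defect x q
      ≡⟨ trans (sym (∑-+ n _ _)) (∑-cong n λ u _ → sym (∑-+ n (f u) _)) ⟩
    ∑ n (λ u → ∑ n (λ v → f u v + 𝟙 (uncovering x q u v)))
      ≡⟨ ∑-cong n (λ u _ → ∑-cong n λ v _ → pair-count (q u) (q v) (near x u v)) ⟩
    ∑ n (λ u → ∑ n (λ v → 𝟙 (q u) + 𝟙 (q v)))
      ≡⟨ ∑-cong n (λ u _ → trans (∑-+ n _ _) (cong (_+ ∑ n (𝟙 ∘ q)) (∑-const n _))) ⟩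
    ∑ n (λ u → n * 𝟙 (q u) + ∑ n (𝟙 ∘ q))
      ≡⟨ trans (∑-+ n _ _) (cong₂ _+_ (∑-*ˡ n n (𝟙 ∘ q)) (∑-const n _)) ⟩
    n * ∑ n (𝟙 ∘ q) + n * ∑ n (𝟙 ∘ q)
      ≡⟨ *-distribʳ-+ (∑ n (𝟙 ∘ q)) n n ⟨
    (n + n) * ∑ n (𝟙 ∘ q) ∎
    where
    open ≡-Reasoning
    n : ℕ
    n = lenᵛ x
    g : Val → ℕ
    g z = 𝟙 (anyᵇ n λ w → q w ∧ memberᵛ x w z)
    f : ℕ → ℕ → ℕ
    f u v = 𝟙 (q u ∨ (q v ∧ not (near x u v))) + (𝟙 (q v ∧ near x u v) + 0)

  𝟙-∨ : ∀ a b → 𝟙 (a ∨ b) ≤ 𝟙 a + 𝟙 b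
  𝟙-∨ true  b = s≤s z≤n
  𝟙-∨ false b = ≤-refl

  𝟙-∧ : ∀ a b → 𝟙 (a ∧ b) ≤ 𝟙 a
  𝟙-∧ true  b = 𝟙≤1 b
  𝟙-∧ false b = z≤n

  member≤ : ∀ x w u v b → 𝟙 (member x w u v b) ≤ 𝟙 (u ≡ᵇ w) + 𝟙 (v ≡ᵇ w)
  member≤ x w u v true  = ≤-trans (𝟙-∧ (w ≡ᵇ v) (near x u v))
    (≤-trans (≤-reflexive (cong 𝟙 (≡ᵇ-sym w v))) (m≤n+m _ _))
  member≤ x w u v false = ≤-trans (𝟙-∨ (w ≡ᵇ u) _) (+-mono-≤
    (≤-reflexive (cong 𝟙 (≡ᵇ-sym w u)))
    (≤-trans (𝟙-∧ (w ≡ᵇ v) _) (≤-reflexive (cong 𝟙 (≡ᵇ-sym w v)))))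

  frequency≤2 : ∀ x → Frequencyℕ 2 (instanceSize x) (lenᵛ x) (incidence x)
  frequency≤2 x e e<n = ≤-trans
    (∑-mono n λ w _ → member≤ x w u v (truth (apply right (apply right z))))
    (≤-trans (≤-reflexive (∑-+ n _ _)) (+-mono-≤ (∑-δ-≤1 n u) (∑-δ-≤1 n v)))
    where
    n = lenᵛ x
    z = nthᵛ (groundᵛ n) e
    u = toℕᵛ (apply left z)
    v = toℕᵛ (apply left (apply right z))

  clique⇔cover : ∀ x k → let n = lenᵛ x in Cliqueℕ n (adjᵛ x) k ⇔
                 Coverℕ (instanceSize x) n (incidence x) k (targetFor n k)
  clique⇔cover x k = mk⇔ to from
    where
    open ≤-Reasoning
    n : ℕ
    n = lenᵛ x
    cov : (ℕ → Bool) → ℕ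
    cov = coverage (instanceSize x) n (incidence x)

    to : Cliqueℕ n (adjᵛ x) k → Coverℕ (instanceSize x) n (incidence x) k (targetFor n k)
    to (q , ∑q , clique) = q , ≤-reflexive ∑q , (begin
      targetFor n k                 ≤⟨ bounded n refl ⟩
      (n + n) * k                   ≡⟨ cong ((n + n) *_) ∑q ⟨
      (n + n) * ∑ n (𝟙 ∘ q)         ≡⟨ coverage-defect x q ⟨
      cov q + defect x q            ≡⟨ cong (cov q +_) no-defect ⟩
      cov q + 0                     ≡⟨ +-identityʳ _ ⟩
      cov q                         ∎)
      where
      bounded : ∀ m → n ≡ m → targetFor m k ≤ (m + m) * k
      -- Without vertices the clique has size 0, so k = 0 and the correction in the target vanishes
      -- as well.
      bounded zero    n≡0 = ≤-reflexive (trans (+-identityʳ k)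
        (trans (sym ∑q) (cong (λ m → ∑ m (𝟙 ∘ q)) n≡0)))
      bounded (suc m) _   = ≤-reflexive (cong (_* k) (trans (cong (suc m + suc m +_) (0∸n≡0 m)) (+-identityʳ _)))
      no-defect : defect x q ≡ 0
      no-defect = ∑-zero n λ u u<n → ∑-zero n λ v v<n → cong 𝟙 (≡false λ eq →
        let qu , rest  = ∧-elim {q u} eq
            qv , far   = ∧-elim {q v} rest
        in contradiction (trans (sym (cong not (close u v u<n v<n qu qv))) far) λ ())
        where
        close : ∀ u v → u < n → v < n → q u ≡ true → q v ≡ true → near x u v ≡ true
        close u v u<n v<n qu qv with u ≟ v
        ... | yes refl = cong (_∨ adjᵛ x u u) (≡ᵇ-refl u)
        ... | no  u≢v  = trans (near-distinct x u≢v) (clique u<n v<n qu qv u≢v)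

    from : Coverℕ (instanceSize x) n (incidence x) k (targetFor n k) → Cliqueℕ n (adjᵛ x) k
    from (q , ∑q≤k , L≤) = q , ≤-antisym ∑q≤k (k≤∑q n refl) , λ {u} {v} u<n v<n qu qv u≢v →
        adjacent u v u≢v qu qv (∑-≡0 n _ (∑-≡0 n _ no-defect u<n) v<n)
      where
      cov≤ : cov q ≤ (n + n) * ∑ n (𝟙 ∘ q)
      cov≤ = ≤-trans (m≤m+n (cov q) (defect x q)) (≤-reflexive (coverage-defect x q))
      -- A chosen set accounts for at most 2n covered elements, so the target forces k sets; with at
      -- most k sets it then leaves no room for a defect.
      k≤∑q : ∀ m → n ≡ m → k ≤ ∑ n (𝟙 ∘ q)
      k≤∑q zero n≡0 = ≤-trans (begin
        k                         ≡⟨ +-identityʳ k ⟨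
        targetFor 0 k             ≡⟨ cong (λ m → targetFor m k) n≡0 ⟨
        targetFor n k             ≤⟨ L≤ ⟩
        cov q                     ≤⟨ cov≤ ⟩
        (n + n) * ∑ n (𝟙 ∘ q)     ≡⟨ cong (λ m → (m + m) * ∑ n (𝟙 ∘ q)) n≡0 ⟩
        0                         ∎) z≤n
      k≤∑q (suc m) n≡ = *-cancelˡ-≤ (suc m + suc m) (begin
        (suc m + suc m) * k                 ≡⟨ cong (λ m → (m + m) * k) n≡ ⟨
        (n + n) * k                         ≤⟨ *-monoˡ-≤ k (m≤m+n (n + n) (1 ∸ n)) ⟩
        targetFor n k                       ≤⟨ L≤ ⟩
        cov q                               ≤⟨ cov≤ ⟩
        (n + n) * ∑ n (𝟙 ∘ q)               ≡⟨ cong (λ m → (m + m) * ∑ n (𝟙 ∘ q)) n≡ ⟩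
        (suc m + suc m) * ∑ n (𝟙 ∘ q)       ∎)
      no-defect : defect x q ≡ 0
      no-defect = n≤0⇒n≡0 (+-cancelˡ-≤ (cov q) _ _ (begin
        cov q + defect x q              ≡⟨ coverage-defect x q ⟩
        (n + n) * ∑ n (𝟙 ∘ q)           ≤⟨ *-monoʳ-≤ (n + n) ∑q≤k ⟩
        (n + n) * k                     ≤⟨ *-monoˡ-≤ k (m≤m+n (n + n) (1 ∸ n)) ⟩
        targetFor n k                   ≤⟨ L≤ ⟩
        cov q                           ≡⟨ +-identityʳ (cov q) ⟨
        cov q + 0                       ∎))
      adjacent : ∀ u v → u ≢ v → q u ≡ true → q v ≡ true →
                 𝟙 (uncovering x q u v) ≡ 0 → adjᵛ x u v ≡ true
      adjacent u v u≢v qu qv eq = trans (sym (near-distinct x u≢v)) (forced qu qv eq)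

  correct : ∀ p → 2 ≤ p → ∀ x k → ∃[ x′ ] (⟦ program′ ⟧ (x ∙ num k) ≡ x′ ∙ num k ×
                                          (Clique x k ⇔ MaxCover p x′ k))
  correct p 2≤p x k rewrite ⟦canonical⟧ x (num k) with eqᵛ (graphVal (lenᵛ x) (adjᵛ x)) x in eq
  ... | true  = _ , refl , subst (λ y → Clique x k ⇔ MaxCover p y k) (sym (⟦cover⟧ x k))
    (⇔-sym (MaxCover⇔ p _ k) ⇔-∘ (coverVal-condition {p} {instanceSize x} {lenᵛ x} {incidence x}
      ⇔-∘ (mk⇔ (λ c → (λ e e<n → ≤-trans (frequency≤2 x e e<n) 2≤p) , Equivalence.to (clique⇔cover x k) (proj₂ c))
               (λ c → eqᵛ-sound _ x eq , Equivalence.from (clique⇔cover x k) (proj₂ c))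
      ⇔-∘ Clique⇔ x k)))
  -- Values that encode no graph are sent to `num 1`; the code of a cover instance is always a pair.
  ... | false = _ , refl , mk⇔
    (λ c → contradiction (trans (sym eq) (invalid (proj₁ (Equivalence.to (Clique⇔ x k) c)))) λ ())
    λ { (_ , () , _) }
    where
    invalid : ValidGraph x → eqᵛ (graphVal (lenᵛ x) (adjᵛ x)) x ≡ true
    invalid valid rewrite valid = eqᵛ-refl x

Clique-to-MaxCover : ∀ p → 2 ≤ p → PolyReduction Clique (MaxCover p)
Clique-to-MaxCover p 2≤p = record
  { reduction = CliqueToCover.program′
  ; correct   = CliqueToCover.correct p 2≤p
  }

-- Cliques that select one vertex of every colour

module Coloured {A : Set} (n M : ℕ) (v : ℕ → A) (colour : A → ℕ) (rel : A → A → Bool)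
                (colour<M : ∀ {i} → i < n → colour (v i) < M)
                (rel-self : ∀ {i} → i < n → rel (v i) (v i) ≡ true) where

  edge : A → A → Bool
  edge x y = not (colour x ≡ᵇ colour y) ∧ (rel x y ∧ rel y x)

  edge-symmetric : ∀ x y → edge x y ≡ edge y x
  edge-symmetric x y = cong₂ (λ a b → not a ∧ b) (≡ᵇ-sym (colour x) (colour y)) (∧-comm (rel x y) _)

  edge-irreflexive : ∀ x → edge x x ≡ false
  edge-irreflexive x = cong (λ a → not a ∧ (rel x x ∧ rel x x)) (≡ᵇ-refl (colour x))

  record Selection : Set where
    field
      pos        : ℕ → ℕ
      pos<n      : ∀ {j} → j < M → pos j < n
      colour-pos : ∀ {j} → j < M → colour (v (pos j)) ≡ j
      related    : ∀ {i j} → i < M → j < M → rel (v (pos i)) (v (pos j)) ≡ true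

  Selection→Clique : Selection → Cliqueℕ n (λ i j → edge (v i) (v j)) M
  Selection→Clique sel = q , total , adjacent
    where
    open Selection sel
    open ≡-Reasoning
    q : ℕ → Bool
    q i = anyᵇ M λ j → pos j ≡ᵇ i
    pos-injective : ∀ {i j} → i < M → j < M → pos i ≡ pos j → i ≡ j
    pos-injective i<M j<M eq =
      trans (sym (colour-pos i<M)) (trans (cong (colour ∘ v) eq) (colour-pos j<M))
    total : ∑ n (𝟙 ∘ q) ≡ M
    total = begin
      ∑ n (𝟙 ∘ q)                                 ≡⟨ ∑-cong n (λ i _ → anyᵇ≡∑ M _ (λ a b a<M b<M pa pb →
        pos-injective a<M b<M (trans (≡ᵇ-sound {pos a} pa) (sym (≡ᵇ-sound {pos b} pb))))) ⟩
      ∑ n (λ i → ∑ M (λ j → 𝟙 (pos j ≡ᵇ i)))      ≡⟨ ∑-swap n M _ ⟩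
      ∑ M (λ j → ∑ n (λ i → 𝟙 (pos j ≡ᵇ i)))      ≡⟨ ∑-cong M (λ j j<M → ∑-δ-1 n (pos<n j<M)) ⟩
      ∑ M (λ _ → 1)                               ≡⟨ trans (∑-const M 1) (*-identityʳ M) ⟩
      M                                           ∎
    adjacent : ∀ {i j} → i < n → j < n → q i ≡ true → q j ≡ true → i ≢ j → edge (v i) (v j) ≡ true
    adjacent {i} {j} _ _ qi qj i≢j with anyᵇ-elim M _ qi | anyᵇ-elim M _ qj
    ... | a , a<M , pa | b , b<M , pb
      rewrite sym (≡ᵇ-sound {pos a} pa) | sym (≡ᵇ-sound {pos b} pb)
            | colour-pos a<M | colour-pos b<M =
      ∧-intro (cong not (≡ᵇ-false {a} {b} (i≢j ∘ cong pos)))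
              (∧-intro (related a<M b<M) (related b<M a<M))

  -- Adjacent vertices differ in colour, so each of the M colour classes meets the clique at most
  -- once. The clique has M vertices, so each class meets it exactly once.
  Clique→Selection : Cliqueℕ n (λ i j → edge (v i) (v j)) M → Selection
  Clique→Selection (q , ∑q , clique) = record
    { pos        = λ j → pick j (j <? M)
    ; pos<n      = λ {j} j<M → proj₁ (pick-spec j<M (j <? M))
    ; colour-pos = λ {j} j<M → proj₂ (proj₂ (pick-spec j<M (j <? M)))
    ; related    = λ {i} {j} i<M j<M → related i j (pick-spec i<M (i <? M)) (pick-spec j<M (j <? M))
    }
    where
    open ≡-Reasoning
    split : ∀ x y → edge x y ≡ true → colour x ≢ colour y × rel x y ≡ true
    split x y eq with ∧-elim {not (colour x ≡ᵇ colour y)} eq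
    ... | distinct , rels = (λ same → contradiction
            (trans (sym distinct) (cong not (≡ᵇ-complete {colour x} same))) λ ()) ,
          proj₁ (∧-elim {rel x y} rels)
    has : ℕ → ℕ → Bool
    has j i = q i ∧ (colour (v i) ≡ᵇ j)
    class : ℕ → ℕ
    class j = ∑ n λ i → 𝟙 (has j i)
    class≤1 : ∀ j → class j ≤ 1
    class≤1 j = ∑-𝟙-≤1 n (has j) λ a b a<n b<n ha hb →
      unique a b a<n b<n (∧-elim {q a} ha) (∧-elim {q b} hb)
      where
      unique : ∀ a b → a < n → b < n → q a ≡ true × (colour (v a) ≡ᵇ j) ≡ true →
               q b ≡ true × (colour (v b) ≡ᵇ j) ≡ true → a ≡ b
      unique a b a<n b<n (qa , ca) (qb , cb) with a ≟ b
      ... | yes a≡b = a≡b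
      ... | no  a≢b = contradiction
        (trans (≡ᵇ-sound {colour (v a)} ca) (sym (≡ᵇ-sound {colour (v b)} cb)))
        (proj₁ (split (v a) (v b) (clique a<n b<n qa qb a≢b)))
    𝟙-∧ : ∀ a b → 𝟙 (a ∧ b) ≡ 𝟙 a * 𝟙 b
    𝟙-∧ true  b = sym (+-identityʳ (𝟙 b))
    𝟙-∧ false b = refl
    ∑-class : ∑ M class ≡ M
    ∑-class = begin
      ∑ M class                                                       ≡⟨ ∑-swap M n _ ⟩
      ∑ n (λ i → ∑ M (λ j → 𝟙 (q i ∧ (colour (v i) ≡ᵇ j))))           ≡⟨ ∑-cong n (λ i _ → trans
        (∑-cong M (λ j _ → 𝟙-∧ (q i) _)) (∑-*ˡ M (𝟙 (q i)) _)) ⟩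
      ∑ n (λ i → 𝟙 (q i) * ∑ M (λ j → 𝟙 (colour (v i) ≡ᵇ j)))         ≡⟨ ∑-cong n (λ i i<n → trans
        (cong (𝟙 (q i) *_) (∑-δ-1 M (colour<M i<n))) (*-identityʳ _)) ⟩
      ∑ n (𝟙 ∘ q)                                                     ≡⟨ ∑q ⟩
      M                                                               ∎
    inhabited : ∀ {j} → j < M → 1 ≤ class j
    inhabited {j} j<M = ∑-tight M (λ j _ → class≤1 j)
      (≤-reflexive (trans (∑-const M 1) (trans (*-identityʳ M) (sym ∑-class)))) j j<M
    found : ∀ {j} → j < M → ∃[ i ] (i < n × 1 ≤ 𝟙 (has j i))
    found j<M = ∑-pos n _ (inhabited j<M)
    pick : ∀ j → Dec (j < M) → ℕ
    pick j (yes j<M) = proj₁ (found j<M)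
    pick j (no  _)   = 0
    Picked : ℕ → ℕ → Set
    Picked j i = i < n × q i ≡ true × colour (v i) ≡ j
    pick-spec : ∀ {j} → j < M → (d : Dec (j < M)) → Picked j (pick j d)
    pick-spec {j} _ (yes j<M) with found j<M
    ... | i , i<n , 1≤ with ∧-elim {q i} (1≤𝟙⇒true 1≤)
    ...   | qi , ci = i<n , qi , ≡ᵇ-sound {colour (v i)} ci
    pick-spec j<M (no j≮M) = contradiction j<M j≮M
    related : ∀ i j {a b} → Picked i a → Picked j b → rel (v a) (v b) ≡ true
    related i j {a} {b} (a<n , qa , _) (b<n , qb , _) with a ≟ b
    -- Edges say nothing about a vertex and itself; this case is what `rel-self` is for.
    ... | yes refl = rel-self a<n
    ... | no  a≢b  = proj₂ (split (v a) (v b) (clique a<n b<n qa qb a≢b))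

-- Tuples of slots as numbers in base b

-- Peels the first slot off the code of a tuple: the remainder is that slot, the quotient is the
-- code of the remaining slots.
∑-divMod : ∀ b M (f : ℕ → ℕ → ℕ) .⦃ _ : NonZero b ⦄ →
           ∑ (M * b) (λ j → f (j % b) (j / b)) ≡ ∑ M (λ v → ∑ b (λ d → f d v))
∑-divMod b zero    f = refl
∑-divMod b (suc M) f = trans (∑-split b (M * b) _) (cong₂ _+_
  (∑-cong b λ d d<b → cong₂ f (m<n⇒m%n≡m d<b) (m<n⇒m/n≡0 d<b))
  (trans (∑-cong (M * b) λ j _ → cong₂ f
           (trans (cong (_% b) (+-comm b j)) ([m+n]%n≡m%n j b))
           (trans (+-distrib-/-∣ˡ j ∣-refl) (cong (_+ j / b) (n/n≡1 b))))
         (∑-divMod b M (λ d v → f d (suc v)))))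

-- A tuple of slots together with the choices made for them.
Tuple : ℕ → Set
Tuple = Vec (ℕ × ℕ)

∑⃗ : ∀ {q} → (ℕ × ℕ → ℕ) → Tuple q → ℕ
∑⃗ f []      = 0
∑⃗ f (y ∷ l) = f y + ∑⃗ f l

∑⃗≡0⇒ : ∀ {q f} {l : Tuple q} → ∑⃗ f l ≡ 0 → All (λ y → f y ≡ 0) l
∑⃗≡0⇒ {l = []}            eq = []
∑⃗≡0⇒ {f = f} {l = y ∷ l} eq = m+n≡0⇒m≡0 (f y) eq ∷ ∑⃗≡0⇒ (m+n≡0⇒n≡0 (f y) eq)

⇒∑⃗≡0 : ∀ {q f} {l : Tuple q} → All (λ y → f y ≡ 0) l → ∑⃗ f l ≡ 0
⇒∑⃗≡0 []       = refl
⇒∑⃗≡0 (e ∷ es) = cong₂ _+_ e (⇒∑⃗≡0 es)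

-- Slots are equal exactly when choices are. One direction makes the choice a function of the slot,
-- the other makes this function injective.
agree : ℕ × ℕ → ℕ × ℕ → Bool
agree (d , c) (d′ , c′) = 𝟙 (d ≡ᵇ d′) ≡ᵇ 𝟙 (c ≡ᵇ c′)

agree⇒ : ∀ {d c d′ c′} → agree (d , c) (d′ , c′) ≡ true → d ≡ d′ ⇔ c ≡ c′
agree⇒ {d} {c} {d′} {c′} eq with d ≡ᵇ d′ in d≡ | c ≡ᵇ c′ in c≡
... | true  | true  = mk⇔ (λ _ → ≡ᵇ-sound {c} c≡) (λ _ → ≡ᵇ-sound {d} d≡)
... | false | false = mk⇔
  (λ e → contradiction (trans (sym d≡) (≡ᵇ-complete {d} e)) λ ())
  (λ e → contradiction (trans (sym c≡) (≡ᵇ-complete {c} e)) λ ())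

⇒agree : ∀ {d c d′ c′} → (d ≡ d′ → c ≡ c′) → (c ≡ c′ → d ≡ d′) → agree (d , c) (d′ , c′) ≡ true
⇒agree {d} {c} {d′} {c′} f g = ≡ᵇ-complete {𝟙 (d ≡ᵇ d′)} (cong 𝟙 (Bool-ext {d ≡ᵇ d′} {c ≡ᵇ c′}
  (λ e → ≡ᵇ-complete {c} (f (≡ᵇ-sound {d} e)))
  (λ e → ≡ᵇ-complete {d} (g (≡ᵇ-sound {c} e)))))

conflict : ℕ × ℕ → ℕ × ℕ → ℕ
conflict y y′ = 𝟙 (not (agree y y′))

-- Compatibility is phrased as a vanishing count because sums over lists are what the programs
-- compute.
conflicts : ∀ {q} → Tuple q → Tuple q → ℕ
conflicts l l′ = ∑⃗ (λ y → ∑⃗ (conflict y) l′) l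

compatible : ∀ {q} → Tuple q → Tuple q → Bool
compatible l l′ = conflicts l l′ ≡ᵇ 0

compatible⇒ : ∀ {q} {l l′ : Tuple q} → compatible l l′ ≡ true →
              All (λ y → All (λ y′ → agree y y′ ≡ true) l′) l
compatible⇒ eq = All.map (λ e → All.map 0⇒true (∑⃗≡0⇒ e)) (∑⃗≡0⇒ (≡ᵇ-sound eq))
  where
  0⇒true : ∀ {b} → 𝟙 (not b) ≡ 0 → b ≡ true
  0⇒true {true} _ = refl

⇒compatible : ∀ {q} {l l′ : Tuple q} → All (λ y → All (λ y′ → agree y y′ ≡ true) l′) l →
              compatible l l′ ≡ true
⇒compatible es = ≡ᵇ-complete (⇒∑⃗≡0 (All.map (λ e → ⇒∑⃗≡0 (All.map (cong (𝟙 ∘ not)) e)) es))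

-- Base b, first slot least significant. The choices are left out, so vertices that differ only in
-- choices or sums compete for the same colour.
index : ∀ {q} → ℕ → Tuple q → ℕ
index b []            = 0
index b ((d , _) ∷ l) = d + b * index b l

InRange : ∀ {q} → ℕ → ℕ → Tuple q → Set
InRange b m′ = All (λ (d , c) → d < b × c < m′)

index< : ∀ {q b m′} {l : Tuple q} → InRange b m′ l → index b l < b ^ q
index< []                                       = s≤s z≤n
index< {suc q} {b} {l = (d , c) ∷ l} ((d<b , _) ∷ r) = begin-strict
  d + b * index b l       <⟨ +-monoˡ-< (b * index b l) d<b ⟩
  b + b * index b l       ≡⟨ *-suc b (index b l) ⟨
  b * suc (index b l)     ≤⟨ *-monoʳ-≤ b (index< r) ⟩
  b * b ^ q               ∎
  where open ≤-Reasoning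

tuple : ∀ b .⦃ _ : NonZero b ⦄ → (ℕ → ℕ) → ∀ q → ℕ → Tuple q
tuple b γ zero    j = []
tuple b γ (suc q) j = (j % b , γ (j % b)) ∷ tuple b γ q (j / b)

index-tuple : ∀ b .⦃ _ : NonZero b ⦄ γ q {j} → j < b ^ q → index b (tuple b γ q j) ≡ j
index-tuple b γ zero    {zero}  _       = refl
index-tuple b γ zero    {suc j} (s≤s ())
index-tuple b γ (suc q) {j}     j<      = begin
  j % b + b * index b (tuple b γ q (j / b))
    ≡⟨ cong (λ i → j % b + b * i) (index-tuple b γ q (m<n*o⇒m/o<n (subst (j <_) (*-comm b (b ^ q)) j<))) ⟩
  j % b + b * (j / b)     ≡⟨ cong (j % b +_) (*-comm b (j / b)) ⟩
  j % b + (j / b) * b     ≡⟨ m≡m%n+[m/n]*n j b ⟨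
  j                       ∎
  where open ≡-Reasoning

tuple-index : ∀ {q} b .⦃ _ : NonZero b ⦄ γ (l : Tuple q) → All (λ (d , c) → d < b × c ≡ γ d) l →
              tuple b γ q (index b l) ≡ l
tuple-index b γ []            []                 = refl
tuple-index b γ ((d , c) ∷ l) ((d<b , refl) ∷ r) = cong₂ _∷_
  (cong (λ d → d , γ d) %≡) (trans (cong (tuple b γ _) /≡) (tuple-index b γ l r))
  where
  open ≡-Reasoning
  I : ℕ
  I = index b l
  %≡ : (d + b * I) % b ≡ d
  %≡ = trans (cong (λ z → (d + z) % b) (*-comm b I)) (trans ([m+kn]%n≡m%n d I b) (m<n⇒m%n≡m d<b))
  /≡ : (d + b * I) / b ≡ I
  /≡ = begin
    (d + b * I) / b         ≡⟨ +-distrib-/-∣ʳ d (m∣m*n I) ⟩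
    d / b + (b * I) / b     ≡⟨ cong₂ _+_ (m<n⇒m/n≡0 d<b) (trans (cong (_/ b) (*-comm b I)) (m*n/n≡m I b)) ⟩
    I                       ∎

All-tuple : ∀ {P : ℕ × ℕ → Set} b .⦃ _ : NonZero b ⦄ γ q j →
            (∀ {d} → d < b → P (d , γ d)) → All P (tuple b γ q j)
All-tuple b γ zero    j p = []
All-tuple b γ (suc q) j p = p (m%n<n j b) ∷ All-tuple b γ q (j / b) p

-- Positive and negative part of the contribution of one element to the
-- expansion of (1 − d)(2 − d)⋯(p − d) over tuples of slots, where d counts
-- the slots other than 0 whose choice contains the element: factor number q
-- is expanded as q (slot 0) minus one summand for each other slot.

factor : ℕ → Bool → ℕ → ℕ × ℕ → ℕ × ℕ
factor q x zero    (P , N) = q * P , q * N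
factor q x (suc _) (P , N) = if x then (N , P) else (0 , 0)

weight : ∀ {q} → (ℕ → ℕ → Bool) → ℕ → Tuple q → ℕ × ℕ
weight         s e []            = 1 , 0
weight {suc q} s e ((d , c) ∷ l) = factor (suc q) (s c e) d (weight s e l)

-- Factor number q multiplies by q, or by 0 or -1, hence by at most q in absolute value. The bound
-- limits how many partial sums the vertices must offer.
weight≤ : ∀ {q} s e (l : Tuple q) → proj₁ (weight s e l) ≤ q ! × proj₂ (weight s e l) ≤ q !
weight≤         s e []                 = ≤-refl , z≤n
weight≤ {suc q} s e ((zero , c) ∷ l)   =
  let P≤ , N≤ = weight≤ s e l in *-monoʳ-≤ (suc q) P≤ , *-monoʳ-≤ (suc q) N≤
weight≤ {suc q} s e ((suc d , c) ∷ l)  with s c e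
... | false = z≤n , z≤n
... | true  = let P≤ , N≤ = weight≤ s e l in
  ≤-trans N≤ (m≤m+n (q !) _) , ≤-trans P≤ (m≤m+n (q !) _)

module _ (k : ℕ) (γ : ℕ → ℕ) (s : ℕ → ℕ → Bool) (e : ℕ) where

  private
    b = suc k
    w : ∀ q → ℕ → ℕ × ℕ
    w q j = weight s e (tuple b γ q j)

  degree : ℕ
  degree = ∑ k λ t → 𝟙 (s (γ (suc t)) e)

  posSum negSum : ℕ → ℕ
  posSum q = ∑ (b ^ q) (proj₁ ∘ w q)
  negSum q = ∑ (b ^ q) (proj₂ ∘ w q)

  private
    if-proj₁ : ∀ x (P N : ℕ) → proj₁ (if x then (N , P) else (0 , 0)) ≡ N * 𝟙 x
    if-proj₁ true  P N = sym (*-identityʳ N)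
    if-proj₁ false P N = sym (*-zeroʳ N)
    if-proj₂ : ∀ x (P N : ℕ) → proj₂ (if x then (N , P) else (0 , 0)) ≡ P * 𝟙 x
    if-proj₂ true  P N = sym (*-identityʳ P)
    if-proj₂ false P N = sym (*-zeroʳ P)

    -- Here π selects one of the two parts. Slot 0 contributes the constant q + 1 times that part;
    -- the k other slots contribute, once for each choice containing e, the opposite part, because
    -- their summand carries a minus sign.
    expand : ∀ q (π : ℕ × ℕ → ℕ) (f g : ℕ → ℕ) →
             (∀ v → π (factor (suc q) (s (γ 0) e) 0 (w q v)) ≡ suc q * f v) →
             (∀ v t → π (factor (suc q) (s (γ (suc t)) e) (suc t) (w q v)) ≡ g v * 𝟙 (s (γ (suc t)) e)) →
             ∑ (b ^ suc q) (π ∘ w (suc q)) ≡ suc q * ∑ (b ^ q) f + degree * ∑ (b ^ q) g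
    expand q π f g f≡ g≡ = begin
      ∑ (b * b ^ q) (π ∘ w (suc q))
        ≡⟨ cong (λ M → ∑ M (π ∘ w (suc q))) (*-comm b (b ^ q)) ⟩
      ∑ (b ^ q * b) (π ∘ w (suc q))
        ≡⟨ ∑-divMod b (b ^ q) (λ d v → π (factor (suc q) (s (γ d) e) d (w q v))) ⟩
      ∑ (b ^ q) (λ v → ∑ b (λ d → π (factor (suc q) (s (γ d) e) d (w q v))))
        ≡⟨ ∑-cong (b ^ q) (λ v _ → cong₂ _+_ (f≡ v) (trans (∑-cong k λ t _ → g≡ v t)
             (trans (∑-*ˡ k (g v) _) (*-comm (g v) degree)))) ⟩
      ∑ (b ^ q) (λ v → suc q * f v + degree * g v)
        ≡⟨ trans (∑-+ (b ^ q) _ _) (cong₂ _+_ (∑-*ˡ (b ^ q) (suc q) f) (∑-*ˡ (b ^ q) degree g)) ⟩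
      suc q * ∑ (b ^ q) f + degree * ∑ (b ^ q) g ∎
      where open ≡-Reasoning

  -- Together with the next recurrence: passing from q to q + 1 multiplies the difference of
  -- `posSum` and `negSum` by q + 1 - d. Starting from 1, this builds the product (1 - d)(2 - d)⋯(q
  -- - d).
  posSum-suc : ∀ q → posSum (suc q) ≡ suc q * posSum q + degree * negSum q
  posSum-suc q = expand q proj₁ _ _ (λ v → refl) (λ v t → if-proj₁ (s (γ (suc t)) e) _ _)

  negSum-suc : ∀ q → negSum (suc q) ≡ suc q * negSum q + degree * posSum q
  negSum-suc q = expand q proj₂ _ _ (λ v → refl) (λ v t → if-proj₂ (s (γ (suc t)) e) _ _)

  degree≡0 : degree ≡ 0 → ∀ q → posSum q ≡ q ! × negSum q ≡ 0
  degree≡0 d≡0 zero    = refl , refl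
  degree≡0 d≡0 (suc q) with degree≡0 d≡0 q
  ... | pos≡ , neg≡ = trans (posSum-suc q) (trans
        (cong₂ (λ P d → suc q * P + d * negSum q) pos≡ d≡0) (+-identityʳ _)) ,
    trans (negSum-suc q) (trans
        (cong₂ (λ N d → suc q * N + d * posSum q) neg≡ d≡0)
        (trans (+-identityʳ (suc q * 0)) (*-zeroʳ (suc q))))

  -- Factor number "degree" vanishes.
  degree≤ : 1 ≤ degree → ∀ q → degree ≤ q → posSum q ≡ negSum q
  degree≤ 1≤d zero    d≤0 = contradiction (≤-trans 1≤d d≤0) λ ()
  degree≤ 1≤d (suc q) d≤  with degree ≟ suc q
  ... | yes d≡ = trans (posSum-suc q) (trans (+-comm (suc q * posSum q) _)
        (trans (cong₂ (λ a c → a * negSum q + c * posSum q) d≡ (sym d≡)) (sym (negSum-suc q))))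
  ... | no  d≢ with degree≤ 1≤d q (≤-pred (≤∧≢⇒< d≤ d≢))
  ...   | eq = trans (posSum-suc q) (trans
          (cong₂ (λ P N → suc q * P + degree * N) eq (sym eq)) (sym (negSum-suc q)))

  uncovered-count : ∀ p → degree ≤ p → posSum p ≡ negSum p + p ! * 𝟙 (degree ≡ᵇ 0)
  uncovered-count p d≤p with degree in d≡
  ... | zero  with degree≡0 d≡ p
  ...   | pos≡ , neg≡ = trans pos≡ (sym (trans (cong (_+ p ! * 1) neg≡) (*-identityʳ (p !))))
  uncovered-count p d≤p | suc d = trans
    (degree≤ (subst (1 ≤_) (sym d≡) (s≤s z≤n)) p (subst (_≤ p) (sym d≡) d≤p))
    (sym (trans (cong (negSum p +_) (*-zeroʳ (p !))) (+-identityʳ _)))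

-- Turns a characteristic function into a list of chosen indices without repetition, which can then
-- be placed into slots.
enumerate : ∀ m (q : ℕ → Bool) → Σ[ f ∈ (ℕ → ℕ) ] (let r = ∑ m (𝟙 ∘ q) in
  (∀ {t} → t < r → f t < m × q (f t) ≡ true) ×
  (∀ {t u} → t < r → u < r → f t ≡ f u → t ≡ u) ×
  (∀ {i} → i < m → q i ≡ true → ∃[ t ] (t < r × f t ≡ i)))
enumerate zero    q = id , (λ ()) , (λ ()) , λ ()
enumerate (suc m) q with enumerate m (q ∘ suc) | q 0 in q0
... | f , sound , inj , onto | false = suc ∘ f ,
  (λ t<r → s<s (proj₁ (sound t<r)) , proj₂ (sound t<r)) ,
  (λ t<r u<r eq → inj t<r u<r (suc-injective eq)) ,
  λ { {zero}  _         qi → contradiction (trans (sym q0) qi) λ ()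
    ; {suc i} (s≤s i<m) qi → let t , t<r , eq = onto i<m qi in t , t<r , cong suc eq }
... | f , sound , inj , onto | true = f′ ,
  (λ { {zero}  _         → z<s , q0
     ; {suc t} (s≤s t<r) → s<s (proj₁ (sound t<r)) , proj₂ (sound t<r) }) ,
  (λ { {zero}  {zero}  _ _ _ → refl
     ; {suc t} {suc u} (s≤s t<r) (s≤s u<r) eq → cong suc (inj t<r u<r (suc-injective eq)) }) ,
  λ { {zero}  _         _  → 0 , z<s , refl
    ; {suc i} (s≤s i<m) qi → let t , t<r , eq = onto i<m qi in suc t , s<s t<r , cong suc eq }
  where
  f′ : ℕ → ℕ
  f′ zero    = 0
  f′ (suc t) = suc (f t)

Vertex : ℕ → Set
Vertex p = Tuple p × ℕ × ℕ

if-true⇒ : ∀ {c x} → (if c then x else true) ≡ true → c ≡ true → x ≡ true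
if-true⇒ eq refl = eq

⇒if-true : ∀ {c x} → (c ≡ true → x ≡ true) → (if c then x else true) ≡ true
⇒if-true {true}  f = f refl
⇒if-true {false} f = refl

-- Slots are 0, …, k.  Slot 0 only stands for the constants of the factors;
-- choices i ≥ m stand for empty sets, so that fewer than k sets can be chosen.
module Slots (n m k p L : ℕ) (s : ℕ → ℕ → Bool)
             (frequent : Frequencyℕ p n m s) (empty : ∀ {i} e → m ≤ i → s i e ≡ false) where

  b m′ M : ℕ
  b  = suc k
  m′ = m + b
  M  = b ^ p

  pos neg : Tuple p → ℕ
  pos l = ∑ n λ e → proj₁ (weight s e l)
  neg l = ∑ n λ e → proj₂ (weight s e l)

  colour : Vertex p → ℕ
  colour (l , _) = index b l

  -- In a vertex (l , x , y), x and y stand for the positive and negative sums over all tuples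
  -- before l. The truncated difference in `terminal` vanishes when total positive sum + p! L ≤ p! n
  -- + total negative sum; as the totals differ by p! times the number of uncovered elements, this
  -- says that at least L elements are covered.
  linked initial terminal rel : Vertex p → Vertex p → Bool
  linked (l , x , y) (l′ , x′ , y′) =
    if suc (index b l) ≡ᵇ index b l′
    then ((x + pos l) ≡ᵇ x′) ∧ ((y + neg l) ≡ᵇ y′) else true
  initial (l , x , y) _ = if index b l ≡ᵇ 0 then (x ≡ᵇ 0) ∧ (y ≡ᵇ 0) else true
  terminal (l , x , y) _ =
    if suc (index b l) ≡ᵇ M
    then (((x + pos l) + p ! * L) ∸ (p ! * n + (y + neg l))) ≡ᵇ 0 else true
  rel u u′ = compatible (proj₁ u) (proj₁ u′) ∧ (linked u u′ ∧ (initial u u′ ∧ terminal u u′))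

  record Choice (γ : ℕ → ℕ) : Set where
    field
      bounded   : ∀ {d} → d < b → γ d < m′
      injective : ∀ {d d′} → d < b → d′ < b → γ d ≡ γ d′ → d ≡ d′

  deg : (ℕ → ℕ) → ℕ → ℕ
  deg γ = degree k γ s

  covered : (ℕ → ℕ) → ℕ
  covered γ = ∑ n λ e → 𝟙 (not (deg γ e ≡ᵇ 0))

  module Count {γ} (choice : Choice γ) where
    open Choice choice

    -- Injectivity of the choice counts each set at most once, and dummies contribute nothing, so
    -- the degree is at most the frequency of e.
    deg≤p : ∀ {e} → e < n → deg γ e ≤ p
    deg≤p {e} e<n = begin
      ∑ k (λ t → 𝟙 (s (γ (suc t)) e))               ≤⟨ ∑-injective k m′ (γ ∘ suc) (λ i → 𝟙 (s i e))
        (λ t t<k → bounded (s<s t<k))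
        (λ t u t<k u<k eq → suc-injective (injective (s<s t<k) (s<s u<k) eq)) ⟩
      ∑ m′ (λ i → 𝟙 (s i e))                        ≡⟨ ∑-split m b _ ⟩
      ∑ m (λ i → 𝟙 (s i e)) + ∑ b (λ i → 𝟙 (s (m + i) e))
        ≡⟨ cong (∑ m (λ i → 𝟙 (s i e)) +_) (∑-zero b λ i _ → cong 𝟙 (empty e (m≤m+n m i))) ⟩
      ∑ m (λ i → 𝟙 (s i e)) + 0                     ≡⟨ +-identityʳ _ ⟩
      ∑ m (λ i → 𝟙 (s i e))                         ≤⟨ frequent e e<n ⟩
      p                                             ∎
      where open ≤-Reasoning

    tuples : ℕ → Tuple p
    tuples = tuple b γ p

    pre₊ pre₋ : ℕ → ℕ
    pre₊ j = ∑ j (pos ∘ tuples)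
    pre₋ j = ∑ j (neg ∘ tuples)

    uncovered : ℕ
    uncovered = ∑ n λ e → 𝟙 (deg γ e ≡ᵇ 0)

    partition : covered γ + uncovered ≡ n
    partition = trans (sym (∑-+ n _ _)) (trans (∑-cong n λ e _ → complement (deg γ e ≡ᵇ 0))
      (trans (∑-const n 1) (*-identityʳ n)))
      where
      complement : ∀ c → 𝟙 (not c) + 𝟙 c ≡ 1
      complement true  = refl
      complement false = refl

    -- Exchanging the sums over tuples and elements reduces this to `uncovered-count` for each
    -- element.
    balance : pre₊ M ≡ pre₋ M + p ! * uncovered
    balance = begin
      pre₊ M                                            ≡⟨ ∑-swap M n _ ⟩
      ∑ n (λ e → posSum k γ s e p)                      ≡⟨ ∑-cong n (λ e e<n → uncovered-count k γ s e p (deg≤p e<n)) ⟩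
      ∑ n (λ e → negSum k γ s e p + p ! * 𝟙 (deg γ e ≡ᵇ 0))
        ≡⟨ trans (∑-+ n _ _) (cong (∑ n (λ e → negSum k γ s e p) +_) (∑-*ˡ n (p !) _)) ⟩
      ∑ n (λ e → negSum k γ s e p) + p ! * uncovered    ≡⟨ cong (_+ p ! * uncovered) (∑-swap n M _) ⟩
      pre₋ M + p ! * uncovered                          ∎
      where open ≡-Reasoning

    -- By `balance`, `pre₋ M` and the factor p! cancel, which leaves L + uncovered ≤ n.
    threshold : (pre₊ M + p ! * L ≤ p ! * n + pre₋ M) ⇔ L ≤ covered γ
    threshold = mk⇔ to from
      where
      open ≤-Reasoning
      F = p !
      regroup : ∀ N F U L → (N + F * U) + F * L ≡ F * (L + U) + N
      regroup = solve-∀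
      lhs : pre₊ M + F * L ≡ F * (L + uncovered) + pre₋ M
      lhs = trans (cong (_+ F * L) balance) (regroup (pre₋ M) F uncovered L)
      to : pre₊ M + F * L ≤ F * n + pre₋ M → L ≤ covered γ
      to le = +-cancelʳ-≤ uncovered L (covered γ) (begin
        L + uncovered           ≤⟨ *-cancelˡ-≤ F ⦃ p !≢0 ⦄
                                     (+-cancelʳ-≤ (pre₋ M) _ _ (subst (_≤ F * n + pre₋ M) lhs le)) ⟩
        n                       ≡⟨ partition ⟨
        covered γ + uncovered   ∎)
      from : L ≤ covered γ → pre₊ M + F * L ≤ F * n + pre₋ M
      from L≤ = begin
        pre₊ M + F * L                  ≡⟨ lhs ⟩
        F * (L + uncovered) + pre₋ M    ≤⟨ +-monoˡ-≤ (pre₋ M) (*-monoʳ-≤ F (begin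
          L + uncovered                   ≤⟨ +-monoˡ-≤ uncovered L≤ ⟩
          covered γ + uncovered           ≡⟨ partition ⟩
          n                               ∎)) ⟩
        F * n + pre₋ M                  ∎

    pre≤ : ∀ (f : Tuple p → ℕ) → (∀ l → f l ≤ n * p !) → ∀ {j} → j ≤ M → ∑ j (f ∘ tuples) ≤ M * (n * p !)
    pre≤ f f≤ {j} j≤M = ≤-trans (∑-≤-const j (n * p !) (λ i _ → f≤ (tuples i))) (*-monoˡ-≤ (n * p !) j≤M)

  pos≤ : ∀ l → pos l ≤ n * p !
  pos≤ l = ∑-≤-const n (p !) (λ e _ → proj₁ (weight≤ s e l))

  neg≤ : ∀ l → neg l ≤ n * p !
  neg≤ l = ∑-≤-const n (p !) (λ e _ → proj₂ (weight≤ s e l))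

  -- Slots 1, ..., r receive the r chosen sets; slot 0 and every later slot d receive the dummy m +
  -- d.
  cover⇒choice : Coverℕ n m s k L → ∃[ γ ] (Choice γ × L ≤ covered γ)
  cover⇒choice (q , ∑q≤k , L≤) with enumerate m q
  ... | f , sound , inj , onto = γ , record { bounded = bounded _ ; injective = injective _ _ } ,
    ≤-trans L≤ (∑-mono n λ e _ → 𝟙-mono (covers e))
    where
    r : ℕ
    r = ∑ m (𝟙 ∘ q)
    γ : ℕ → ℕ
    γ zero    = m + 0
    γ (suc t) with t <? r
    ... | yes _ = f t
    ... | no  _ = m + suc t
    γ-suc : ∀ {t} → t < r → γ (suc t) ≡ f t
    γ-suc {t} t<r with t <? r
    ... | yes _   = refl
    ... | no  t≮r = contradiction t<r t≮r
    bounded : ∀ d → d < b → γ d < m′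
    bounded zero    d<b = +-monoʳ-< m d<b
    bounded (suc t) d<b with t <? r
    ... | yes t<r = ≤-trans (proj₁ (sound t<r)) (m≤m+n m b)
    ... | no  _   = +-monoʳ-< m d<b
    apart : ∀ {t x} → t < r → f t ≢ m + x
    apart t<r eq = <⇒≢ (≤-trans (proj₁ (sound t<r)) (m≤m+n m _)) eq
    injective : ∀ d d′ → d < b → d′ < b → γ d ≡ γ d′ → d ≡ d′
    injective zero    zero    _ _ _ = refl
    injective zero    (suc u) _ _ eq with u <? r
    ... | yes u<r = contradiction (sym eq) (apart u<r)
    ... | no  _   = +-cancelˡ-≡ m _ _ eq
    injective (suc t) zero    _ _ eq with t <? r
    ... | yes t<r = contradiction eq (apart t<r)
    ... | no  _   = +-cancelˡ-≡ m _ _ eq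
    injective (suc t) (suc u) _ _ eq with t <? r | u <? r
    ... | yes t<r | yes u<r = cong suc (inj t<r u<r eq)
    ... | yes t<r | no  _   = contradiction eq (apart t<r)
    ... | no  _   | yes u<r = contradiction (sym eq) (apart u<r)
    ... | no  _   | no  _   = +-cancelˡ-≡ m _ _ eq
    𝟙-mono : ∀ {x y} → (x ≡ true → y ≡ true) → 𝟙 x ≤ 𝟙 y
    𝟙-mono {true}  g = ≤-reflexive (cong 𝟙 (sym (g refl)))
    𝟙-mono {false} g = z≤n
    covers : ∀ e → anyᵇ m (λ i → q i ∧ s i e) ≡ true → not (deg γ e ≡ᵇ 0) ≡ true
    covers e eq with anyᵇ-elim m _ eq
    ... | i , i<m , both with ∧-elim {q i} both
    ...   | qi , si with onto i<m qi
    ...     | t , t<r , ft≡i = cong not (≡ᵇ-false {deg γ e} (λ d≡0 → contradiction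
              (trans (sym (∑-≡0 k _ d≡0 (≤-trans t<r ∑q≤k)))
                     (cong 𝟙 (trans (cong (λ c → s c e) (trans (γ-suc t<r) ft≡i)) si))) λ ()))

  -- Slot 0 is skipped, so at most k sets arise. Dummies are empty, so an element of positive degree
  -- lies in a genuine set of the collection.
  choice⇒cover : ∀ {γ} → L ≤ covered γ → Coverℕ n m s k L
  choice⇒cover {γ} L≤ = q , small , ≤-trans L≤ (∑-mono n λ e _ → covers e)
    where
    open ≤-Reasoning
    q : ℕ → Bool
    q i = anyᵇ k λ t → γ (suc t) ≡ᵇ i
    small : ∑ m (𝟙 ∘ q) ≤ k
    small = begin
      ∑ m (𝟙 ∘ q)                                     ≤⟨ ∑-mono m (λ i _ → anyᵇ≤∑ k _) ⟩
      ∑ m (λ i → ∑ k (λ t → 𝟙 (γ (suc t) ≡ᵇ i)))      ≡⟨ ∑-swap m k _ ⟩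
      ∑ k (λ t → ∑ m (λ i → 𝟙 (γ (suc t) ≡ᵇ i)))      ≤⟨ ∑-≤-const k 1 (λ t _ → ∑-δ-≤1 m (γ (suc t))) ⟩
      k * 1                                           ≡⟨ *-identityʳ k ⟩
      k                                               ∎
    in-family : ∀ {i e} → s i e ≡ true → i < m
    in-family {i} {e} si with i <? m
    ... | yes i<m = i<m
    ... | no  i≮m = contradiction (trans (sym si) (empty e (≮⇒≥ i≮m))) λ ()
    covers : ∀ e → 𝟙 (not (deg γ e ≡ᵇ 0)) ≤ 𝟙 (anyᵇ m λ i → q i ∧ s i e)
    covers e with deg γ e in d≡
    ... | zero  = z≤n
    ... | suc d with ∑-pos k _ (subst (1 ≤_) (sym d≡) (s≤s z≤n))
    ...   | t , t<k , 1≤ = ≤-reflexive (sym (cong 𝟙 (anyᵇ-intro m _ (in-family si)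
              (∧-intro (anyᵇ-intro k _ t<k (≡ᵇ-refl (γ (suc t)))) si))))
      where
      si : s (γ (suc t)) e ≡ true
      si = 1≤𝟙⇒true 1≤

  -- The order of the vertex list is immaterial, and repetitions do no harm: equal vertices share a
  -- colour and are not adjacent.
  module Graph-of (N r : ℕ) (v : ℕ → Vertex p) (0<p : 0 < p) (r-large : M * (n * p !) < r)
                  (v-range : ∀ {i} → i < N → InRange b m′ (proj₁ (v i)))
                  (v-self  : ∀ {i} → i < N → rel (v i) (v i) ≡ true)
                  (v-all   : ∀ {l x y} → InRange b m′ l → x < r → y < r →
                             rel (l , x , y) (l , x , y) ≡ true → ∃[ i ] (i < N × v i ≡ (l , x , y))) where

    v-colour : ∀ {i} → i < N → colour (v i) < M
    v-colour i<N = index< (v-range i<N)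

    open Coloured N M v colour rel v-colour v-self public

    choice⇒selection : ∀ {γ} → Choice γ → L ≤ covered γ → Selection
    choice⇒selection {γ} choice L≤ = record
      { pos        = λ j → position j (j <? M)
      ; pos<n      = λ {j} j<M → proj₁ (spec j<M (j <? M))
      ; colour-pos = λ {j} j<M → trans (cong colour (proj₂ (spec j<M (j <? M)))) (index-tuple b γ p j<M)
      ; related    = λ {i} {j} i<M j<M → trans
          (cong₂ rel (proj₂ (spec i<M (i <? M))) (proj₂ (spec j<M (j <? M)))) (related i<M j<M)
      }
      where
      open Choice choice
      open Count choice
      u : ℕ → Vertex p
      u j = tuples j , pre₊ j , pre₋ j
      related : ∀ {i j} → i < M → j < M → rel (u i) (u j) ≡ true
      related {i} {j} i<M j<M = ∧-intro
        (⇒compatible (All-tuple b γ p i λ d<b → All-tuple b γ p j λ d′<b →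
          ⇒agree (cong γ) (injective d<b d′<b)))
        (∧-intro
          (⇒if-true λ i+1≡j → linked-sums (trans (sym (trans (≡ᵇ-sound {suc (index b (tuples i))} i+1≡j) (index-tuple b γ p j<M)))
            (cong suc (index-tuple b γ p i<M))))
        (∧-intro
          (⇒if-true λ i≡0 → first-sums (trans (sym (index-tuple b γ p i<M)) (≡ᵇ-sound {index b (tuples i)} i≡0)))
          (⇒if-true λ i+1≡M → last-sums (trans (cong suc (sym (index-tuple b γ p i<M))) (≡ᵇ-sound {suc (index b (tuples i))} i+1≡M)))))
        where
        linked-sums : j ≡ suc i → ((pre₊ i + pos (tuples i)) ≡ᵇ pre₊ j) ∧ ((pre₋ i + neg (tuples i)) ≡ᵇ pre₋ j) ≡ true
        linked-sums refl = ∧-intro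
          (≡ᵇ-complete {pre₊ i + pos (tuples i)} (sym (∑-last i (pos ∘ tuples))))
          (≡ᵇ-complete {pre₋ i + neg (tuples i)} (sym (∑-last i (neg ∘ tuples))))
        first-sums : i ≡ 0 → (pre₊ i ≡ᵇ 0) ∧ (pre₋ i ≡ᵇ 0) ≡ true
        first-sums refl = refl
        last-sums : suc i ≡ M →
          ((((pre₊ i + pos (tuples i)) + p ! * L) ∸ (p ! * n + (pre₋ i + neg (tuples i)))) ≡ᵇ 0) ≡ true
        last-sums i+1≡M = ≡ᵇ-complete (m≤n⇒m∸n≡0 (subst₂ (λ P N → P + p ! * L ≤ p ! * n + N)
          (trans (cong pre₊ (sym i+1≡M)) (∑-last i (pos ∘ tuples)))
          (trans (cong pre₋ (sym i+1≡M)) (∑-last i (neg ∘ tuples)))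
          (Equivalence.from threshold L≤)))
      vertex : ∀ {j} → j < M → ∃[ i ] (i < N × v i ≡ u j)
      vertex {j} j<M = v-all (All-tuple b γ p j λ d<b → d<b , bounded d<b)
        (≤-<-trans (pre≤ pos pos≤ (<⇒≤ j<M)) r-large)
        (≤-<-trans (pre≤ neg neg≤ (<⇒≤ j<M)) r-large)
        (related j<M j<M)
      position : ∀ j → Dec (j < M) → ℕ
      position j (yes j<M) = proj₁ (vertex j<M)
      position j (no  _)   = 0
      spec : ∀ {j} → j < M → (d : Dec (j < M)) → position j d < N × v (position j d) ≡ u j
      spec _   (yes j<M) = proj₂ (vertex j<M)
      spec j<M (no  j≮M) = contradiction j<M j≮M

    module _ (sel : Selection) where
      open Selection sel renaming (pos to place; related to related′)

      private
        l : ℕ → Tuple p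
        l j = proj₁ (v (place j))
        x y : ℕ → ℕ
        x j = proj₁ (proj₂ (v (place j)))
        y j = proj₂ (proj₂ (v (place j)))

        head : ∀ {q} → Tuple q → ℕ
        head []            = 0
        head ((_ , c) ∷ _) = c

        head-entry : ∀ {q} {P : ℕ × ℕ → Set} {t : Tuple q} {d} → 0 < q → index b t ≡ d → d < b →
                     InRange b m′ t → All P t → P (d , head t)
        head-entry {P = P} {(d₀ , c) ∷ t} {d} _ index≡ d<b ((d₀<b , _) ∷ _) (pd ∷ _) =
          subst (λ z → P (z , c)) d₀≡d pd
          where
          open ≡-Reasoning
          d₀≡d : d₀ ≡ d
          d₀≡d = begin
            d₀                          ≡⟨ m<n⇒m%n≡m d₀<b ⟨
            d₀ % b                      ≡⟨ [m+kn]%n≡m%n d₀ (index b t) b ⟨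
            (d₀ + index b t * b) % b    ≡⟨ cong (λ z → (d₀ + z) % b) (*-comm (index b t) b) ⟩
            (d₀ + b * index b t) % b    ≡⟨ cong (_% b) index≡ ⟩
            d % b                       ≡⟨ m<n⇒m%n≡m d<b ⟩
            d                           ∎

        -- Since p > 0, each d < b is a colour; it belongs to the tuple of slots (d , 0 , ..., 0),
        -- whose first entry reveals the choice made for slot d.
        γ : ℕ → ℕ
        γ d = head (l d)

        b≤M : b ≤ M
        b≤M = subst (_≤ M) (^-identityʳ b) (^-monoʳ-≤ b 0<p)

        range : ∀ {j} → j < M → InRange b m′ (l j)
        range j<M = v-range (pos<n j<M)

        entry : ∀ {P : ℕ × ℕ → Set} {d} → d < b → All P (l d) → P (d , γ d)
        entry {P} d<b = head-entry {P = P} 0<p (colour-pos (≤-trans d<b b≤M)) d<b (range (≤-trans d<b b≤M))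

        agreement : ∀ {i j} → i < M → j < M →
                    All (λ z → All (λ z′ → agree z z′ ≡ true) (l j)) (l i)
        agreement i<M j<M = compatible⇒ (proj₁ (∧-elim (related′ i<M j<M)))

        sums : ∀ {i j} → i < M → j < M → linked (v (place i)) (v (place j)) ≡ true ×
               initial (v (place i)) (v (place j)) ≡ true × terminal (v (place i)) (v (place j)) ≡ true
        sums {i} {j} i<M j<M with ∧-elim {compatible (l i) (l j)} (related′ i<M j<M)
        ... | _ , rest with ∧-elim {linked (v (place i)) (v (place j))} rest
        ...   | linked≡ , rest′ = linked≡ , ∧-elim {initial (v (place i)) (v (place j))} rest′

        choice : Choice γ
        choice = record
          { bounded   = λ d<b → proj₂ (entry {λ (d , c) → d < b × c < m′} d<b (range (≤-trans d<b b≤M)))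
          ; injective = λ {d} {d′} d<b d′<b → Equivalence.from (agree⇒ {d} {γ d} {d′} {γ d′}
              (entry {λ z → agree (d , γ d) z ≡ true} d′<b
                (entry {λ z → All (λ z′ → agree z z′ ≡ true) (l d′)} d<b
                  (agreement (≤-trans d<b b≤M) (≤-trans d′<b b≤M)))))
          }

        open Count choice

        -- An entry (d , c) is compared with (d , γ d), which comes from the vertex of colour d:
        -- same slot, hence same choice.
        follows : ∀ {q} (t : Tuple q) → InRange b m′ t →
                  (∀ {d} → d < b → All (λ z → agree z (d , γ d) ≡ true) t) →
                  All (λ (d , c) → d < b × c ≡ γ d) t
        follows []            []                agrees = []
        follows ((d , c) ∷ t) ((d<b , _) ∷ rs) agrees =
          (d<b , Equivalence.to (agree⇒ {d} {c} {d} {γ d} (All.head (agrees d<b))) refl) ∷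
          follows t rs (λ d<b → All.tail (agrees d<b))

        l≡ : ∀ {j} → j < M → l j ≡ tuples j
        l≡ {j} j<M = trans
          (sym (tuple-index b γ (l j) (follows (l j) (range j<M) λ {d} d<b →
            All.map (λ {z} → entry {λ z′ → agree z z′ ≡ true} d<b) (agreement j<M (≤-trans d<b b≤M)))))
          (cong tuples (colour-pos j<M))

        -- Induction along the colours: `initial` pins the sums at colour 0, and `linked` passes
        -- them from each colour to the next.
        prefix : ∀ j → j < M → x j ≡ pre₊ j × y j ≡ pre₋ j
        prefix zero    0<M with sums 0<M 0<M
        ... | _ , initial≡ , _ with ∧-elim {x 0 ≡ᵇ 0} (if-true⇒ initial≡ (≡ᵇ-complete (colour-pos 0<M)))
        ...   | x≡ , y≡ = ≡ᵇ-sound x≡ , ≡ᵇ-sound y≡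
        prefix (suc j) j+1<M with prefix j (<-trans (n<1+n j) j+1<M) | sums (<-trans (n<1+n j) j+1<M) j+1<M
        ... | xj , yj | linked≡ , _ with ∧-elim {(x j + pos (l j)) ≡ᵇ x (suc j)}
                (if-true⇒ linked≡ (≡ᵇ-complete {suc (index b (l j))}
                  (trans (cong suc (colour-pos j<M)) (sym (colour-pos j+1<M)))))
          where j<M = <-trans (n<1+n j) j+1<M
        ...   | x≡ , y≡ =
          trans (sym (≡ᵇ-sound {x j + pos (l j)} x≡)) (trans (cong₂ _+_ xj (cong pos (l≡ j<M))) (sym (∑-last j (pos ∘ tuples)))) ,
          trans (sym (≡ᵇ-sound {y j + neg (l j)} y≡)) (trans (cong₂ _+_ yj (cong neg (l≡ j<M))) (sym (∑-last j (neg ∘ tuples))))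
          where j<M = <-trans (n<1+n j) j+1<M

        last-sums : ∀ j → suc j ≡ M → pre₊ M + p ! * L ≤ p ! * n + pre₋ M
        last-sums j j+1≡M = subst₂ (λ P N → P + p ! * L ≤ p ! * n + N)
          (trans (cong₂ _+_ (proj₁ (prefix j j<M)) (cong pos (l≡ j<M))) (trans (sym (∑-last j (pos ∘ tuples))) (cong pre₊ j+1≡M)))
          (trans (cong₂ _+_ (proj₂ (prefix j j<M)) (cong neg (l≡ j<M))) (trans (sym (∑-last j (neg ∘ tuples))) (cong pre₋ j+1≡M)))
          (m∸n≡0⇒m≤n (≡ᵇ-sound (if-true⇒ (proj₂ (proj₂ (sums j<M j<M)))
            (≡ᵇ-complete {suc (index b (l j))} (trans (cong suc (colour-pos j<M)) j+1≡M)))))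
          where
          j<M : j < M
          j<M = ≤-reflexive j+1≡M

      selection⇒covered : ∃[ γ ] L ≤ covered γ
      selection⇒covered = γ , Equivalence.to threshold
        (last-sums (pred M) (suc-pred M ⦃ >-nonZero (≤-trans (s≤s z≤n) b≤M) ⦄))

    cover⇔clique : Coverℕ n m s k L ⇔ Cliqueℕ N (λ i j → edge (v i) (v j)) M
    cover⇔clique = mk⇔
      (λ c → let γ , choice , L≤ = cover⇒choice c in Selection→Clique (choice⇒selection choice L≤))
      (λ c → let γ , L≤ = selection⇒covered (Clique→Selection c) in choice⇒cover {γ} L≤)

-- Reductions that are polynomial in the size of the input when the
-- parameter is written in unary

unary : ℕ → Val
unary k = listOf k (λ _ → num 0)

record UnaryReduction (A B : ParamProblem) : Set where
  field
    reduction : PolyTime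
    parameter : Poly
    correct   : ∀ x k → ∃[ x′ ] (⟦ reduction ⟧ (x ∙ unary k ∙ num 0) ≡ x′ ∙ num (eval parameter k) ×
                                 (A x k ⇔ B x′ (eval parameter k)))

-- A unary k has size 2k + 1, and one further node joins it to the rest.
maxSize : Val → ℕ → ℕ
maxSize x k = size (x ∙ num k) + (2 + (k + k))

size-unary : ∀ j → size (unary j) ≡ suc (j + j)
size-unary zero    = refl
size-unary (suc j) = trans (cong (λ s → suc (suc s)) (size-unary j)) (cong (λ s → suc (suc s)) (sym (+-suc j j)))

size-state : ∀ x {k} i j → i + j ≡ k → size (x ∙ unary j ∙ num i) ≤ maxSize x k
size-state x {k} i j i+j≡k = begin
  suc (size x + suc (size (unary j) + size (num i)))  ≡⟨ cong (λ s → suc (size x + suc (s + size (num i)))) (size-unary j) ⟩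
  suc (size x + suc (suc (j + j) + size (num i)))     ≤⟨ s≤s (+-monoʳ-≤ (size x) (s≤s (+-mono-≤
    (s≤s (+-mono-≤ j≤k j≤k)) (size-mono i≤k)))) ⟩
  suc (size x + suc (suc (k + k) + size (num k)))     ≡⟨ lemma (size x) k (size (num k)) ⟩
  maxSize x k                                         ∎
  where
  open ≤-Reasoning
  i≤k : i ≤ k
  i≤k = subst (i ≤_) i+j≡k (m≤m+n i j)
  j≤k : j ≤ k
  j≤k = subst (j ≤_) i+j≡k (m≤n+m j i)
  lemma : ∀ x k s → suc (x + suc (suc (k + k) + s)) ≡ suc (x + s) + (2 + (k + k))
  lemma = solve-∀

module Unary where

  init test step : PolyTime
  init = fstᵖ ,ᵖ natᵖ 0 ,ᵖ sndᵖ
  test = sndᵖ ∘ᵖ sndᵖ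
  step = fstᵖ ,ᵖ (natᵖ 0 ,ᵖ fstᵖ ∘ᵖ sndᵖ) ,ᵖ monusᵖ (sndᵖ ∘ᵖ sndᵖ) (natᵖ 1)

  loop : ∀ x {k} i j → i + j ≡ k →
         Loop test step (maxSize x k) i (x ∙ unary j ∙ num i) (x ∙ unary k ∙ num 0)
  loop x zero    j refl  = halt refl (size-state x zero j refl)
  loop x (suc i) j i+j≡k = next refl (size-state x (suc i) j i+j≡k) (loop x i (suc j) (trans (+-suc i j) i+j≡k))

-- The conversion to unary is a parameter, so that its time bound is not
-- unfolded.
loop⇒≤fpt : ∀ {A B} (R : UnaryReduction A B) (init test step : PolyTime) →
            (∀ x k → Loop test step (maxSize x k) k (⟦ init ⟧ (x ∙ num k)) (x ∙ unary k ∙ num 0)) →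
            A ≤fpt B
loop⇒≤fpt {A} {B} R init test step loop with poly≤monomial
  (κ 2 ⊕ (bound init ⊕ (bound (UnaryReduction.reduction R)
    ⊕ (κ 1 ⊕ X) ⊗ (κ 1 ⊕ (bound test ⊕ bound step)))))
... | a , d , monomial = record
  { program      = program init ⨾ while (program test) (program step) ⨾ program reduction
  ; f            = eval f′
  ; g            = eval parameter
  ; c            = d
  ; f-computable = Computable-poly f′ Computable-id
  ; g-computable = Computable-poly parameter Computable-id
  ; reduces      = reduces′
  }
  where
  open UnaryReduction R
  -- Loop states have size at most S ≤ (3 + 2k) s, where s is the input size. Hence a S^d splits
  -- into a factor depending on k alone and the power s^d.
  f′ : Poly
  f′ = κ a ⊗ (κ 3 ⊕ (X ⊕ X)) ^ₚ d
  reduces′ : ∀ x k → ∃[ x′ ] ∃[ k′ ] ∃[ t ]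
    (program init ⨾ while (program test) (program step) ⨾ program reduction ⊢ x ∙ num k ⇓ x′ ∙ num k′ ∣ t
     × t ≤ eval f′ k * size (x ∙ num k) ^ d
     × k′ ≤ eval parameter k
     × (A x k ⇔ B x′ k′))
  reduces′ x k with runs init (x ∙ num k) | run-while (loop x k)
                  | runs reduction (x ∙ unary k ∙ num 0) | correct x k
  ... | t₁ , r₁ , t₁≤ | t₂ , r₂ , t₂≤ | t₃ , r₃ , t₃≤ | x′ , eq , A⇔B =
    x′ , eval parameter k , _ ,
    run-seq r₁ (run-seq r₂ (subst (λ w → program reduction ⊢ x ∙ unary k ∙ num 0 ⇓ w ∣ t₃) eq r₃)) ,
    time≤ , ≤-refl , A⇔B
    where
    open ≤-Reasoning
    s S : ℕ
    s = size (x ∙ num k)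
    S = maxSize x k
    k≤S : k ≤ S
    k≤S = ≤-trans (m≤n⇒m≤1+n (m≤n⇒m≤1+n (m≤m+n k k))) (m≤n+m _ s)
    1≤S : 1 ≤ S
    1≤S = ≤-trans (1≤size (x ∙ num k)) (m≤m+n s _)
    b₁ b₃ rt : ℕ
    b₁ = eval (bound init) S
    b₃ = eval (bound reduction) S
    rt = roundTime test step S
    regroup : ∀ a b c → suc (a + suc (b + c)) ≡ 2 + (a + (c + b))
    regroup = solve-∀
    S≤ : S ≤ (3 + (k + k)) * s
    S≤ = subst (S ≤_) (expand (size x + size (num k)) k) (m≤m+n S _)
      where
      expand : ∀ u k → suc u + (2 + (k + k)) + (2 + (k + k)) * u ≡ (3 + (k + k)) * suc u
      expand = solve-∀
    time≤ : suc (t₁ + suc (t₂ + t₃)) ≤ eval f′ k * s ^ d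
    time≤ = begin
      suc (t₁ + suc (t₂ + t₃))          ≤⟨ s≤s (+-mono-≤
        (≤-trans t₁≤ (eval-mono (bound init) (m≤m+n s _)))
        (s≤s (+-mono-≤ (≤-trans t₂≤ (*-monoˡ-≤ rt (s≤s k≤S)))
          (≤-trans t₃≤ (eval-mono (bound reduction) (size-state x 0 k refl)))))) ⟩
      suc (b₁ + suc (suc S * rt + b₃))  ≡⟨ regroup b₁ (suc S * rt) b₃ ⟩
      2 + (b₁ + (b₃ + suc S * rt))      ≤⟨ monomial S 1≤S ⟩
      a * S ^ d                         ≤⟨ *-monoʳ-≤ a (^-monoˡ-≤ d S≤) ⟩
      a * ((3 + (k + k)) * s) ^ d       ≡⟨ cong (a *_) (^-distribʳ (3 + (k + k)) s d) ⟩
      a * ((3 + (k + k)) ^ d * s ^ d)   ≡⟨ *-assoc a _ _ ⟨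
      a * (3 + (k + k)) ^ d * s ^ d     ≡⟨ cong (λ z → a * z * s ^ d) (eval-^ₚ (κ 3 ⊕ (X ⊕ X)) d k) ⟨
      eval f′ k * s ^ d                 ∎

unary⇒≤fpt : ∀ {A B} → UnaryReduction A B → A ≤fpt B
unary⇒≤fpt R = loop⇒≤fpt R init test step (λ x k → loop x k 0 (+-identityʳ k))
  where open Unary

-- Membership in lists of values

data _∈ᵛ_ (z : Val) : Val → Set where
  here  : ∀ {v} → z ∈ᵛ (z ∙ v)
  there : ∀ {u v} → z ∈ᵛ v → z ∈ᵛ (u ∙ v)

∈-position : ∀ {z v} → z ∈ᵛ v → ∃[ i ] (i < lenᵛ v × nthᵛ v i ≡ z)
∈-position here       = 0 , z<s , refl
∈-position (there z∈) = let i , i< , eq = ∈-position z∈ in suc i , s<s i< , eq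

∈-append-left : ∀ {z u v} → z ∈ᵛ u → z ∈ᵛ appendᵛ u v
∈-append-left here       = here
∈-append-left (there z∈) = there (∈-append-left z∈)

∈-append-right : ∀ {z} u {v} → z ∈ᵛ v → z ∈ᵛ appendᵛ u v
∈-append-right (num n) z∈ = z∈
∈-append-right (x ∙ u) z∈ = there (∈-append-right u z∈)

∈-concat : ∀ {z} n (f : ℕ → Val) {i} → i < n → z ∈ᵛ f i → z ∈ᵛ concatᵛ (listOf n f)
∈-concat (suc n) f {zero}  _         z∈ = ∈-append-left z∈
∈-concat (suc n) f {suc i} (s≤s i<n) z∈ = ∈-append-right (f 0) (∈-concat n (f ∘ suc) i<n z∈)

∈-listOf : ∀ {z} n (f : ℕ → Val) {i} → i < n → z ≡ f i → z ∈ᵛ listOf n f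
∈-listOf (suc n) f {zero}  _         refl = here
∈-listOf (suc n) f {suc i} (s≤s i<n) eq   = there (∈-listOf n (f ∘ suc) i<n eq)

len-append : ∀ u v → lenᵛ (appendᵛ u v) ≡ lenᵛ u + lenᵛ v
len-append (num n) v = refl
len-append (x ∙ u) v = cong suc (len-append u v)

len-concat : ∀ n f → lenᵛ (concatᵛ (listOf n f)) ≡ ∑ n (lenᵛ ∘ f)
len-concat zero    f = refl
len-concat (suc n) f = trans (len-append (f 0) _) (cong (lenᵛ (f 0) +_) (len-concat n (f ∘ suc)))

-- The program that builds the graph from a cover instance

infixl 9 _↑_
-- Weakening: the expression ignores the first entries of the environment. Every enclosing `forᵖ`
-- adds two, an index and an element.
_↑_ : PolyTime → ℕ → PolyTime
E ↑ zero  = E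
E ↑ suc i = (E ↑ i) ∘ᵖ sndᵖ

powᵖ : PolyTime → ℕ → PolyTime
powᵖ E zero    = natᵖ 1
powᵖ E (suc q) = multᵖ E (powᵖ E q)

replicateᵖ : ℕ → PolyTime
replicateᵖ zero    = natᵖ 0
replicateᵖ (suc j) = natᵖ 0 ,ᵖ replicateᵖ j

-- environment (l , b)
indexᵖ : ℕ → PolyTime
indexᵖ zero    = natᵖ 0
indexᵖ (suc q) = addᵖ (fstᵖ ∘ᵖ fstᵖ ∘ᵖ var 0)
  (multᵖ sndᵖ (indexᵖ q ∘ᵖ (sndᵖ ∘ᵖ var 0 ,ᵖ sndᵖ)))

-- environment ((d , c) , weight , e , F)
factorᵖ : ℕ → PolyTime
factorᵖ q =
  ifᵖ fstᵖ ∘ᵖ var 0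
  then (ifᵖ entryᵖ (sndᵖ ∘ᵖ sndᵖ ∘ᵖ sndᵖ) (sndᵖ ∘ᵖ var 0) (var 2)
        then sndᵖ ∘ᵖ var 1 ,ᵖ fstᵖ ∘ᵖ var 1
        else (natᵖ 0 ,ᵖ natᵖ 0))
  else (multᵖ (natᵖ q) (fstᵖ ∘ᵖ var 1) ,ᵖ multᵖ (natᵖ q) (sndᵖ ∘ᵖ var 1))

-- environment (l , e , F)
weightᵖ : ℕ → PolyTime
weightᵖ zero    = natᵖ 1 ,ᵖ natᵖ 0
weightᵖ (suc q) = factorᵖ (suc q) ∘ᵖ
  (fstᵖ ∘ᵖ var 0 ,ᵖ weightᵖ q ∘ᵖ (sndᵖ ∘ᵖ var 0 ,ᵖ sndᵖ) ,ᵖ sndᵖ)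

-- environment (l , F , N)
totalᵖ : ℕ → PolyTime
totalᵖ p = sumᵖ (forᵖ (sndᵖ ∘ᵖ sndᵖ) (fstᵖ ∘ᵖ w)) ,ᵖ sumᵖ (forᵖ (sndᵖ ∘ᵖ sndᵖ) (sndᵖ ∘ᵖ w))
  where
  w : PolyTime
  w = weightᵖ p ∘ᵖ (var 2 ,ᵖ var 0 ,ᵖ var 3)

-- environment (l , l′)
compatibleᵖ : PolyTime
compatibleᵖ = notᵖ (sumᵖ (forᵖ fstᵖ (sumᵖ (forᵖ (sndᵖ ↑ 2) (notᵖ
  (eqᵖ (eqᵖ (fstᵖ ∘ᵖ var 3) (fstᵖ ∘ᵖ var 1)) (eqᵖ (sndᵖ ∘ᵖ var 3) (sndᵖ ∘ᵖ var 1))))))))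

-- The global environment is Γ = (F , N , L , b , D): the family, the ground
-- set, the target, and the number and list of slots.
-- environment (u , u′ , Γ)
relᵖ : ℕ → PolyTime
relᵖ p = andᵖ (compatibleᵖ ∘ᵖ (l ,ᵖ l′)) (andᵖ nextᵖ (andᵖ startᵖ finalᵖ))
  where
  l l′ x y x′ y′ i i′ total x₊ y₊ nextᵖ startᵖ finalᵖ : PolyTime
  l  = fstᵖ ∘ᵖ var 0
  l′ = fstᵖ ∘ᵖ var 1
  x  = fstᵖ ∘ᵖ sndᵖ ∘ᵖ var 0
  x′ = fstᵖ ∘ᵖ sndᵖ ∘ᵖ var 1
  y  = sndᵖ ∘ᵖ sndᵖ ∘ᵖ var 0
  y′ = sndᵖ ∘ᵖ sndᵖ ∘ᵖ var 1
  i  = indexᵖ p ∘ᵖ (l ,ᵖ var 5)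
  i′ = indexᵖ p ∘ᵖ (l′ ,ᵖ var 5)
  total = totalᵖ p ∘ᵖ (l ,ᵖ var 2 ,ᵖ var 3)
  x₊ = addᵖ x (fstᵖ ∘ᵖ total)
  y₊ = addᵖ y (sndᵖ ∘ᵖ total)
  nextᵖ  = ifᵖ eqᵖ (addᵖ (natᵖ 1) i) i′ then andᵖ (eqᵖ x₊ x′) (eqᵖ y₊ y′) else natᵖ 1
  startᵖ = ifᵖ eqᵖ i (natᵖ 0) then andᵖ (eqᵖ x (natᵖ 0)) (eqᵖ y (natᵖ 0)) else natᵖ 1
  finalᵖ = ifᵖ eqᵖ (addᵖ (natᵖ 1) i) (powᵖ (var 5) p)
           then notᵖ (monusᵖ (addᵖ x₊ (multᵖ (natᵖ (p !)) (var 4)))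
                             (addᵖ (multᵖ (natᵖ (p !)) (lenᵖ (var 3))) y₊))
           else natᵖ 1

-- environment Γ
tuplesᵖ : ℕ → PolyTime
tuplesᵖ zero    = natᵖ 0 ,ᵖ natᵖ 0
tuplesᵖ (suc q) = concatᵖ (forᵖ (var 4) (concatᵖ (forᵖ (choices ↑ 2)
  (forᵖ (tuplesᵖ q ↑ 4) ((var 4 ,ᵖ var 2) ,ᵖ var 1)))))
  where
  choices : PolyTime
  choices = concatᵖ (var 0 ,ᵖ var 4 ,ᵖ natᵖ 0)

-- Loops run over lists, so the range of partial sums is a list whose length only has to exceed M n
-- p!. It has one entry for each tuple with choices, element and unit of p!, and one more.
rangeᵖ verticesᵖ edgesᵖ : ℕ → PolyTime
rangeᵖ p = natᵖ 0 ,ᵖ concatᵖ (forᵖ (tuplesᵖ p) (concatᵖ (forᵖ (var 3) (replicateᵖ (p !)))))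

verticesᵖ p = concatᵖ (forᵖ (tuplesᵖ p) (concatᵖ (forᵖ (rangeᵖ p ↑ 2) (concatᵖ (forᵖ (rangeᵖ p ↑ 4)
  -- A vertex unrelated to itself, for instance one with wrong sums at the first or last colour, can
  -- be in no selection; dropping it provides `rel-self`.
  (ifᵖ relᵖ p ∘ᵖ (u ,ᵖ u ,ᵖ idᵖ ↑ 6) then (u ,ᵖ natᵖ 0) else natᵖ 0))))))
  where
  u : PolyTime
  u = var 5 ,ᵖ var 2 ,ᵖ var 0

edgesᵖ p = forᵖ (verticesᵖ p) (forᵖ (verticesᵖ p ↑ 2) (andᵖ
  (notᵖ (eqᵖ (indexᵖ p ∘ᵖ (fstᵖ ∘ᵖ var 3 ,ᵖ var 7)) (indexᵖ p ∘ᵖ (fstᵖ ∘ᵖ var 1 ,ᵖ var 7))))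
  (andᵖ (relᵖ p ∘ᵖ (var 3 ,ᵖ var 1 ,ᵖ idᵖ ↑ 4)) (relᵖ p ∘ᵖ (var 1 ,ᵖ var 3 ,ᵖ idᵖ ↑ 4)))))

-- Codes of tuples and vertices, and what the graph program computes

pairVal : ℕ × ℕ → Val
pairVal (a , b) = num a ∙ num b

tupleVal : ∀ {q} → Tuple q → Val
tupleVal []      = num 0
tupleVal (y ∷ l) = pairVal y ∙ tupleVal l

vertexVal : ∀ {p} → Vertex p → Val
vertexVal (l , y) = tupleVal l ∙ pairVal y

toPair : Val → ℕ × ℕ
toPair v = toℕᵛ (apply left v) , toℕᵛ (apply right v)

toTuple : ∀ q → Val → Tuple q
toTuple zero    v = []
toTuple (suc q) v = toPair (apply left v) ∷ toTuple q (apply right v)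

toVertex : ∀ p → Val → Vertex p
toVertex p v = toTuple p (apply left v) , toPair (apply right v)

toTuple-tupleVal : ∀ {q} (l : Tuple q) → toTuple q (tupleVal l) ≡ l
toTuple-tupleVal []      = refl
toTuple-tupleVal (y ∷ l) = cong (y ∷_) (toTuple-tupleVal l)

toVertex-vertexVal : ∀ {p} (u : Vertex p) → toVertex p (vertexVal u) ≡ u
toVertex-vertexVal (l , y) = cong (_, y) (toTuple-tupleVal l)

zero-bit : ∀ {u n} → u ≡ num n → (if truth u then num 0 else num 1) ≡ bitVal (n ≡ᵇ 0)
zero-bit {n = zero}  refl = refl
zero-bit {n = suc n} refl = refl

if-bit-true : ∀ {c a u v} → u ≡ bitVal c → v ≡ bitVal a →
              (if truth u then v else num 1) ≡ bitVal (if c then a else true)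
if-bit-true {true}  refl eq = eq
if-bit-true {false} refl eq = refl

apply₂ : ∀ {o u v x y w} → u ≡ x → v ≡ y → apply o (x ∙ y) ≡ w → apply o (u ∙ v) ≡ w
apply₂ refl refl eq = eq

⟦powᵖ⟧ : ∀ E q ρ {b} → ⟦ E ⟧ ρ ≡ num b → ⟦ powᵖ E q ⟧ ρ ≡ num (b ^ q)
⟦powᵖ⟧ E zero    ρ eq = refl
⟦powᵖ⟧ E (suc q) ρ eq = apply₂ {mult} eq (⟦powᵖ⟧ E q ρ eq) refl

len-replicateᵖ : ∀ j ρ → lenᵛ (⟦ replicateᵖ j ⟧ ρ) ≡ j
len-replicateᵖ zero    ρ = refl
len-replicateᵖ (suc j) ρ = cong suc (len-replicateᵖ j ρ)

⟦indexᵖ⟧ : ∀ {q} (l : Tuple q) b → ⟦ indexᵖ q ⟧ (tupleVal l ∙ num b) ≡ num (index b l)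
⟦indexᵖ⟧ []            b = refl
⟦indexᵖ⟧ ((d , _) ∷ l) b = apply₂ {add} {num d} refl (apply₂ {mult} {num b} refl (⟦indexᵖ⟧ l b) refl) refl

⟦factorᵖ⟧ : ∀ q F d c w e → ⟦ factorᵖ q ⟧ ((num d ∙ num c) ∙ pairVal w ∙ num e ∙ F) ≡
            pairVal (factor q (entryᵛ F c e) d w)
⟦factorᵖ⟧ q F zero    c w e = refl
⟦factorᵖ⟧ q F (suc d) c w e
  rewrite ⟦entryᵖ⟧ (sndᵖ ∘ᵖ sndᵖ ∘ᵖ sndᵖ) (sndᵖ ∘ᵖ var 0) (var 2)
            ((num (suc d) ∙ num c) ∙ pairVal w ∙ num e ∙ F) {c} {e} refl refl
  with entryᵛ F c e
... | true  = refl
... | false = refl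

⟦weightᵖ⟧ : ∀ {q} (l : Tuple q) e F →
            ⟦ weightᵖ q ⟧ (tupleVal l ∙ num e ∙ F) ≡ pairVal (weight (entryᵛ F) e l)
⟦weightᵖ⟧ []            e F = refl
⟦weightᵖ⟧ {suc q} ((d , c) ∷ l) e F = trans
  (cong (λ w → ⟦ factorᵖ (suc q) ⟧ ((num d ∙ num c) ∙ w ∙ num e ∙ F)) (⟦weightᵖ⟧ l e F))
  (⟦factorᵖ⟧ (suc q) F d c (weight (entryᵛ F) e l) e)

⟦totalᵖ⟧ : ∀ {p} (l : Tuple p) F N → ⟦ totalᵖ p ⟧ (tupleVal l ∙ F ∙ N) ≡ pairVal
           ( ∑ (lenᵛ N) (λ e → proj₁ (weight (entryᵛ F) e l))
           , ∑ (lenᵛ N) (λ e → proj₂ (weight (entryᵛ F) e l)))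
⟦totalᵖ⟧ l F N = cong₂ (λ a b → num a ∙ num b)
  (sum-map N λ e _ → cong (apply left) (⟦weightᵖ⟧ l e F))
  (sum-map N λ e _ → cong (apply right) (⟦weightᵖ⟧ l e F))

sum-tuple : ∀ {q f g} (l : Tuple q) i → (∀ j y → f j (pairVal y) ≡ num (g y)) →
            sumᵛ (mapFrom f i (tupleVal l)) ≡ ∑⃗ g l
sum-tuple []      i f≗g = refl
sum-tuple (y ∷ l) i f≗g = cong₂ _+_ (cong toℕᵛ (f≗g (num i) y)) (sum-tuple l (suc i) f≗g)

⟦compatibleᵖ⟧ : ∀ {q} (l l′ : Tuple q) →
                ⟦ compatibleᵖ ⟧ (tupleVal l ∙ tupleVal l′) ≡ bitVal (compatible l l′)
⟦compatibleᵖ⟧ l l′ = zero-bit (cong num (sum-tuple l 0 λ i y →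
  cong num (sum-tuple l′ 0 λ j y′ → not-bit refl)))

module Membership (p : ℕ) (0<p : 0 < p) (F N : Val) (L k : ℕ)
                  (frequent : Frequencyℕ p (lenᵛ N) (lenᵛ F) (entryᵛ F)) where

  n m : ℕ
  n = lenᵛ N
  m = lenᵛ F

  empty : ∀ {i} e → m ≤ i → entryᵛ F i e ≡ false
  empty e m≤i = cong (λ r → truth (nthᵛ r e)) (nth-overflow F m≤i)

  open Slots n m k p L (entryᵛ F) frequent empty

  D Γ : Val
  D = num 0 ∙ unary k
  Γ = F ∙ N ∙ num L ∙ num b ∙ D ∙ num 0

  ⟦relᵖ⟧ : ∀ u u′ → ⟦ relᵖ p ⟧ (vertexVal u ∙ vertexVal u′ ∙ Γ) ≡ bitVal (rel u u′)
  ⟦relᵖ⟧ (l , x , y) (l′ , x′ , y′) = and-bit (⟦compatibleᵖ⟧ l l′) (and-bit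
    (if-bit-true (eq-bit i₊≡ (⟦indexᵖ⟧ l′ b))
      (and-bit {(x + pos l) ≡ᵇ x′} (eq-bit x₊≡ refl) (eq-bit {y + neg l} y₊≡ refl)))
    (and-bit
      (if-bit-true (eq-bit (⟦indexᵖ⟧ l b) refl) (and-bit {x ≡ᵇ 0} refl refl))
      (if-bit-true (eq-bit i₊≡ (⟦powᵖ⟧ (var 5) p (vertexVal (l , x , y) ∙ vertexVal (l′ , x′ , y′) ∙ Γ) refl))
        (zero-bit (apply₂ {monus} (apply₂ {add} {y = num (p ! * L)} x₊≡ refl refl)
          (apply₂ {add} (apply₂ {mult} {num (p !)} refl (cong num (count-map N)) refl) y₊≡ refl) refl)))))
    where
    i₊≡ = apply₂ {add} {num 1} refl (⟦indexᵖ⟧ l b) refl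
    x₊≡ = apply₂ {add} {num x} refl (cong (apply left) (⟦totalᵖ⟧ l F N)) refl
    y₊≡ = apply₂ {add} {num y} refl (cong (apply right) (⟦totalᵖ⟧ l F N)) refl

  tuplesVal : ℕ → Val
  tuplesVal q = ⟦ tuplesᵖ q ⟧ Γ

  len-D : lenᵛ D ≡ b
  len-D = cong suc (len-listOf k (λ _ → num 0))

  len-choices : lenᵛ (appendᵛ F (appendᵛ D (num 0))) ≡ m′
  len-choices = trans (len-append F _) (cong (m +_)
    (trans (len-append D (num 0)) (trans (+-identityʳ _) len-D)))

  extension : ℕ → ℕ → ℕ → ℕ → Val
  extension q d c i = (num d ∙ num c) ∙ nthᵛ (tuplesVal q) i

  extensions : ℕ → ℕ → ℕ → Val
  extensions q d c = listOf (lenᵛ (tuplesVal q)) (extension q d c)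

  slotExtensions : ℕ → ℕ → Val
  slotExtensions q d = concatᵛ (listOf m′ (extensions q d))

  tuplesVal-suc : ∀ q → tuplesVal (suc q) ≡ concatᵛ (listOf b (slotExtensions q))
  tuplesVal-suc q = subst₂
    (λ B M → tuplesVal (suc q) ≡ concatᵛ (listOf B λ d → concatᵛ (listOf M (extensions q d))))
    len-D len-choices
    (⟦concat-for⟧ D λ d _ → ⟦concat-for⟧ (appendᵛ F (appendᵛ D (num 0))) λ c _ →
      map≡listOf (tuplesVal q) λ i _ → refl)

  IsTuple : ℕ → Val → Set
  IsTuple q z = Σ[ l ∈ Tuple q ] (InRange b m′ l × z ≡ tupleVal l)

  tuples-sound : ∀ q → Allᵛ (IsTuple q) (tuplesVal q)
  tuples-sound zero    = ([] , [] , refl) ◂ end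
  tuples-sound (suc q) rewrite tuplesVal-suc q =
    Allᵛ-concat b λ d d<b → Allᵛ-concat m′ λ c c<m′ → Allᵛ-listOf (lenᵛ (tuplesVal q)) λ i i< →
      let l , r , eq = Allᵛ-nth (tuples-sound q) i<
      in (d , c) ∷ l , (d<b , c<m′) ∷ r , cong ((num d ∙ num c) ∙_) eq

  tuples-complete : ∀ {q} {l : Tuple q} → InRange b m′ l → tupleVal l ∈ᵛ tuplesVal q
  tuples-complete []                                            = here
  tuples-complete {suc q} {(d , c) ∷ l} ((d<b , c<m′) ∷ r) rewrite tuplesVal-suc q =
    let i , i< , eq = ∈-position (tuples-complete r)
    in ∈-concat b (slotExtensions q) d<b (∈-concat m′ (extensions q d) c<m′
         (∈-listOf (lenᵛ (tuplesVal q)) (extension q d c) i< (cong ((num d ∙ num c) ∙_) (sym eq))))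

  -- Each tuple of slots appears with at least one choice per slot, because m′ ≥ b > 0.
  b^q≤tuples : ∀ q → b ^ q ≤ lenᵛ (tuplesVal q)
  b^q≤tuples zero    = ≤-refl
  b^q≤tuples (suc q) rewrite tuplesVal-suc q = begin
    b * b ^ q                                   ≤⟨ *-monoʳ-≤ b (b^q≤tuples q) ⟩
    b * t                                       ≡⟨ ∑-const b t ⟨
    ∑ b (λ _ → t)                               ≤⟨ ∑-mono b (λ d d<b → begin
      t                                           ≡⟨ len-listOf t (extension q d 0) ⟨
      lenᵛ (extensions q d 0)                     ≤⟨ ∑-member m′ (lenᵛ ∘ extensions q d) 0<m′ ⟩
      ∑ m′ (lenᵛ ∘ extensions q d)                ≡⟨ len-concat m′ (extensions q d) ⟨
      lenᵛ (slotExtensions q d)                   ∎) ⟩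
    ∑ b (lenᵛ ∘ slotExtensions q)               ≡⟨ len-concat b (slotExtensions q) ⟨
    lenᵛ (concatᵛ (listOf b (slotExtensions q))) ∎
    where
    open ≤-Reasoning
    t : ℕ
    t = lenᵛ (tuplesVal q)
    0<m′ : 0 < m′
    0<m′ = ≤-trans (s≤s z≤n) (m≤n+m b m)

  r : ℕ
  r = lenᵛ (⟦ rangeᵖ p ⟧ Γ)

  r-large : M * (n * p !) < r
  r-large = s≤s (begin
    M * (n * p !)                                 ≤⟨ *-monoˡ-≤ (n * p !) (b^q≤tuples p) ⟩
    lenᵛ (tuplesVal p) * (n * p !)                ≡⟨ ∑-const (lenᵛ (tuplesVal p)) (n * p !) ⟨
    ∑ (lenᵛ (tuplesVal p)) (λ _ → n * p !)        ≡⟨ ∑-cong (lenᵛ (tuplesVal p)) (λ i _ → inner i) ⟨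
    ∑ (lenᵛ (tuplesVal p)) (λ i → lenᵛ (block i)) ≡⟨ len-concat (lenᵛ (tuplesVal p)) block ⟨
    lenᵛ (concatᵛ (listOf (lenᵛ (tuplesVal p)) block))
      ≡⟨ cong lenᵛ (⟦concat-for⟧ (tuplesVal p) λ i _ → refl) ⟨
    lenᵛ (apply right (⟦ rangeᵖ p ⟧ Γ))           ∎)
    where
    open ≤-Reasoning
    ρ : ℕ → ℕ → Val
    ρ i e = num e ∙ nthᵛ N e ∙ num i ∙ nthᵛ (tuplesVal p) i ∙ Γ
    block : ℕ → Val
    block i = concatᵛ (mapFrom (λ e z → ⟦ replicateᵖ (p !) ⟧ (e ∙ z ∙ num i ∙ nthᵛ (tuplesVal p) i ∙ Γ)) 0 N)
    inner : ∀ i → lenᵛ (block i) ≡ n * p !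
    inner i = begin-equality
      lenᵛ (block i)                                        ≡⟨ cong lenᵛ (⟦concat-for⟧ N λ e _ → refl) ⟩
      lenᵛ (concatᵛ (listOf n λ e → ⟦ replicateᵖ (p !) ⟧ (ρ i e)))  ≡⟨ len-concat n _ ⟩
      ∑ n (λ e → lenᵛ (⟦ replicateᵖ (p !) ⟧ (ρ i e)))       ≡⟨ ∑-cong n (λ e _ → len-replicateᵖ (p !) (ρ i e)) ⟩
      ∑ n (λ e → p !)                                       ≡⟨ ∑-const n (p !) ⟩
      n * p !                                               ∎

  vertexList : Val
  vertexList = ⟦ verticesᵖ p ⟧ Γ

  candidate : ℕ → ℕ → ℕ → Val
  candidate i x y = nthᵛ (tuplesVal p) i ∙ num x ∙ num y

  filtered : Val → Val
  filtered u = if truth (⟦ relᵖ p ⟧ (u ∙ u ∙ Γ)) then u ∙ num 0 else num 0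

  row : ℕ → ℕ → Val
  row i x = concatᵛ (listOf r λ y → filtered (candidate i x y))

  plane : ℕ → Val
  plane i = concatᵛ (listOf r (row i))

  vertexList≡ : vertexList ≡ concatᵛ (listOf (lenᵛ (tuplesVal p)) plane)
  vertexList≡ = ⟦concat-for⟧ (tuplesVal p) λ i _ → ⟦concat-for⟧ (⟦ rangeᵖ p ⟧ Γ) λ x _ →
        ⟦concat-for⟧ (⟦ rangeᵖ p ⟧ Γ) λ y _ → refl

  filtered≡ : ∀ u → filtered (vertexVal u) ≡ (if rel u u then vertexVal u ∙ num 0 else num 0)
  filtered≡ u = if-bit (rel u u) (⟦relᵖ⟧ u u)

  IsVertex : Val → Set
  IsVertex z = Σ[ u ∈ Vertex p ] (InRange b m′ (proj₁ u) × rel u u ≡ true × z ≡ vertexVal u)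

  vertices-sound : Allᵛ IsVertex vertexList
  vertices-sound = subst (Allᵛ IsVertex) (sym vertexList≡)
    (Allᵛ-concat (lenᵛ (tuplesVal p)) λ i i< → Allᵛ-concat r λ x _ → Allᵛ-concat r λ y _ →
      let l , in-range , eq = Allᵛ-nth (tuples-sound p) i<
      in subst (λ z → Allᵛ IsVertex (filtered (z ∙ num x ∙ num y))) (sym eq) (keep (l , x , y) in-range))
    where
    keep : ∀ u → InRange b m′ (proj₁ u) → Allᵛ IsVertex (filtered (vertexVal u))
    keep u in-range rewrite filtered≡ u with rel u u in self
    ... | true  = (u , in-range , self , refl) ◂ end
    ... | false = end

  vertices-complete : ∀ {l x y} → InRange b m′ l → x < r → y < r →
                      rel (l , x , y) (l , x , y) ≡ true → vertexVal (l , x , y) ∈ᵛ vertexList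
  vertices-complete {l} {x} {y} in-range x<r y<r self = subst (vertexVal (l , x , y) ∈ᵛ_) (sym vertexList≡)
    (let i , i< , eq = ∈-position (tuples-complete in-range)
     in ∈-concat (lenᵛ (tuplesVal p)) plane i< (∈-concat r (row i) x<r (∈-concat r (λ y → filtered (candidate i x y)) y<r
          (subst (λ z → vertexVal (l , x , y) ∈ᵛ filtered (z ∙ num x ∙ num y)) (sym eq)
            (subst (vertexVal (l , x , y) ∈ᵛ_) (sym (trans (filtered≡ (l , x , y))
              (cong (if_then vertexVal (l , x , y) ∙ num 0 else num 0) self))) here)))))

  v : ℕ → Vertex p
  v i = toVertex p (nthᵛ vertexList i)

  v-spec : ∀ {i} → i < lenᵛ vertexList →
           InRange b m′ (proj₁ (v i)) × rel (v i) (v i) ≡ true × nthᵛ vertexList i ≡ vertexVal (v i)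
  v-spec {i} i< =
    let u , in-range , self , eq = Allᵛ-nth vertices-sound i<
        u≡v = trans (sym (toVertex-vertexVal u)) (cong (toVertex p) (sym eq))
    in subst (λ w → InRange b m′ (proj₁ w) × rel w w ≡ true × nthᵛ vertexList i ≡ vertexVal w)
         u≡v (in-range , self , eq)

  v-range : ∀ {i} → i < lenᵛ vertexList → InRange b m′ (proj₁ (v i))
  v-range i< = proj₁ (v-spec i<)

  v-self : ∀ {i} → i < lenᵛ vertexList → rel (v i) (v i) ≡ true
  v-self i< = proj₁ (proj₂ (v-spec i<))

  v-all : ∀ {l x y} → InRange b m′ l → x < r → y < r → rel (l , x , y) (l , x , y) ≡ true →
          ∃[ i ] (i < lenᵛ vertexList × v i ≡ (l , x , y))
  v-all in-range x<r y<r self =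
    let i , i< , eq = ∈-position (vertices-complete in-range x<r y<r self)
    in i , i< , trans (cong (toVertex p) eq) (toVertex-vertexVal _)

  open Graph-of (lenᵛ vertexList) r v 0<p r-large v-range v-self v-all

  ⟦edgesᵖ⟧ : ⟦ edgesᵖ p ⟧ Γ ≡ graphVal (lenᵛ vertexList) (λ i j → edge (v i) (v j))
  ⟦edgesᵖ⟧ = map≡listOf vertexList λ i i< → map≡listOf vertexList λ j j< →
    trans (cong₂ (λ u u′ → ⟦ bodyᵖ ⟧ (num j ∙ u′ ∙ num i ∙ u ∙ Γ))
                 (proj₂ (proj₂ (v-spec i<))) (proj₂ (proj₂ (v-spec j<))))
      (and-bit (not-bit (eq-bit (⟦indexᵖ⟧ (proj₁ (v i)) b) (⟦indexᵖ⟧ (proj₁ (v j)) b)))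
        (and-bit (⟦relᵖ⟧ (v i) (v j)) (⟦relᵖ⟧ (v j) (v i))))
    where
    bodyᵖ : PolyTime
    bodyᵖ = andᵖ
      (notᵖ (eqᵖ (indexᵖ p ∘ᵖ (fstᵖ ∘ᵖ var 3 ,ᵖ var 7)) (indexᵖ p ∘ᵖ (fstᵖ ∘ᵖ var 1 ,ᵖ var 7))))
      (andᵖ (relᵖ p ∘ᵖ (var 3 ,ᵖ var 1 ,ᵖ idᵖ ↑ 4)) (relᵖ p ∘ᵖ (var 1 ,ᵖ var 3 ,ᵖ idᵖ ↑ 4)))

  cover⇔Clique : Coverℕ n m (entryᵛ F) k L ⇔ Clique (⟦ edgesᵖ p ⟧ Γ) M
  cover⇔Clique = subst (λ y → Coverℕ n m (entryᵛ F) k L ⇔ Clique y M) (sym ⟦edgesᵖ⟧)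
    (⇔-sym (Clique⇔ _ M) ⇔-∘ (graphVal-condition (lenᵛ vertexList)
      (λ {i} {j} _ _ → edge-symmetric (v i) (v j)) (λ {i} _ → edge-irreflexive (v i)) ⇔-∘ cover⇔clique))

-- Validity test and assembly of the reduction from MaxCover to Clique

module CoverToClique (p : ℕ) (0<p : 0 < p) where

  -- The environment is (x , U) with the parameter in unary.

  groundᵖ familyᵖ targetᵖ paramᵖ canonicalᵖ frequentᵖ validᵖ globalᵖ reductionᵖ : PolyTime
  groundᵖ = fstᵖ ∘ᵖ var 0
  familyᵖ = fstᵖ ∘ᵖ sndᵖ ∘ᵖ var 0
  targetᵖ = toNumᵖ ∘ᵖ sndᵖ ∘ᵖ sndᵖ ∘ᵖ var 0
  paramᵖ  = addᵖ (natᵖ 1) (lenᵖ (var 1))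

  canonicalᵖ = forᵖ groundᵖ (natᵖ 0)
            ,ᵖ forᵖ familyᵖ (forᵖ (groundᵖ ↑ 2) (entryᵖ (familyᵖ ↑ 4) (var 2) (var 0)))
            ,ᵖ targetᵖ

  frequentᵖ = notᵖ (sumᵖ (forᵖ groundᵖ
    (monusᵖ (sumᵖ (forᵖ (familyᵖ ↑ 2) (entryᵖ (familyᵖ ↑ 4) (var 0) (var 2)))) (natᵖ p))))

  validᵖ = andᵖ (eqᵖ canonicalᵖ (var 0)) frequentᵖ

  -- One cell in front of the unary k gives the list of k + 1 slots.
  globalᵖ = familyᵖ ,ᵖ groundᵖ ,ᵖ targetᵖ ,ᵖ paramᵖ ,ᵖ (natᵖ 0 ,ᵖ var 1) ,ᵖ natᵖ 0

  reductionᵖ = (ifᵖ validᵖ then edgesᵖ p ∘ᵖ globalᵖ else natᵖ 1) ,ᵖ powᵖ paramᵖ p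

  -- Truncated subtraction makes this sum vanish exactly when every frequency is at most p.
  excess : Val → ℕ
  excess x = ∑ (elements x) λ e → ∑ (sets x) (λ i → 𝟙 (inSet x i e)) ∸ p

  canonicalVal : Val → Val
  canonicalVal x = coverVal (elements x) (sets x) (inSet x) (target x)

  module _ (x : Val) (k : ℕ) where

    ρ : Val
    ρ = x ∙ unary k ∙ num 0

    ⟦canonicalᵖ⟧ : ⟦ canonicalᵖ ⟧ ρ ≡ canonicalVal x
    ⟦canonicalᵖ⟧ = cong₂ _∙_ (map≡listOf (apply left x) λ _ _ → refl) (cong₂ _∙_
      (map≡listOf (apply left (apply right x)) λ i _ → map≡listOf (apply left x) λ e _ →
        ⟦entryᵖ⟧ (familyᵖ ↑ 4) (var 2) (var 0)
          (num e ∙ nthᵛ (apply left x) e ∙ num i ∙ nthᵛ (apply left (apply right x)) i ∙ ρ) refl refl)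
      (⟦toNumᵖ⟧ (apply right (apply right x))))

    ⟦frequentᵖ⟧ : ⟦ frequentᵖ ⟧ ρ ≡ bitVal (excess x ≡ᵇ 0)
    ⟦frequentᵖ⟧ = zero-bit (cong num (sum-map (apply left x) λ e _ → cong (λ t → num (t ∸ p))
      (sum-map (apply left (apply right x)) λ i _ →
        ⟦entryᵖ⟧ (familyᵖ ↑ 4) (var 0) (var 2)
          (num i ∙ nthᵛ (apply left (apply right x)) i ∙ num e ∙ nthᵛ (apply left x) e ∙ ρ) refl refl)))

    valid : Bool
    valid = eqᵛ (canonicalVal x) x ∧ (excess x ≡ᵇ 0)

    ⟦validᵖ⟧ : ⟦ validᵖ ⟧ ρ ≡ bitVal valid
    ⟦validᵖ⟧ = and-bit (cong (λ y → bitVal (eqᵛ y x)) ⟦canonicalᵖ⟧) ⟦frequentᵖ⟧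

    ⟦paramᵖ⟧ : ⟦ paramᵖ ⟧ ρ ≡ num (suc k)
    ⟦paramᵖ⟧ = cong (num ∘ suc) (trans (count-map (unary k)) (len-listOf k _))

    ⟦globalᵖ⟧ : ⟦ globalᵖ ⟧ ρ ≡
      apply left (apply right x) ∙ apply left x ∙ num (target x) ∙ num (suc k) ∙ (num 0 ∙ unary k) ∙ num 0
    ⟦globalᵖ⟧ = cong₂ (λ L B → apply left (apply right x) ∙ apply left x ∙ L ∙ B ∙ (num 0 ∙ unary k) ∙ num 0)
      (⟦toNumᵖ⟧ (apply right (apply right x))) ⟦paramᵖ⟧

    frequent : excess x ≡ 0 → Frequencyℕ p (elements x) (sets x) (inSet x)
    frequent eq e e<n = m∸n≡0⇒m≤n (∑-≡0 (elements x) _ eq e<n)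

    valid⇒ : valid ≡ true → ValidCover x × excess x ≡ 0
    valid⇒ eq with ∧-elim {eqᵛ (canonicalVal x) x} eq
    ... | canonical , freq = eqᵛ-sound _ x canonical , ≡ᵇ-sound freq

    ⇒valid : ∀ {k′} → CoverCondition p x k′ → valid ≡ true
    ⇒valid (canonical , freq , _) = ∧-intro
      (trans (cong (λ y → eqᵛ y x) canonical) (eqᵛ-refl x))
      (≡ᵇ-complete (∑-zero (elements x) λ e e<n → m≤n⇒m∸n≡0 (freq e e<n)))

    graph : Val
    graph = if valid then ⟦ edgesᵖ p ⟧ (⟦ globalᵖ ⟧ ρ) else num 1

    reduced : ⟦ reductionᵖ ⟧ ρ ≡ graph ∙ num (suc k ^ p)
    reduced = cong₂ _∙_ (if-bit valid ⟦validᵖ⟧) (⟦powᵖ⟧ paramᵖ p ρ ⟦paramᵖ⟧)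

    equivalent : MaxCover p x k ⇔ Clique graph (suc k ^ p)
    equivalent with valid in eq
    ... | true  = subst (λ y → MaxCover p x k ⇔ Clique (⟦ edgesᵖ p ⟧ y) (suc k ^ p)) (sym ⟦globalᵖ⟧)
      (Membership.cover⇔Clique p 0<p (apply left (apply right x)) (apply left x) (target x) k freq
        ⇔-∘ (mk⇔ (proj₂ ∘ proj₂) (λ cover → proj₁ (valid⇒ eq) , freq , cover) ⇔-∘ MaxCover⇔ p x k))
      where
      freq : Frequencyℕ p (elements x) (sets x) (inSet x)
      freq = frequent (proj₂ (valid⇒ eq))
    -- A graph without vertices has code `num 0` and any other code is a pair, so `num 1` encodes no
    -- graph.
    ... | false = mk⇔
      (λ c → contradiction (trans (sym eq) (⇒valid (Equivalence.to (MaxCover⇔ p x k) c))) λ ())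
      (λ c → contradiction (proj₁ (Equivalence.to (Clique⇔ (num 1) (suc k ^ p)) c)) λ ())

MaxCover-to-Clique : ∀ p → 0 < p → UnaryReduction (MaxCover p) Clique
MaxCover-to-Clique p 0<p = record
  { reduction = reductionᵖ
  ; parameter = (κ 1 ⊕ X) ^ₚ p
  ; correct   = λ x k → graph x k ,
      subst (λ k′ → ⟦ reductionᵖ ⟧ (x ∙ unary k ∙ num 0) ≡ graph x k ∙ num k′ ×
                    (MaxCover p x k ⇔ Clique (graph x k) k′))
        (sym (eval-^ₚ (κ 1 ⊕ X) p k)) (reduced x k , equivalent x k)
  }
  where open CoverToClique p 0<p

mainTheorem1 : ∀ (p : ℕ) → 2 < p → W[1]-complete (MaxCover p)
mainTheorem1 p 2<p =
  unary⇒≤fpt (MaxCover-to-Clique p (≤-trans (s≤s z≤n) 2<p)) ,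
  λ B B∈W[1] → ≤fpt-∘ B∈W[1] (Clique-to-MaxCover p (<⇒≤ 2<p))
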